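{- For every $n\ge 1$ the genus distribution of the cross $R_n$ is unimodal, and its peak $p_R(n)$ is $$p_R(n)=\begin{cases}\Big[\dfrac{n+1}{2}\Big], & 1\le n\le 6,\\[2mm] 3, & n=7,\\[1mm] \Big[\dfrac{n+2}{3}\Big]+1, & n\ge 8.\end{cases}$$
   Context: $[x]$ denotes the largest integer not exceeding $x$. The cross $R_n$ is the cubic multigraph consisting of a cycle of length $2n+2$ whose vertices in cyclic order are $w,u_1,u_2,\dots,u_n,v_n,v_{n-1},\dots,v_1,w'$, together with the edges $u_lv_{n-l+1}$ for $1\le l\le n$ and one additional edge joining $w$ and $w'$ (so $w,w'$ are joined by two parallel edges). For a graph $G$, $g_i(G)$ is the number of 2-cell embeddings of $G$ on the orientable surface of genus $i$ (embeddings counted as rotation systems), and the genus distribution of $G$ is the sequence $g_\gamma(G),g_{\gamma+1}(G),\dots,g_{\gamma_M}(G)$ with $\gamma,\gamma_M$ the minimum and maximum genus of $G$. A finite sequence of nonnegative numbers $\{a_i\}_{i=q}^n$ is unimodal if $a_q\le\cdots\le a_{l-1}<a_l=\cdots=a_m>a_{m+1}\ge\cdots\ge a_n$ for some $q\le l\le m\le n$; if $l=m$, then $m$ is called the peak (indices are genera). -}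

module Defs where

open import Data.Bool.Base using (Bool; true; false; not; if_then_else_)
import Data.Bool.Properties as Bool
open import Data.Fin.Base using (Fin; zero; suc; inject₁; fromℕ; opposite; _↑ˡ_; _↑ʳ_; splitAt)
import Data.Fin.Properties as Fin
open import Data.List.Base
  using (List; []; _∷_; [_]; map; concatMap; filter; length; allFin; iterate; deduplicate; cartesianProduct; cartesianProductWith)
import Data.List.Membership.DecPropositional as DecMembership
open import Data.Nat.Base using (ℕ; zero; suc; _+_; _*_; _/_; _≤_; _<_; _≤ᵇ_; _≡ᵇ_)
import Data.Nat.Properties as ℕ
open import Data.Product.Base using (_×_; _,_; ∃₂; proj₁; proj₂)
import Data.Product.Properties as Product
open import Data.Sum.Base using ([_,_]′)
open import Data.Vec.Base using (Vec; []; _∷_; lookup)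
open import Function.Base using (_∘_)
open import Relation.Binary.Definitions using (DecidableEquality)
open import Relation.Binary.PropositionalEquality.Core using (_≡_)
open import Relation.Nullary.Decidable.Core using (Dec; does)

-- Parallel edges and loops are allowed.
record Multigraph : Set where
  field
    order size : ℕ
    ends       : Fin size → Fin order × Fin order

insertions : {A : Set} → A → List A → List (List A)
insertions x []       = [ x ∷ [] ]
insertions x (y ∷ ys) = (x ∷ y ∷ ys) ∷ map (y ∷_) (insertions x ys)

permutations : {A : Set} → List A → List (List A)
permutations []       = [ [] ]
permutations (x ∷ xs) = concatMap (insertions x) (permutations xs)

-- Every cyclic order of a repetition-free list has exactly one linear
-- representative that keeps the first element in front.
cyclicOrders : {A : Set} → List A → List (List A)
cyclicOrders []       = [ [] ]
cyclicOrders (x ∷ xs) = map (x ∷_) (permutations xs)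

choices : {A : Set} {k : ℕ} → (Fin k → List A) → List (Vec A k)
choices {k = zero}  f = [ [] ]
choices {k = suc _} f = cartesianProductWith _∷_ (f zero) (choices (f ∘ suc))

module _ {A : Set} (_≟_ : DecidableEquality A) where

  -- The argument c is the element that follows the last one.  The value
  -- for an x outside the list is irrelevant.
  successor : A → List A → A → A
  successor c []           x = c
  successor c (y ∷ [])     x = c
  successor c (y ∷ z ∷ zs) x = if does (y ≟ x) then z else successor c (z ∷ zs) x

  cyclicSuccessor : List A → A → A
  cyclicSuccessor []       x = x
  cyclicSuccessor (y ∷ ys) x = successor y (y ∷ ys) x

module Embeddings (G : Multigraph) where
  open Multigraph G

  -- An edge end: (e , false) lies at proj₁ (ends e), (e , true) at
  -- proj₂ (ends e).
  Dart : Set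
  Dart = Fin size × Bool

  _≟ᵈ_ : DecidableEquality Dart
  _≟ᵈ_ = Product.≡-dec Fin._≟_ Bool._≟_

  open DecMembership _≟ᵈ_ using (_∈?_)

  darts : List Dart
  darts = cartesianProduct (allFin size) (false ∷ true ∷ [])

  vertexOf : Dart → Fin order
  vertexOf (e , false) = proj₁ (ends e)
  vertexOf (e , true)  = proj₂ (ends e)

  mate : Dart → Dart
  mate (e , b) = e , not b

  dartsAt : Fin order → List Dart
  dartsAt v = filter (λ d → vertexOf d Fin.≟ v) darts

  -- A cyclic order of the edge ends at every vertex; `rotationSystems` lists
  -- each rotation system exactly once.
  RotationSystem : Set
  RotationSystem = Vec (List Dart) order

  rotationSystems : List RotationSystem
  rotationSystems = choices (cyclicOrders ∘ dartsAt)

  module _ (ρ : RotationSystem) where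

    rotate : Dart → Dart
    rotate d = cyclicSuccessor _≟ᵈ_ (lookup ρ (vertexOf d)) d

    faceStep : Dart → Dart
    faceStep = rotate ∘ mate

    -- `faceStep` permutes the darts, so its orbits have at most
    -- `length darts` elements.
    faceBoundary : Dart → List Dart
    faceBoundary d = iterate faceStep d (length darts)

    faces : ℕ
    faces = length (deduplicate (λ d d′ → d′ ∈? faceBoundary d) darts)

    -- Euler's formula  order − size + faces = 2 − 2 g,  valid for a connected
    -- graph with at least one edge.
    HasGenus : ℕ → Set
    HasGenus g = order + faces + 2 * g ≡ size + 2

    hasGenus? : (g : ℕ) → Dec (HasGenus g)
    hasGenus? g = order + faces + 2 * g ℕ.≟ size + 2

  embeddingCount : ℕ → ℕ
  embeddingCount g = length (filter (λ ρ → hasGenus? ρ g) rotationSystems)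

  IsMinimumGenus : ℕ → Set
  IsMinimumGenus γ = 0 < embeddingCount γ × (∀ i → i < γ → embeddingCount i ≡ 0)

  IsMaximumGenus : ℕ → Set
  IsMaximumGenus γ = 0 < embeddingCount γ × (∀ i → γ < i → embeddingCount i ≡ 0)

open Embeddings public using (embeddingCount; IsMinimumGenus; IsMaximumGenus)

-- a q ≤ ⋯ ≤ a (l - 1) < a l = ⋯ = a m > a (m + 1) ≥ ⋯ ≥ a n; a strict
-- inequality is void when l = q, respectively m = n.
record UnimodalWith (q n : ℕ) (a : ℕ → ℕ) (l m : ℕ) : Set where
  field
    q≤l     : q ≤ l
    l≤m     : l ≤ m
    m≤n     : m ≤ n
    rising  : ∀ i → q ≤ i → suc i < l → a i ≤ a (suc i)
    rise    : ∀ i → q ≤ i → suc i ≡ l → a i < a l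
    plateau : ∀ i → l ≤ i → i ≤ m → a i ≡ a l
    fall    : m < n → a (suc m) < a m
    falling : ∀ i → m < i → i < n → a (suc i) ≤ a i

Unimodal : (q n : ℕ) → (ℕ → ℕ) → Set
Unimodal q n a = ∃₂ λ l m → UnimodalWith q n a l m

IsPeak : (q n : ℕ) → (ℕ → ℕ) → ℕ → Set
IsPeak q n a p = UnimodalWith q n a p p

-- The vertices are numbered in the order in which they occur on the cycle
-- w, u₁, …, uₙ, vₙ, …, v₁, w′.  Indices of u and v are shifted to start from
-- 0, so `opposite l` is the shift of n - l + 1.
module Cross (n : ℕ) where

  Vertex : Set
  Vertex = Fin (suc (n + suc n))

  w w′ : Vertex
  w  = zero
  w′ = suc (n ↑ʳ fromℕ n)

  u v : Fin n → Vertex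
  u l = suc (l ↑ˡ suc n)
  v l = suc (n ↑ʳ inject₁ (opposite l))

  -- The edges are those of the path from w to w′ along the cycle, the chords,
  -- and the two parallel edges joining w and w′, one of which closes the cycle.
  cross : Multigraph
  cross = record
    { order = suc (n + suc n)
    ; size  = (n + suc n) + (n + 2)
    ; ends  = [ (λ k → inject₁ k , suc k)
              , [ (λ l → u l , v (opposite l)) , (λ _ → w′ , w) ]′ ∘ splitAt n
              ]′ ∘ splitAt (n + suc n)
    }

open Cross public using (cross)

crossPeak : ℕ → ℕ
crossPeak n =
  if n ≤ᵇ 6 then (n + 1) / 2
  else if n ≡ᵇ 7 then 3
  else (n + 2) / 3 + 1

{-# OPTIONS --safe #-}
-- The 2-colourings of the darts that are constant along the faces number 2^faces.
-- Cut the path w, u₁, …, uₙ, x₁, …, xₙ, w′ (the chords are uₗxₗ) behind uₗ and behind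
-- xₗ: the faces cross the cut along four strands, and the rotations at uₗ and xₗ
-- either swap two strands or join two of them and create a new pair.  Hence the
-- faces are the loops of a Brauer-like diagram with 24 states, closed by a twist, or
-- by a hook at each end when the rotations at w and w′ agree.  Counting loops by a
-- transfer recursion gives the genus polynomial of R_{n+1},
--   2 (z main + (1 − z) minor + lower-order corrections),
-- whose dominant term has the coefficients 2ⁿ⁺¹ (F_{n+2}(i) + 4 F_{n-1}(i - 1)) with
-- F_m(i) = 2ⁱ binom(m - i, i), while minor has 4ⁱ instead of 2ⁿ⁺¹.  The ratio of
-- consecutive F_m(i) is rational and crosses 1 at the peak, for both summands at the
-- same i; away from the peak it deviates from 1 by far more than the minor term can
-- compensate once n + 1 ≥ 80.  Below that bound the closed form is evaluated.

module Submission where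

open import Defs
open import Data.Bool.Base using (Bool; true; false; not; if_then_else_; _∧_; _∨_; _xor_; T)
import Data.Bool.Properties as Bool
open import Data.Fin.Base using (Fin; zero; suc; toℕ; inject₁; fromℕ; splitAt; _↑ˡ_; _↑ʳ_)
open import Data.Fin.Patterns using (0F; 1F)
import Data.Fin.Properties as Fin
import Data.Fin.Relation.Unary.Top as Top
open import Data.List.Base using (List; []; _∷_; [_]; _++_; map; concatMap; filter; filterᵇ; length; lookup; iterate; deduplicate; cartesianProduct; cartesianProductWith; tabulate)
import Data.List.Membership.DecPropositional as DecMembership
open import Data.List.Membership.Propositional using (_∈_)
open import Data.List.Membership.Propositional.Properties using (∈-filter⁺; ∈-filter⁻; ∈-cartesianProduct⁺; ∈-allFin)
import Data.List.Properties as List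
import Data.List.Relation.Unary.All as All
open import Data.List.Relation.Unary.All using (All; []; _∷_)
import Data.List.Relation.Unary.All.Properties as All
open import Data.List.Relation.Unary.AllPairs using (AllPairs; []; _∷_)
import Data.List.Relation.Unary.AllPairs.Properties as AllPairs
import Data.List.Relation.Unary.Any as Any
open import Data.List.Relation.Unary.Any using (Any; here; there)
import Data.List.Relation.Unary.Any.Properties as Any
open import Data.Maybe.Base using (Maybe; just; nothing)
open import Data.Nat.Base using (ℕ; zero; suc; _+_; _*_; _∸_; _^_; _/_; _≤_; _<_; _≡ᵇ_; _≤ᵇ_; _<ᵇ_; z≤n; s≤s; >-nonZero)
open import Data.Nat.Divisibility.Core using (divides)
open import Data.Nat.DivMod using (m*n/n≡m; /-monoˡ-≤; m/n*n≤m; +-distrib-/-∣ʳ)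
open import Data.Nat.ListAction using (sum)
open import Data.Nat.ListAction.Properties using (sum-++)
import Data.Nat.Properties as ℕ
open import Data.Nat.Solver using (module +-*-Solver)
open import Data.Nat.Tactic.RingSolver using (solve-∀)
open import Data.Product.Base using (_×_; _,_; ∃; ∃₂; ∃-syntax; Σ; proj₁; proj₂)
open import Data.Sum.Base using (_⊎_; inj₁; inj₂; [_,_]′)
open import Data.Sum.Function.Propositional using (_⊎-↔_)
open import Data.Unit.Base using (tt)
open import Data.Vec.Base as Vec using (Vec; []; _∷_)
import Data.Vec.Properties as Vec
open import Function.Base using (_∘_; id)
open import Function.Bundles using (_↔_; mk↔ₛ′; module Inverse; _⇔_; mk⇔; module Equivalence)
open import Function.Construct.Composition using (_↔-∘_)
open import Function.Construct.Identity using (↔-id)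
open import Relation.Binary.Definitions using (DecidableEquality; tri<; tri≈; tri>)
open import Relation.Binary.PropositionalEquality hiding ([_])
open import Relation.Nullary using (¬_; yes; no; contradiction)
open import Relation.Nullary.Decidable using (¬?; does; does-⇔)

-- Colourings replace faces because `faces` is defined by global orbits, whereas invariance under
-- `faceStep` is a conjunction of conditions at single vertices: it can be cut along the path and
-- glued again. The invariant colourings are enumerated twice, by faces and by strand colours, and
-- `2^-injective` recovers the number of faces. Euler's formula enters through a potential on the
-- states, so that every step costs 0 or 1 handles and the counts become polynomials in z with
-- linear recurrences. The obstacle is the minor term. At genus i, with k = n + 1 - 2 i, the main
-- term exceeds it by a factor of order 2^k only, which is of little use near the maximum genus.
-- Beyond the peak put e + 1 = 3 i - (n + 3); there the main term drops by the relative amount (e +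
-- 1)/(e + 1 + 2 (k + 2)) at least. Since n + 3 = 2 (e + 1) + 3 (k + 2), k and e cannot both be
-- small, and this trade-off decides where the evaluation of single cases may stop. Below the peak k
-- is large anyway.

infix 1 _Enumerates_

-- Colourings are functions and are compared pointwise, so they are counted through an index type:
-- `injective` and `complete` make `colour` a bijection up to `_≗_`.
record _Enumerates_ (I : Set) {A : Set} (P : (A → Bool) → Set) : Set where
  field
    colour    : I → A → Bool
    satisfies : ∀ i → P (colour i)
    injective : ∀ {i j} → colour i ≗ colour j → i ≡ j
    complete  : ∀ φ → P φ → ∃ λ i → colour i ≗ φ

-- Orbits and invariant 2-colourings

module Orbits {A : Set} (_≟_ : DecidableEquality A) (f : A → A)
  (f-injective : ∀ {x y} → f x ≡ f y → x ≡ y)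
  (xs : List A) (∈xs : ∀ x → x ∈ xs) where

  open DecMembership _≟_ using (_∈?_)

  orbit : A → List A
  orbit x = iterate f x (length xs)

  infixl 8 _⟪_⟫
  _⟪_⟫ : A → ℕ → A
  x ⟪ zero ⟫ = x
  x ⟪ suc k ⟫ = f (x ⟪ k ⟫)

  ⟪⟫-shift : ∀ x k → f x ⟪ k ⟫ ≡ f (x ⟪ k ⟫)
  ⟪⟫-shift x zero    = refl
  ⟪⟫-shift x (suc k) = cong f (⟪⟫-shift x k)

  ⟪⟫-+ : ∀ x k l → x ⟪ k + l ⟫ ≡ x ⟪ l ⟫ ⟪ k ⟫
  ⟪⟫-+ x zero    l = refl
  ⟪⟫-+ x (suc k) l = cong f (⟪⟫-+ x k l)

  ∈iterate⁻ : ∀ n {x y} → y ∈ iterate f x n → ∃ λ k → y ≡ x ⟪ k ⟫ × k < n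
  ∈iterate⁻ (suc n) (here eq) = 0 , eq , s≤s z≤n
  ∈iterate⁻ (suc n) {x} (there y∈) with k , eq , k<n ← ∈iterate⁻ n y∈ =
    suc k , trans eq (⟪⟫-shift x k) , s≤s k<n

  ∈iterate⁺ : ∀ {n k} x → k < n → x ⟪ k ⟫ ∈ iterate f x n
  ∈iterate⁺ {k = zero}  x (s≤s _)   = here refl
  ∈iterate⁺ {k = suc k} x (s≤s k<n) =
    there (subst (_∈ iterate f (f x) _) (⟪⟫-shift x k) (∈iterate⁺ (f x) k<n))

  ⟪⟫-cancel : ∀ {x y} k → x ⟪ k ⟫ ≡ y ⟪ k ⟫ → x ≡ y
  ⟪⟫-cancel zero    eq = eq
  ⟪⟫-cancel (suc k) eq = ⟪⟫-cancel k (f-injective eq)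

  position : A → Fin (length xs)
  position x = Any.index (∈xs x)

  position-injective : ∀ {x y} → position x ≡ position y → x ≡ y
  position-injective {x} {y} eq = trans (Any.lookup-index (∈xs x))
    (trans (cong (lookup xs) eq) (sym (Any.lookup-index (∈xs y))))

  -- Pigeonhole on `length xs + 1` iterates gives a repetition, and injectivity of `f` cancels the
  -- common initial segment. The bound on `q` is what makes the truncated list `orbit` closed under
  -- `f`.
  period : ∀ x → ∃ λ q → x ⟪ suc q ⟫ ≡ x × q < length xs
  period x with i , j , i<j , eq ← Fin.pigeonhole (ℕ.n<1+n (length xs)) (λ k → position (x ⟪ toℕ k ⟫))
    with o , i+o≡j ← ℕ.m≤n⇒∃[o]m+o≡n i<j =
    o , sym (⟪⟫-cancel (toℕ i) (trans (position-injective eq)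
              (trans (cong (x ⟪_⟫) (sym (trans (ℕ.+-suc (toℕ i) o) i+o≡j))) (⟪⟫-+ x (toℕ i) (suc o)))))
      , ℕ.≤-trans (s≤s (ℕ.m≤n+m o (toℕ i))) (ℕ.≤-trans (ℕ.≤-reflexive i+o≡j) (ℕ.≤-pred (Fin.toℕ<n j)))

  self∈orbit : ∀ x → x ∈ orbit x
  self∈orbit x with _ , _ , q<n ← period x = ∈iterate⁺ x (ℕ.≤-<-trans z≤n q<n)

  orbit-step : ∀ {x y} → y ∈ orbit x → f y ∈ orbit x
  orbit-step {x} y∈ with k , refl , k<n ← ∈iterate⁻ (length xs) y∈ with ℕ.m≤n⇒m<n∨m≡n k<n
  ... | inj₁ 1+k<n = ∈iterate⁺ x 1+k<n
  -- The list ends at this iterate; subtracting one period from the exponent leads back into it.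
  ... | inj₂ 1+k≡n with q , eq , q<n ← period x
      with o , q+o≡n ← ℕ.m≤n⇒∃[o]m+o≡n q<n =
    subst (_∈ orbit x) back (∈iterate⁺ x (subst (suc o ≤_) q+o≡n (s≤s (ℕ.m≤n+m o q))))
    where
    back : x ⟪ o ⟫ ≡ x ⟪ suc k ⟫
    back = sym (trans (cong (x ⟪_⟫) (trans 1+k≡n (trans (sym q+o≡n) (ℕ.+-comm (suc q) o))))
                      (trans (⟪⟫-+ x o (suc q)) (cong (_⟪ o ⟫) eq)))

  orbit-back : ∀ {x y} → f y ∈ orbit x → y ∈ orbit x
  orbit-back {x} fy∈ with ∈iterate⁻ (length xs) fy∈
  ... | suc k , eq , k<n = subst (_∈ orbit x) (sym (f-injective eq)) (∈iterate⁺ x (ℕ.<-trans (ℕ.n<1+n k) k<n))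
  ... | zero  , eq , _ with q , eq′ , q<n ← period x =
    subst (_∈ orbit x) (f-injective (trans eq′ (sym eq))) (∈iterate⁺ x q<n)

  orbit-trans : ∀ {x y z} → y ∈ orbit x → z ∈ orbit y → z ∈ orbit x
  orbit-trans {x} {y} y∈ z∈ with k , refl , _ ← ∈iterate⁻ (length xs) z∈ = go k
    where
    go : ∀ k → y ⟪ k ⟫ ∈ orbit x
    go zero    = y∈
    go (suc k) = orbit-step (go k)

  Invariant : (A → Bool) → Set
  Invariant φ = ∀ x → φ (f x) ≡ φ x

  invariant-orbit : ∀ {φ x y} → Invariant φ → y ∈ orbit x → φ y ≡ φ x
  invariant-orbit {φ} {x} inv y∈ with k , refl , _ ← ∈iterate⁻ (length xs) y∈ = go k
    where
    go : ∀ k → φ (x ⟪ k ⟫) ≡ φ x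
    go zero    = refl
    go (suc k) = trans (inv _) (go k)

  Covering Separated : List A → Set
  Covering rs  = ∀ y → Any (λ r → y ∈ orbit r) rs
  Separated rs = AllPairs (λ r s → ¬ s ∈ orbit r) rs

  paint : (rs : List A) → Vec Bool (length rs) → A → Bool
  paint []       []       y = false
  paint (r ∷ rs) (c ∷ cs) y with y ∈? orbit r
  ... | yes _ = c
  ... | no  _ = paint rs cs y

  paint-invariant : ∀ rs cs → Invariant (paint rs cs)
  paint-invariant []       []       y = refl
  paint-invariant (r ∷ rs) (c ∷ cs) y with y ∈? orbit r | f y ∈? orbit r
  ... | yes _ | yes _ = refl
  ... | yes p | no ¬q = contradiction (orbit-step p) ¬q
  ... | no ¬p | yes q = contradiction (orbit-back q) ¬p
  ... | no _  | no _  = paint-invariant rs cs y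

  paint-head : ∀ r rs c cs → paint (r ∷ rs) (c ∷ cs) r ≡ c
  paint-head r rs c cs with r ∈? orbit r
  ... | yes _ = refl
  ... | no ¬p = contradiction (self∈orbit r) ¬p

  paint-tail : ∀ r rs c cs {y} → ¬ y ∈ orbit r → paint (r ∷ rs) (c ∷ cs) y ≡ paint rs cs y
  paint-tail r rs c cs {y} ¬p with y ∈? orbit r
  ... | yes p = contradiction p ¬p
  ... | no _  = refl

  paint-injective : ∀ {rs} → Separated rs → ∀ cs ds →
    (∀ {y} → y ∈ rs → paint rs cs y ≡ paint rs ds y) → cs ≡ ds
  paint-injective                []         []       []       eq = refl
  paint-injective {rs = r ∷ rs} (r∉ ∷ sep) (c ∷ cs) (d ∷ ds) eq = cong₂ _∷_
    (trans (sym (paint-head r rs c cs)) (trans (eq (here refl)) (paint-head r rs d ds)))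
    (paint-injective sep cs ds λ y∈ →
      trans (sym (paint-tail r rs c cs (All.lookup r∉ y∈)))
        (trans (eq (there y∈)) (paint-tail r rs d ds (All.lookup r∉ y∈))))

  paint-complete : ∀ {φ} → Invariant φ → ∀ rs y → Any (λ r → y ∈ orbit r) rs →
    paint rs (Vec.map φ (Vec.fromList rs)) y ≡ φ y
  paint-complete inv (r ∷ rs) y any with y ∈? orbit r
  ... | yes p = sym (invariant-orbit inv p)
  ... | no ¬p with any
  ...   | here p     = contradiction p ¬p
  ...   | there any′ = paint-complete inv rs y any′

  -- Written exactly as in `faces`, so that for `faceStep ρ` and `darts` its length is the number of
  -- faces by definition.
  representatives : List A
  representatives = deduplicate (λ x y → y ∈? orbit x) xs

  representatives-cover : Covering representatives
  representatives-cover y = Any.deduplicate⁺ (λ x y → y ∈? orbit x) orbit-trans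
    (Any.map (λ { refl → self∈orbit y }) (∈xs y))

  deduplicate-separated : ∀ ys → Separated (deduplicate (λ x y → y ∈? orbit x) ys)
  deduplicate-separated []       = []
  deduplicate-separated (y ∷ ys) =
    All.all-filter (λ z → ¬? (z ∈? orbit y)) (deduplicate _ ys)
      ∷ AllPairs.filter⁺ _ (deduplicate-separated ys)

  enumeration : Vec Bool (length representatives) Enumerates Invariant
  enumeration = record
    { colour    = paint representatives
    ; satisfies = paint-invariant representatives
    ; injective = λ eq → paint-injective (deduplicate-separated xs) _ _ (λ {y} _ → eq y)
    ; complete  = λ φ inv → _ , λ y → paint-complete inv representatives y (representatives-cover y)
    }

-- Finite sums

variable
  A B : Set

enumerations-agree : ∀ {m n} {I J : Set} {P : (A → Bool) → Set} → I Enumerates P → J Enumerates P →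
  Fin m ↔ I → Fin n ↔ J → m ≡ n
enumerations-agree {A = A} {P = P} E F e f = ℕ.≤-antisym (size≤ E F e f) (size≤ F E f e)
  where
  open _Enumerates_
  size≤ : ∀ {I J : Set} {m n} → I Enumerates P → J Enumerates P → Fin m ↔ I → Fin n ↔ J → m ≤ n
  size≤ {I} {J} E F e f = Fin.injective⇒≤ {f = λ i → Inverse.from f (move (Inverse.to e i))} λ {i} {j} eq →
    trans (sym (Inverse.strictlyInverseʳ e i))
      (trans (cong (Inverse.from e) (move-injective
        (trans (sym (Inverse.strictlyInverseˡ f _)) (trans (cong (Inverse.to f) eq) (Inverse.strictlyInverseˡ f _)))))
        (Inverse.strictlyInverseʳ e j))
    where
    move : I → J
    move i = proj₁ (complete F (colour E i) (satisfies E i))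
    same : ∀ i → colour F (move i) ≗ colour E i
    same i = proj₂ (complete F (colour E i) (satisfies E i))
    move-injective : ∀ {i j} → move i ≡ move j → i ≡ j
    move-injective {i} {j} eq = injective E λ x →
      trans (sym (same i x)) (trans (cong (λ v → colour F v x) eq) (same j x))

ΣV : ∀ m → (Vec Bool m → ℕ) → ℕ
ΣV zero    h = h []
ΣV (suc m) h = ΣV m (h ∘ (false ∷_)) + ΣV m (h ∘ (true ∷_))

ΣVec[]↔ : {P : Vec Bool 0 → Set} → P [] ↔ Σ (Vec Bool 0) P
ΣVec[]↔ = mk↔ₛ′ ([] ,_) (λ { ([] , p) → p }) (λ { ([] , p) → refl }) (λ _ → refl)

ΣVec∷↔ : ∀ {m} {P : Vec Bool (suc m) → Set} →
  (Σ (Vec Bool m) (P ∘ (false ∷_)) ⊎ Σ (Vec Bool m) (P ∘ (true ∷_))) ↔ Σ (Vec Bool (suc m)) P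
ΣVec∷↔ = mk↔ₛ′ [ (λ (v , p) → false ∷ v , p) , (λ (v , p) → true ∷ v , p) ]′
  (λ { (false ∷ v , p) → inj₁ (v , p) ; (true ∷ v , p) → inj₂ (v , p) })
  (λ { (false ∷ v , p) → refl ; (true ∷ v , p) → refl }) (λ { (inj₁ p) → refl ; (inj₂ p) → refl })

ΣV-card : ∀ m {h} {P : Vec Bool m → Set} → (∀ v → Fin (h v) ↔ P v) → Fin (ΣV m h) ↔ Σ (Vec Bool m) P
ΣV-card zero    c = ΣVec[]↔ ↔-∘ c []
ΣV-card (suc m) c = ΣVec∷↔ ↔-∘ ((ΣV-card m (c ∘ (false ∷_)) ⊎-↔ ΣV-card m (c ∘ (true ∷_))) ↔-∘ Fin.+↔⊎)

if-card : ∀ b {k} {P : Set} → Fin k ↔ P → Fin (if b then k else 0) ↔ (T b × P)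
if-card true  c = mk↔ₛ′ (tt ,_) proj₂ (λ _ → refl) (λ _ → refl) ↔-∘ c
if-card false c = mk↔ₛ′ (λ ()) (λ ()) (λ ()) (λ ())

T-card : ∀ b → Fin (if b then 1 else 0) ↔ T b
T-card true  = Fin.1↔⊤
T-card false = Fin.0↔⊥

bits↔ : ∀ m → Fin (2 ^ m) ↔ Vec Bool m
bits↔ m = mk↔ₛ′ proj₁ (_, tt) (λ _ → refl) (λ _ → refl)
  ↔-∘ (ΣV-card m (λ _ → Fin.1↔⊤) ↔-∘ subst (λ k → Fin (2 ^ m) ↔ Fin k) (sym (ones m)) (↔-id _))
  where
  ones : ∀ m → ΣV m (λ _ → 1) ≡ 2 ^ m
  ones zero    = refl
  ones (suc m) = cong₂ _+_ (ones m) (trans (ones m) (sym (ℕ.+-identityʳ _)))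

allV : ∀ m → List (Vec Bool m)
allV zero    = [ [] ]
allV (suc m) = map (false ∷_) (allV m) ++ map (true ∷_) (allV m)

sumOver : List A → (A → ℕ) → ℕ
sumOver xs h = sum (map h xs)

sumOver-++ : ∀ (xs ys : List A) h → sumOver (xs ++ ys) h ≡ sumOver xs h + sumOver ys h
sumOver-++ xs ys h = trans (cong sum (List.map-++ h xs ys)) (sum-++ (map h xs) (map h ys))

sumOver-map : ∀ (f : A → B) xs h → sumOver (map f xs) h ≡ sumOver xs (h ∘ f)
sumOver-map f xs h = cong sum (sym (List.map-∘ xs))

sumOver-cong : ∀ (xs : List A) {h h′} → h ≗ h′ → sumOver xs h ≡ sumOver xs h′
sumOver-cong xs eq = cong sum (List.map-cong eq xs)

sumOver-concatMap : ∀ (f : A → List B) xs h → sumOver (concatMap f xs) h ≡ sumOver xs λ x → sumOver (f x) h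
sumOver-concatMap f []       h = refl
sumOver-concatMap f (x ∷ xs) h =
  trans (sumOver-++ (f x) _ h) (cong (sumOver (f x) h +_) (sumOver-concatMap f xs h))

sumOver-filterᵇ : ∀ (p : A → Bool) xs h → sumOver (filterᵇ p xs) h ≡ sumOver xs λ x → if p x then h x else 0
sumOver-filterᵇ p []       h = refl
sumOver-filterᵇ p (x ∷ xs) h with p x
... | true  = cong (h x +_) (sumOver-filterᵇ p xs h)
... | false = sumOver-filterᵇ p xs h

ΣV≡sumOver : ∀ m h → ΣV m h ≡ sumOver (allV m) h
ΣV≡sumOver zero    h = sym (ℕ.+-identityʳ (h []))
ΣV≡sumOver (suc m) h = trans
  (cong₂ _+_ (trans (ΣV≡sumOver m _) (sym (sumOver-map (false ∷_) (allV m) h)))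
             (trans (ΣV≡sumOver m _) (sym (sumOver-map (true ∷_) (allV m) h))))
  (sym (sumOver-++ (map (false ∷_) (allV m)) (map (true ∷_) (allV m)) h))

ΣV-cong : ∀ m {h h′} → h ≗ h′ → ΣV m h ≡ ΣV m h′
ΣV-cong zero    eq = eq []
ΣV-cong (suc m) eq = cong₂ _+_ (ΣV-cong m (eq ∘ (false ∷_))) (ΣV-cong m (eq ∘ (true ∷_)))

-- The list on the right is independent of `h` and evaluates once `p` and `f` are concrete, so
-- `matches-sum` can compare such sums by computation.
ΣVΣV≡sumOver : ∀ m n (p : Vec Bool m → Vec Bool n → Bool) (f : Vec Bool m → Vec Bool n → A) (h : A → ℕ) →
  ΣV m (λ v → ΣV n λ w → if p v w then h (f v w) else 0) ≡
  sumOver (concatMap (λ v → map (f v) (filterᵇ (p v) (allV n))) (allV m)) h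
ΣVΣV≡sumOver m n p f h = trans (ΣV≡sumOver m _) (trans
  (sumOver-cong (allV m) λ v → trans (ΣV≡sumOver n _)
    (trans (sym (sumOver-filterᵇ (p v) (allV n) (h ∘ f v))) (sym (sumOver-map (f v) (filterᵇ (p v) (allV n)) h))))
  (sym (sumOver-concatMap (λ v → map (f v) (filterᵇ (p v) (allV n))) (allV m) h)))

infix 7 _==_
_==_ : Bool → Bool → Bool
x == y = not (x xor y)

==⇒≡ : ∀ {x y} → T (x == y) → x ≡ y
==⇒≡ {false} {false} _ = refl
==⇒≡ {true}  {true}  _ = refl

==-refl : ∀ x → T (x == x)
==-refl false = tt
==-refl true  = tt

-- Equality of finite multisets

module Matching {A : Set} (_≈_ : A → A → Bool) (≈⇒≡ : ∀ {x y} → T (x ≈ y) → x ≡ y) where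

  delete : A → List A → Maybe (List A)
  delete x [] = nothing
  delete x (y ∷ ys) with x ≈ y | delete x ys
  ... | true  | _        = just ys
  ... | false | just ys′ = just (y ∷ ys′)
  ... | false | nothing  = nothing

  matches : List A → List A → Bool
  matches []       []      = true
  matches []       (_ ∷ _) = false
  matches (x ∷ xs) ys with delete x ys
  ... | just ys′ = matches xs ys′
  ... | nothing  = false

  delete-sum : ∀ x ys {ys′} h → delete x ys ≡ just ys′ → sumOver ys h ≡ h x + sumOver ys′ h
  delete-sum x (y ∷ ys) h eq with x ≈ y in x≈y | delete x ys in del
  delete-sum x (y ∷ ys) h refl | true | _ with refl ← ≈⇒≡ {x} {y} (subst T (sym x≈y) tt) = refl
  delete-sum x (y ∷ ys) {_ ∷ ys′} h refl | false | just _ = begin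
    h y + sumOver ys h            ≡⟨ cong (h y +_) (delete-sum x ys h del) ⟩
    h y + (h x + sumOver ys′ h)   ≡⟨ ℕ.+-assoc (h y) (h x) _ ⟨
    h y + h x + sumOver ys′ h     ≡⟨ cong (_+ sumOver ys′ h) (ℕ.+-comm (h y) (h x)) ⟩
    h x + h y + sumOver ys′ h     ≡⟨ ℕ.+-assoc (h x) (h y) _ ⟩
    h x + (h y + sumOver ys′ h)   ∎
    where open ≡-Reasoning

  -- One Boolean check settles the equality for every `h` at once; in the application `h` counts the
  -- colourings of a remainder of unknown length.
  matches-sum : ∀ xs ys h → T (matches xs ys) → sumOver xs h ≡ sumOver ys h
  matches-sum []       []       h _ = refl
  matches-sum (x ∷ xs) ys h t with delete x ys in del
  ... | just ys′ = trans (cong (h x +_) (matches-sum xs ys′ h t)) (sym (delete-sum x ys h del))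

-- Strand diagrams

Rotations : Set
Rotations = Bool × Bool

Colours : Set
Colours = Vec Bool 4

-- The colour conditions at a vertex with edge ends p, q, r, in this cyclic
-- order or in the opposite one; p′ is the colour of the mate of p.
around : Bool → (p p′ q q′ r r′ : Bool) → Bool
around false p p′ q q′ r r′ = q == p′ ∧ r == q′ ∧ p == r′
around true  p p′ q q′ r r′ = r == p′ ∧ q == r′ ∧ p == q′

-- t, b are the colours of the two ends of the path edge behind uₗ and s, d those
-- of the path edge behind xₗ; y, y′ are the colours of the two ends of the chord.
advance : Rotations → Colours → Colours → Vec Bool 2 → Bool
advance (α , β) (t ∷ b ∷ s ∷ d ∷ []) (t′ ∷ b′ ∷ s′ ∷ d′ ∷ []) (y ∷ y′ ∷ []) =
  around α b t t′ b′ y y′ ∧ around β d s s′ d′ y′ y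

-- The two halves of the path are glued with a twist.
glued : Colours → Colours → Bool
glued (t ∷ b ∷ s ∷ d ∷ []) (t′ ∷ b′ ∷ s′ ∷ d′ ∷ []) = t′ == s ∧ b′ == d ∧ s′ == t ∧ d′ == b

-- The initial colours `i` are carried along because the end of either half of the path is glued to
-- the beginning of the other half.
data Chain : List Rotations → Colours → Colours → Set where
  finish : ∀ {i c} → T (glued i c) → Chain [] i c
  pass   : ∀ {g gs i c} c′ y → T (advance g c c′ y) → Chain gs i c′ → Chain (g ∷ gs) i c

chains : List Rotations → Colours × Colours → ℕ
chains []       (i , c) = if glued i c then 1 else 0
chains (g ∷ gs) (i , c) = ΣV 4 λ c′ → ΣV 2 λ y → if advance g c c′ y then chains gs (i , c′) else 0

chains-card : ∀ gs i c → Fin (chains gs (i , c)) ↔ Chain gs i c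
chains-card []       i c =
  mk↔ₛ′ finish (λ { (finish t) → t }) (λ { (finish t) → refl }) (λ _ → refl) ↔-∘ T-card (glued i c)
chains-card (g ∷ gs) i c =
  mk↔ₛ′ (λ (c′ , y , t , ch) → pass c′ y t ch) (λ { (pass c′ y t ch) → c′ , y , t , ch })
    (λ { (pass c′ y t ch) → refl }) (λ { (c′ , y , t , ch) → refl }) ↔-∘ ΣV-card 4 λ c′ → ΣV-card 2 λ y → if-card (advance g c c′ y) (chains-card gs i c′)

-- The colours of the chord are forgotten, but the number of admissible ones survives as the
-- multiplicity of the entry.
extensions : Rotations → Colours × Colours → List (Colours × Colours)
extensions g (i , c) = concatMap (λ c′ → map (λ _ → i , c′) (filterᵇ (advance g c c′) (allV 2))) (allV 4)

chains-∷ : ∀ g gs x → chains (g ∷ gs) x ≡ sumOver (extensions g x) (chains gs)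
chains-∷ g gs (i , c) = ΣVΣV≡sumOver 4 2 (advance g c) (λ c′ _ → i , c′) (chains gs)

-- The strands t, s (and likewise b, d) are numbered false, true.  In `through σ τ`
-- all four strands run from the initial to the current position; in
-- `hooked i j k l` the current strands i, j and the initial strands k, l are
-- joined to each other; in `split m k` all strands are, t with b if m (or k,
-- at the initial end) is false and t with d if it is true.
data State : Set where
  through : (σ τ : Bool) → State
  hooked  : (i j k l : Bool) → State
  split   : (m k : Bool) → State

strands : Bool → Bool → Bool → Bool → Bool → Bool → Colours
strands i j x x′ y y′ = at i x x′ ∷ at j y y′ ∷ at i x′ x ∷ at j y′ y ∷ []
  where
  at : Bool → Bool → Bool → Bool
  at false x x′ = x
  at true  x x′ = x′

-- Faces run in one direction along t, s and in the other along b, d. Hence a through strand stays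
-- in its pair and a hook joins one strand of each pair, which leaves the 4 + 16 + 4 = 24 walled
-- Brauer diagrams on 2 + 2 strands.
colourings : State → List (Colours × Colours)
colourings (through σ τ) = map
  (λ { (x ∷ x′ ∷ y ∷ y′ ∷ []) → strands false false x x′ y y′ , strands σ τ x x′ y y′ }) (allV 4)
colourings (hooked i j k l) = map
  (λ { (c ∷ e ∷ x ∷ y ∷ []) → strands k l e x e y , strands i j c x c y }) (allV 4)
colourings (split m k) = map
  (λ { (c ∷ c′ ∷ e ∷ e′ ∷ []) → strands false k e e′ e e′ , strands false m c c′ c c′ }) (allV 4)

-- By the conditions in `advance`, (false , false) exchanges b and d, and (true , true) exchanges t
-- and s; (true , false) joins the old t and d and opens a new hook between t and d, and (false ,
-- true) does the same with s and b.
next : Rotations → State → State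
next (false , false) (through σ τ)             = through σ (not τ)
next (true  , true)  (through σ τ)             = through (not σ) τ
next (true  , false) (through σ τ)             = hooked false true σ (not τ)
next (false , true)  (through σ τ)             = hooked true false (not σ) τ
next (false , false) (hooked i j k l)          = hooked i (not j) k l
next (true  , true)  (hooked i j k l)          = hooked (not i) j k l
next (true  , false) (hooked true false k l)   = split true (k xor l)
next (true  , false) (hooked _ _ k l)          = hooked false true k l
next (false , true)  (hooked false true k l)   = split true (k xor l)
next (false , true)  (hooked _ _ k l)          = hooked true false k l
next (false , false) (split m k)               = split (not m) k
next (true  , true)  (split m k)               = split (not m) k
next (true  , false) (split m k)               = split true k
next (false , true)  (split m k)               = split true k

loop : Rotations → State → Bool
loop (true  , false) (hooked false true _ _) = true
loop (false , true)  (hooked true false _ _) = true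
loop (true  , false) (split m _)             = m
loop (false , true)  (split m _)             = m
loop _               _                       = false

bit : Bool → ℕ
bit b = if b then 1 else 0

-- The gluing exchanges t with s and b with d, so through strands that arrive exchanged close up
-- separately and the others merge into one loop.
closingLoops : State → ℕ
closingLoops (through σ τ)    = 2 + bit σ + bit τ
closingLoops (hooked i j k l) = 1 + bit (i xor k) + bit (j xor l)
closingLoops (split m k)      = 2 ∸ bit (m xor k)

loops : State → List Rotations → ℕ
loops s []       = closingLoops s
loops s (g ∷ gs) = bit (loop g s) + loops (next g s) gs

infix 7 _≈ᵛ_ _≈ᵖ_
_≈ᵛ_ : ∀ {n} → Vec Bool n → Vec Bool n → Bool
[]       ≈ᵛ []       = true
(x ∷ xs) ≈ᵛ (y ∷ ys) = x == y ∧ xs ≈ᵛ ys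

T-∧⁻ : ∀ {x y} → T (x ∧ y) → T x × T y
T-∧⁻ = Equivalence.to Bool.T-∧

T-∧⁺ : ∀ {x y} → T x → T y → T (x ∧ y)
T-∧⁺ p q = Equivalence.from Bool.T-∧ (p , q)

≈ᵛ⇒≡ : ∀ {n} {xs ys : Vec Bool n} → T (xs ≈ᵛ ys) → xs ≡ ys
≈ᵛ⇒≡ {xs = []}     {[]}     _ = refl
≈ᵛ⇒≡ {xs = x ∷ xs} {y ∷ ys} t with p , q ← T-∧⁻ {x == y} t = cong₂ _∷_ (==⇒≡ p) (≈ᵛ⇒≡ q)

_≈ᵖ_ : Colours × Colours → Colours × Colours → Bool
(i , c) ≈ᵖ (j , d) = i ≈ᵛ j ∧ c ≈ᵛ d

≈ᵖ⇒≡ : ∀ {x y} → T (x ≈ᵖ y) → x ≡ y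
≈ᵖ⇒≡ {i , c} {j , d} t with p , q ← T-∧⁻ {i ≈ᵛ j} t = cong₂ _,_ (≈ᵛ⇒≡ p) (≈ᵛ⇒≡ q)

open Matching _≈ᵖ_ (λ {x} {y} → ≈ᵖ⇒≡ {x} {y})

∀ᵛ : ∀ m → (Vec Bool m → Bool) → Bool
∀ᵛ zero    p = p []
∀ᵛ (suc m) p = ∀ᵛ m (p ∘ (false ∷_)) ∧ ∀ᵛ m (p ∘ (true ∷_))

∀ᵛ-sound : ∀ m p → T (∀ᵛ m p) → ∀ v → T (p v)
∀ᵛ-sound zero    p t []          = t
∀ᵛ-sound (suc m) p t (false ∷ v) = ∀ᵛ-sound m _ (proj₁ (T-∧⁻ {∀ᵛ m (p ∘ (false ∷_))} t)) v
∀ᵛ-sound (suc m) p t (true  ∷ v) = ∀ᵛ-sound m _ (proj₂ (T-∧⁻ {∀ᵛ m (p ∘ (false ∷_))} t)) v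

-- A completed loop has a colour of its own that nothing else restricts, so each colouring of the
-- next state then arises twice.
step-matches : Rotations → State → Bool
step-matches g s = matches (concatMap (extensions g) (colourings s))
  (concatMap (λ _ → colourings (next g s)) (allV (bit (loop g s))))

through-matches split-matches : Vec Bool 4 → Bool
through-matches (α ∷ β ∷ σ ∷ τ ∷ []) = step-matches (α , β) (through σ τ)
split-matches   (α ∷ β ∷ m ∷ k ∷ []) = step-matches (α , β) (split m k)

hooked-matches : Vec Bool 6 → Bool
hooked-matches (α ∷ β ∷ i ∷ j ∷ k ∷ l ∷ []) = step-matches (α , β) (hooked i j k l)

step-matched : ∀ g s → T (step-matches g s)
step-matched (α , β) (through σ τ)    = ∀ᵛ-sound 4 through-matches tt (α ∷ β ∷ σ ∷ τ ∷ [])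
step-matched (α , β) (hooked i j k l) = ∀ᵛ-sound 6 hooked-matches tt (α ∷ β ∷ i ∷ j ∷ k ∷ l ∷ [])
step-matched (α , β) (split m k)      = ∀ᵛ-sound 4 split-matches tt (α ∷ β ∷ m ∷ k ∷ [])

closing : ∀ s → sumOver (colourings s) (chains []) ≡ 2 ^ closingLoops s
closing (through false false) = refl
closing (through false true)  = refl
closing (through true  false) = refl
closing (through true  true)  = refl
closing (hooked false false false false) = refl
closing (hooked false false false true)  = refl
closing (hooked false false true  false) = refl
closing (hooked false false true  true)  = refl
closing (hooked false true  false false) = refl
closing (hooked false true  false true)  = refl
closing (hooked false true  true  false) = refl
closing (hooked false true  true  true)  = refl
closing (hooked true  false false false) = refl
closing (hooked true  false false true)  = refl
closing (hooked true  false true  false) = refl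
closing (hooked true  false true  true)  = refl
closing (hooked true  true  false false) = refl
closing (hooked true  true  false true)  = refl
closing (hooked true  true  true  false) = refl
closing (hooked true  true  true  true)  = refl
closing (split false false) = refl
closing (split false true)  = refl
closing (split true  false) = refl
closing (split true  true)  = refl

sumOver-const : ∀ k (N : ℕ) → sumOver (allV k) (λ _ → N) ≡ 2 ^ k * N
sumOver-const k N = trans (sym (ΣV≡sumOver k _)) (go k)
  where
  go : ∀ k → ΣV k (λ _ → N) ≡ 2 ^ k * N
  go zero    = sym (ℕ.*-identityˡ N)
  go (suc k) = trans (cong₂ _+_ (go k) (go k))
    (trans (sym (ℕ.*-distribʳ-+ N (2 ^ k) (2 ^ k))) (cong (λ m → (2 ^ k + m) * N) (sym (ℕ.+-identityʳ (2 ^ k)))))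

chains-sum : ∀ gs s → sumOver (colourings s) (chains gs) ≡ 2 ^ loops s gs
chains-sum []       s = closing s
chains-sum (g ∷ gs) s = begin
  sumOver (colourings s) (chains (g ∷ gs))
    ≡⟨ sumOver-cong (colourings s) (chains-∷ g gs) ⟩
  sumOver (colourings s) (λ x → sumOver (extensions g x) (chains gs))
    ≡⟨ sumOver-concatMap (extensions g) (colourings s) (chains gs) ⟨
  sumOver (concatMap (extensions g) (colourings s)) (chains gs)
    ≡⟨ matches-sum (concatMap (extensions g) (colourings s)) _ (chains gs) (step-matched g s) ⟩
  sumOver (concatMap (λ _ → colourings s′) (allV l)) (chains gs)
    ≡⟨ sumOver-concatMap (λ _ → colourings s′) (allV l) (chains gs) ⟩
  sumOver (allV l) (λ _ → sumOver (colourings s′) (chains gs))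
    ≡⟨ sumOver-cong (allV l) (λ _ → chains-sum gs s′) ⟩
  sumOver (allV l) (λ _ → 2 ^ loops s′ gs)
    ≡⟨ sumOver-const l _ ⟩
  2 ^ l * 2 ^ loops s′ gs
    ≡⟨ ℕ.^-distribˡ-+-* 2 l (loops s′ gs) ⟨
  2 ^ loops s (g ∷ gs) ∎
  where
  open ≡-Reasoning
  s′ = next g s
  l  = bit (loop g s)

-- Of the three conditions at w′ this is the one between the two parallel edges; the other two
-- determine the colours that `outer` hands to `glued`.
spareSide : Bool → Colours → Bool
spareSide false (f₁ ∷ t₁ ∷ f₂ ∷ t₂ ∷ []) = f₂ == t₁
spareSide true  (f₁ ∷ t₁ ∷ f₂ ∷ t₂ ∷ []) = f₁ == t₂

-- The colours that the path sees at its ends, after the two parallel edges,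
-- whose ends at w′ and w have colours f₁, t₁ and f₂, t₂, have been contracted.
outer : Bool → Colours → Colours → Colours
outer false (_ ∷ _ ∷ s ∷ d ∷ []) (f₁ ∷ t₁ ∷ f₂ ∷ t₂ ∷ []) = f₁ ∷ t₂ ∷ s ∷ d ∷ []
outer true  (_ ∷ _ ∷ s ∷ d ∷ []) (f₁ ∷ t₁ ∷ f₂ ∷ t₂ ∷ []) = f₂ ∷ t₁ ∷ s ∷ d ∷ []

start : Bool → Bool → Colours → Colours → Bool
start ω ω′ c@(t ∷ b ∷ _ ∷ _ ∷ []) e@(f₁ ∷ t₁ ∷ f₂ ∷ t₂ ∷ []) =
  around ω t b t₁ f₁ t₂ f₂ ∧ spareSide ω′ e

Closed : Bool → Bool → List Rotations → Set
Closed ω ω′ gs = Σ Colours λ c → Σ Colours λ e → T (start ω ω′ c e) × Chain gs (outer ω′ c e) c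

closed-card : ∀ ω ω′ gs → Fin (ΣV 4 λ c → ΣV 4 λ e → if start ω ω′ c e then chains gs (outer ω′ c e , c) else 0)
  ↔ Closed ω ω′ gs
closed-card ω ω′ gs = ΣV-card 4 λ c → ΣV-card 4 λ e → if-card (start ω ω′ c e) (chains-card gs _ c)

-- When the rotations at w and w′ differ, the two parallel edges bound a digon, which the `suc`
-- counts. When they agree, t and b are joined at both ends of the strand diagram.
facesOf : Bool → Bool → List Rotations → ℕ
facesOf ω ω′ gs =
  if ω xor ω′ then suc (loops (through false false) gs) else loops (hooked false false false false) gs

starts : Bool → Bool → List (Colours × Colours)
starts ω ω′ = concatMap (λ c → map (λ e → outer ω′ c e , c) (filterᵇ (start ω ω′ c) (allV 4))) (allV 4)

starts-sum : ∀ ω ω′ gs → sumOver (starts ω ω′) (chains gs) ≡ 2 ^ facesOf ω ω′ gs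
starts-sum ω ω′ gs = by-cases ω ω′
  where
  once : ∀ ω ω′ → T (matches (starts ω ω′) (colourings (hooked false false false false))) →
    sumOver (starts ω ω′) (chains gs) ≡ 2 ^ loops (hooked false false false false) gs
  once ω ω′ t = trans (matches-sum (starts ω ω′) _ (chains gs) t) (chains-sum gs (hooked false false false false))
  twice : ∀ ω ω′ → T (matches (starts ω ω′) (concatMap (λ _ → colourings (through false false)) (allV 1))) →
    sumOver (starts ω ω′) (chains gs) ≡ 2 ^ suc (loops (through false false) gs)
  twice ω ω′ t = trans (matches-sum (starts ω ω′) _ (chains gs) t)
    (trans (sumOver-concatMap (λ _ → colourings (through false false)) (allV 1) (chains gs))
      (trans (sumOver-cong (allV 1) (λ _ → chains-sum gs (through false false)))
        (sumOver-const 1 (2 ^ loops (through false false) gs))))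
  by-cases : ∀ ω ω′ → sumOver (starts ω ω′) (chains gs) ≡ 2 ^ facesOf ω ω′ gs
  by-cases false false = once false false tt
  by-cases false true  = twice false true tt
  by-cases true  false = twice true false tt
  by-cases true  true  = once true true tt

closed↔ : ∀ ω ω′ gs → Fin (2 ^ facesOf ω ω′ gs) ↔ Closed ω ω′ gs
closed↔ ω ω′ gs = subst (λ k → Fin k ↔ Closed ω ω′ gs)
  (trans (ΣVΣV≡sumOver 4 4 (start ω ω′) (λ c e → outer ω′ c e , c) (chains gs)) (starts-sum ω ω′ gs))
  (closed-card ω ω′ gs)

-- Cubic graphs

module _ {A : Set} {_≺_ : A → A → Set} (≺-asym : ∀ {x y} → x ≺ y → ¬ y ≺ x) where

  sorted-unique : ∀ {xs ys} → AllPairs _≺_ xs → AllPairs _≺_ ys →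
    (∀ {z} → z ∈ xs → z ∈ ys) → (∀ {z} → z ∈ ys → z ∈ xs) → xs ≡ ys
  sorted-unique []        []        _ _ = refl
  sorted-unique []        (_ ∷ _)   _ g with () ← g (here refl)
  sorted-unique (_ ∷ _)   []        f _ with () ← f (here refl)
  sorted-unique {x ∷ xs} {y ∷ ys} (x≺ ∷ sx) (y≺ ∷ sy) f g = cong₂ _∷_ x≡y
    (sorted-unique sx sy (λ z∈ → tail-⊆ (f (there z∈)) (sym x≡y) x≺ z∈)
                         (λ z∈ → tail-⊆ (g (there z∈)) x≡y y≺ z∈))
    where
    x≡y : x ≡ y
    x≡y with f (here refl) | g (here refl)
    ... | here eq  | _        = eq
    ... | there _  | here eq  = sym eq
    ... | there x∈ | there y∈ = contradiction (All.lookup y≺ x∈) (≺-asym (All.lookup x≺ y∈))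
    tail-⊆ : ∀ {a b as bs z} → z ∈ b ∷ bs → b ≡ a → All (a ≺_) as → z ∈ as → z ∈ bs
    tail-⊆ (there z∈) _   _  _  = z∈
    tail-⊆ (here refl) refl a≺ z∈ = contradiction (All.lookup a≺ z∈) (λ p → ≺-asym p p)

T-around : ∀ β {p p′ q q′ r r′} → T (around β p p′ q q′ r r′) →
  if β then (r ≡ p′ × q ≡ r′ × p ≡ q′) else (q ≡ p′ × r ≡ q′ × p ≡ r′)
T-around false {p} {p′} {q} {q′} t with a , t′ ← T-∧⁻ {q == p′} t with b , c ← T-∧⁻ t′ = ==⇒≡ a , ==⇒≡ b , ==⇒≡ c
T-around true  {p} {p′} {q} {q′} {r} t with a , t′ ← T-∧⁻ {r == p′} t with b , c ← T-∧⁻ t′ = ==⇒≡ a , ==⇒≡ b , ==⇒≡ c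

around-T : ∀ β {p p′ q q′ r r′} →
  (if β then (r ≡ p′ × q ≡ r′ × p ≡ q′) else (q ≡ p′ × r ≡ q′ × p ≡ r′)) → T (around β p p′ q q′ r r′)
around-T false {p} {q = q} {r = r} (refl , refl , refl) = T-∧⁺ (==-refl q) (T-∧⁺ (==-refl r) (==-refl p))
around-T true  {p} {q = q} {r = r} (refl , refl , refl) = T-∧⁺ (==-refl r) (T-∧⁺ (==-refl q) (==-refl p))

choices-map : ∀ {A : Set} {k} (f : Fin k → Bool → A) →
  choices (λ v → f v false ∷ f v true ∷ []) ≡ map (λ bs → Vec.tabulate λ v → f v (Vec.lookup bs v)) (allV k)
choices-map {k = zero}  f = refl
choices-map {k = suc k} f = trans
  (cong₂ _++_ (step false) (trans (List.++-identityʳ _) (step true)))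
  (sym (List.map-++ _ (map (false ∷_) (allV k)) (map (true ∷_) (allV k))))
  where
  step : ∀ b → map (f zero b ∷_) (choices (λ v → f (suc v) false ∷ f (suc v) true ∷ []))
             ≡ map (λ bs → Vec.tabulate λ v → f v (Vec.lookup bs v)) (map (b ∷_) (allV k))
  step b = trans (cong (map (f zero b ∷_)) (choices-map (f ∘ suc)))
    (trans (sym (List.map-∘ (allV k))) (List.map-∘ (allV k)))

module CubicGraph (G : Multigraph) where
  open Multigraph G
  open Embeddings G hiding (embeddingCount; IsMinimumGenus; IsMaximumGenus)

  mate-involutive : ∀ d → mate (mate d) ≡ d
  mate-involutive (e , false) = refl
  mate-involutive (e , true)  = refl

  ∈darts : ∀ d → d ∈ darts
  ∈darts (e , false) = ∈-cartesianProduct⁺ (∈-allFin e) (here refl)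
  ∈darts (e , true)  = ∈-cartesianProduct⁺ (∈-allFin e) (there (here refl))

  infix 4 _≺_
  _≺_ : Dart → Dart → Set
  (e , b) ≺ (e′ , b′) = toℕ e < toℕ e′ ⊎ e ≡ e′ × b ≡ false × b′ ≡ true

  ≺-asym : ∀ {x y} → x ≺ y → ¬ y ≺ x
  ≺-asym (inj₁ p) (inj₁ q) = ℕ.<-asym p q
  ≺-asym (inj₁ p) (inj₂ (refl , _)) = ℕ.<-irrefl refl p
  ≺-asym (inj₂ (refl , _)) (inj₁ q) = ℕ.<-irrefl refl q
  ≺-asym (inj₂ (_ , refl , refl)) (inj₂ (_ , () , _))

  darts-sorted : AllPairs _≺_ darts
  darts-sorted = go (AllPairs.tabulate⁺-< {f = id} id)
    where
    above : ∀ e b es → All (λ e′ → toℕ e < toℕ e′) es → All ((e , b) ≺_) (cartesianProduct es (false ∷ true ∷ []))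
    above e b []        []       = []
    above e b (e′ ∷ es) (p ∷ ps) = inj₁ p ∷ inj₁ p ∷ above e b es ps
    go : ∀ {es : List (Fin size)} → AllPairs (λ e e′ → toℕ e < toℕ e′) es →
      AllPairs _≺_ (cartesianProduct es (false ∷ true ∷ []))
    go [] = []
    go {e ∷ es} (p ∷ ps) = (inj₂ (refl , refl , refl) ∷ above e false es p) ∷ above e true es p ∷ go ps

  -- For symbolic `n` the filter in `dartsAt` does not reduce. A strictly sorted list is determined
  -- by its members, so it suffices to exhibit a sorted complete list.
  dartsAt-≡ : ∀ {v ds} → AllPairs _≺_ ds → All (λ d → vertexOf d ≡ v) ds →
    (∀ d → vertexOf d ≡ v → d ∈ ds) → dartsAt v ≡ ds
  dartsAt-≡ {v} sorted at complete = sorted-unique ≺-asym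
    (AllPairs.filter⁺ (λ d → vertexOf d Fin.≟ v) darts-sorted) sorted
    (λ {d} d∈ → complete d (proj₂ (∈-filter⁻ (λ d → vertexOf d Fin.≟ v) {xs = darts} d∈)))
    (λ {d} d∈ → ∈-filter⁺ (λ d → vertexOf d Fin.≟ v) (∈darts d) (All.lookup at d∈))

  Corner : Fin order → Dart → Dart → Dart → Set
  Corner v p q r = dartsAt v ≡ p ∷ q ∷ r ∷ []

  module Cubic (cubic : ∀ v → ∃[ p ] ∃[ q ] ∃[ r ] Corner v p q r) where

    -- Three edge ends have exactly two cyclic orders, which turns a rotation system into a bit
    -- vector.
    orient : Fin order → Bool → List Dart
    orient v b with p , q , r , _ ← cubic v = if b then p ∷ r ∷ q ∷ [] else p ∷ q ∷ r ∷ []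

    system : Vec Bool order → RotationSystem
    system bs = Vec.tabulate λ v → orient v (Vec.lookup bs v)

    cyclicOrders-dartsAt : ∀ v → cyclicOrders (dartsAt v) ≡ orient v false ∷ orient v true ∷ []
    cyclicOrders-dartsAt v with p , q , r , eq ← cubic v rewrite eq = refl

    choices-cong : ∀ {A : Set} {k} {f g : Fin k → List A} → f ≗ g → choices f ≡ choices g
    choices-cong {k = zero}  eq = refl
    choices-cong {k = suc k} eq = cong₂ (cartesianProductWith _∷_) (eq zero) (choices-cong (eq ∘ suc))

    rotationSystems-≡ : rotationSystems ≡ map system (allV order)
    rotationSystems-≡ = trans (choices-cong cyclicOrders-dartsAt) (choices-map orient)

    embeddingCount-≡ : ∀ g → embeddingCount G g ≡
      ΣV order λ bs → if does (hasGenus? (system bs) g) then 1 else 0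
    embeddingCount-≡ g = begin
      length (filter (λ ρ → hasGenus? ρ g) rotationSystems)
        ≡⟨ cong (length ∘ filter (λ ρ → hasGenus? ρ g)) rotationSystems-≡ ⟩
      length (filter (λ ρ → hasGenus? ρ g) (map system (allV order)))
        ≡⟨ length-filter (map system (allV order)) ⟩
      sumOver (map system (allV order)) (λ ρ → if does (hasGenus? ρ g) then 1 else 0)
        ≡⟨ sumOver-map system (allV order) _ ⟩
      sumOver (allV order) (λ bs → if does (hasGenus? (system bs) g) then 1 else 0)
        ≡⟨ ΣV≡sumOver order _ ⟨
      ΣV order (λ bs → if does (hasGenus? (system bs) g) then 1 else 0) ∎
      where
      open ≡-Reasoning
      length-filter : ∀ ρs → length (filter (λ ρ → hasGenus? ρ g) ρs) ≡
        sumOver ρs (λ ρ → if does (hasGenus? ρ g) then 1 else 0)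
      length-filter []       = refl
      length-filter (ρ ∷ ρs) with does (hasGenus? ρ g)
      ... | true  = cong suc (length-filter ρs)
      ... | false = length-filter ρs

    module _ (bs : Vec Bool order) where

      ρ : RotationSystem
      ρ = system bs

      successor-cycle : ∀ {v x y z} → Vec.lookup ρ v ≡ x ∷ y ∷ z ∷ [] →
        vertexOf x ≡ v → vertexOf y ≡ v → vertexOf z ≡ v → x ≢ y → x ≢ z → y ≢ z →
        rotate ρ x ≡ y × rotate ρ y ≡ z × rotate ρ z ≡ x
      successor-cycle {v} {x} {y} {z} eq x-at y-at z-at x≢y x≢z y≢z = at-x , at-y , at-z
        where
        at-x : rotate ρ x ≡ y
        at-x rewrite x-at | eq with x ≟ᵈ x
        ... | yes _ = refl
        ... | no ¬p = contradiction refl ¬p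
        at-y : rotate ρ y ≡ z
        at-y rewrite y-at | eq with x ≟ᵈ y
        ... | yes p = contradiction p x≢y
        ... | no _ with y ≟ᵈ y
        ...   | yes _ = refl
        ...   | no ¬p = contradiction refl ¬p
        at-z : rotate ρ z ≡ x
        at-z rewrite z-at | eq with x ≟ᵈ z
        ... | yes p = contradiction p x≢z
        ... | no _ with y ≟ᵈ z
        ...   | yes p = contradiction p y≢z
        ...   | no _ = refl

      RotatesAt : Bool → Dart → Dart → Dart → Set
      RotatesAt false p q r = rotate ρ p ≡ q × rotate ρ q ≡ r × rotate ρ r ≡ p
      RotatesAt true  p q r = rotate ρ p ≡ r × rotate ρ r ≡ q × rotate ρ q ≡ p

      rotates : ∀ {v p q r} → Corner v p q r → RotatesAt (Vec.lookup bs v) p q r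
      rotates {v} {p} {q} {r} corner = oriented (Vec.lookup bs v) (Vec.lookup∘tabulate (λ v → orient v (Vec.lookup bs v)) v)
        where
        at : ∀ {d} → d ∈ p ∷ q ∷ r ∷ [] → vertexOf d ≡ v
        at {d} d∈ = proj₂ (∈-filter⁻ (λ d → vertexOf d Fin.≟ v) {xs = darts} (subst (d ∈_) (sym corner) d∈))
        sorted : AllPairs _≺_ (p ∷ q ∷ r ∷ [])
        sorted = subst (AllPairs _≺_) corner (AllPairs.filter⁺ (λ d → vertexOf d Fin.≟ v) darts-sorted)
        ≺⇒≢ : ∀ {x y} → x ≺ y → x ≢ y
        ≺⇒≢ x≺x refl = ≺-asym x≺x x≺x
        orient-≡ : ∀ b → orient v b ≡ (if b then p ∷ r ∷ q ∷ [] else p ∷ q ∷ r ∷ [])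
        orient-≡ b with cubic v
        ... | p′ , q′ , r′ , eq with refl ← trans (sym eq) corner = refl
        oriented : ∀ b → Vec.lookup ρ v ≡ orient v b → RotatesAt b p q r
        oriented b eq with sorted
        oriented false eq | (p≺q ∷ p≺r ∷ []) ∷ (q≺r ∷ []) ∷ _ =
          successor-cycle (trans eq (orient-≡ false)) (at (here refl)) (at (there (here refl))) (at (there (there (here refl))))
            (≺⇒≢ p≺q) (≺⇒≢ p≺r) (≺⇒≢ q≺r)
        oriented true eq | (p≺q ∷ p≺r ∷ []) ∷ (q≺r ∷ []) ∷ _ =
          successor-cycle (trans eq (orient-≡ true)) (at (here refl)) (at (there (there (here refl)))) (at (there (here refl)))
            (≺⇒≢ p≺r) (≺⇒≢ p≺q) (≺⇒≢ q≺r ∘ sym)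

      ∈corner : ∀ {d p q r} → Corner (vertexOf d) p q r → d ∈ p ∷ q ∷ r ∷ []
      ∈corner {d} corner = subst (d ∈_) corner (∈-filter⁺ (λ d′ → vertexOf d′ Fin.≟ vertexOf d) (∈darts d) refl)

      -- Supplies an inverse of `rotate`, and with it the injectivity of `faceStep` that the orbit
      -- theory requires.
      rotate³ : ∀ d → rotate ρ (rotate ρ (rotate ρ d)) ≡ d
      rotate³ d with p , q , r , corner ← cubic (vertexOf d) = go (Vec.lookup bs (vertexOf d)) (rotates corner) (∈corner corner)
        where
        go : ∀ b → RotatesAt b p q r → d ∈ p ∷ q ∷ r ∷ [] → rotate ρ (rotate ρ (rotate ρ d)) ≡ d
        go false (a , b , c) (here refl)                 rewrite a | b | c = refl
        go false (a , b , c) (there (here refl))         rewrite b | c | a = refl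
        go false (a , b , c) (there (there (here refl))) rewrite c | a | b = refl
        go true  (a , b , c) (here refl)                 rewrite a | b | c = refl
        go true  (a , b , c) (there (here refl))         rewrite c | a | b = refl
        go true  (a , b , c) (there (there (here refl))) rewrite b | c | a = refl

      faceStep-injective : ∀ {x y} → faceStep ρ x ≡ faceStep ρ y → x ≡ y
      faceStep-injective {x} {y} eq = trans (sym (mate-involutive x)) (trans (cong mate mates) (mate-involutive y))
        where
        mates : mate x ≡ mate y
        mates = trans (sym (rotate³ (mate x))) (trans (cong (rotate ρ ∘ rotate ρ) eq) (rotate³ (mate y)))

      open Orbits _≟ᵈ_ (faceStep ρ) faceStep-injective darts ∈darts public using (Invariant; enumeration)

      -- Invariance at d, applied with x = mate d, compares the colours of `rotate ρ x` and
      -- `mate x`. The first lies at the vertex of x, so the condition involves only that vertex and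
      -- the mates of its edge ends.
      AroundAll : (Dart → Bool) → Set
      AroundAll φ = ∀ {v p q r} → Corner v p q r →
        T (around (Vec.lookup bs v) (φ p) (φ (mate p)) (φ q) (φ (mate q)) (φ r) (φ (mate r)))

      invariant⇒around : ∀ {φ} → Invariant φ → AroundAll φ
      invariant⇒around {φ} inv {v} {p} {q} {r} corner = around-T (Vec.lookup bs v) (go (Vec.lookup bs v) (rotates corner))
        where
        turn : ∀ {x y} → rotate ρ x ≡ y → φ y ≡ φ (mate x)
        turn {x} eq = trans (cong φ (trans (sym eq) (cong (rotate ρ) (sym (mate-involutive x))))) (inv (mate x))
        go : ∀ b → RotatesAt b p q r → if b
          then (φ r ≡ φ (mate p) × φ q ≡ φ (mate r) × φ p ≡ φ (mate q))
          else (φ q ≡ φ (mate p) × φ r ≡ φ (mate q) × φ p ≡ φ (mate r))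
        go false (a , b , c) = turn a , turn b , turn c
        go true  (a , b , c) = turn a , turn b , turn c

      around⇒invariant : ∀ {φ} → AroundAll φ → Invariant φ
      around⇒invariant {φ} all d = trans (turn (mate d)) (cong φ (mate-involutive d))
        where
        turn : ∀ x → φ (rotate ρ x) ≡ φ (mate x)
        turn x with p , q , r , corner ← cubic (vertexOf x) =
          go (Vec.lookup bs (vertexOf x)) (rotates corner) (T-around (Vec.lookup bs (vertexOf x)) (all corner)) (∈corner corner)
          where
          go : ∀ b → RotatesAt b p q r → (if b
            then (φ r ≡ φ (mate p) × φ q ≡ φ (mate r) × φ p ≡ φ (mate q))
            else (φ q ≡ φ (mate p) × φ r ≡ φ (mate q) × φ p ≡ φ (mate r))) →
            x ∈ p ∷ q ∷ r ∷ [] → φ (rotate ρ x) ≡ φ (mate x)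
          go false (a , b , c) (a′ , b′ , c′) (here refl)                 = trans (cong φ a) a′
          go false (a , b , c) (a′ , b′ , c′) (there (here refl))         = trans (cong φ b) b′
          go false (a , b , c) (a′ , b′ , c′) (there (there (here refl))) = trans (cong φ c) c′
          go true  (a , b , c) (a′ , b′ , c′) (here refl)                 = trans (cong φ a) a′
          go true  (a , b , c) (a′ , b′ , c′) (there (here refl))         = trans (cong φ c) c′
          go true  (a , b , c) (a′ , b′ , c′) (there (there (here refl))) = trans (cong φ b) b′

-- Colourings of the cross

module _ {m : ℕ} where

  -- Embedding by value. For `m = n` its image meets that of `n ↑ʳ_` in the index n: the middle edge
  -- of the path lies behind uₙ and in front of x₁, hence is both `before (fromℕ n)` and
  -- `after zero`.
  low : ∀ n → Fin (suc n) → Fin (n + suc m)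
  low zero    zero    = zero
  low (suc n) zero    = zero
  low (suc n) (suc i) = suc (low n i)

  toℕ-low : ∀ n i → toℕ (low n i) ≡ toℕ i
  toℕ-low zero    zero    = refl
  toℕ-low (suc n) zero    = refl
  toℕ-low (suc n) (suc i) = cong suc (toℕ-low n i)

  low-inject₁ : ∀ n i → low n (inject₁ i) ≡ i ↑ˡ suc m
  low-inject₁ (suc n) zero    = refl
  low-inject₁ (suc n) (suc i) = cong suc (low-inject₁ n i)

  low-fromℕ : ∀ n → low n (fromℕ n) ≡ n ↑ʳ zero
  low-fromℕ zero    = refl
  low-fromℕ (suc n) = cong suc (low-fromℕ n)

  inject₁-low-zero : ∀ n → inject₁ (low n zero) ≡ zero
  inject₁-low-zero zero    = refl
  inject₁-low-zero (suc n) = refl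

  inject₁-low-suc : ∀ n i → inject₁ (low n (suc i)) ≡ suc (i ↑ˡ suc m)
  inject₁-low-suc (suc n) zero    = cong suc (inject₁-low-zero n)
  inject₁-low-suc (suc n) (suc i) = cong suc (inject₁-low-suc n i)

  inject₁-↑ʳ : ∀ n (i : Fin m) → inject₁ (n ↑ʳ suc i) ≡ suc (n ↑ʳ inject₁ i)
  inject₁-↑ʳ zero    i = refl
  inject₁-↑ʳ (suc n) i = cong suc (inject₁-↑ʳ n i)

  data LowOrHigh n : Fin (n + suc m) → Set where
    low′  : ∀ i → LowOrHigh n (low n i)
    high′ : ∀ (i : Fin m) → LowOrHigh n (n ↑ʳ suc i)

  lowOrHigh : ∀ n k → LowOrHigh n k
  lowOrHigh zero    zero    = low′ zero
  lowOrHigh zero    (suc k) = high′ k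
  lowOrHigh (suc n) zero    = low′ zero
  lowOrHigh (suc n) (suc k) with lowOrHigh n k
  ... | low′ i  = low′ (suc i)
  ... | high′ i = high′ i

data Summand m n : Fin (m + n) → Set where
  left  : ∀ i → Summand m n (i ↑ˡ n)
  right : ∀ i → Summand m n (m ↑ʳ i)

summand : ∀ m {n} k → Summand m n k
summand zero    k       = right k
summand (suc m) zero    = left zero
summand (suc m) (suc k) with summand m k
... | left i  = left (suc i)
... | right i = right i

byTop : ∀ {A : Set} n → A → (Fin n → A) → Fin (suc n) → A
byTop zero    a f zero    = a
byTop (suc n) a f zero    = f zero
byTop (suc n) a f (suc i) = byTop n a (f ∘ suc) i

byTop-fromℕ : ∀ {A : Set} n {a : A} {f} → byTop n a f (fromℕ n) ≡ a
byTop-fromℕ zero    = refl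
byTop-fromℕ (suc n) = byTop-fromℕ n

byTop-inject₁ : ∀ {A : Set} n {a : A} {f} i → byTop n a f (inject₁ i) ≡ f i
byTop-inject₁ (suc n) zero    = refl
byTop-inject₁ (suc n) (suc i) = byTop-inject₁ n i

chain : ∀ {n i} (g : Fin n → Rotations) (c : Fin (suc n) → Colours) (y : Fin n → Vec Bool 2) →
  (∀ l → T (advance (g l) (c (inject₁ l)) (c (suc l)) (y l))) → T (glued i (c (fromℕ n))) →
  Chain (tabulate g) i (c zero)
chain {zero}  g c y adv gl = finish gl
chain {suc n} g c y adv gl = pass (c (suc zero)) (y zero) (adv zero) (chain (g ∘ suc) (c ∘ suc) (y ∘ suc) (adv ∘ suc) gl)

sequence : ∀ {n i c} (g : Fin n → Rotations) → Chain (tabulate g) i c → Fin (suc n) → Colours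
sequence {c = c} g ch zero = c
sequence {suc n} g (pass _ _ _ ch) (suc l) = sequence (g ∘ suc) ch l

chords : ∀ {n i c} (g : Fin n → Rotations) → Chain (tabulate g) i c → Fin n → Vec Bool 2
chords g (pass _ y _ ch) zero    = y
chords g (pass _ _ _ ch) (suc l) = chords (g ∘ suc) ch l

sequence-zero : ∀ {n i c} (g : Fin n → Rotations) (ch : Chain (tabulate g) i c) → sequence g ch zero ≡ c
sequence-zero {zero}  g ch = refl
sequence-zero {suc n} g ch = refl

sequence-advance : ∀ {n i c} (g : Fin n → Rotations) (ch : Chain (tabulate g) i c) l →
  T (advance (g l) (sequence g ch (inject₁ l)) (sequence g ch (suc l)) (chords g ch l))
sequence-advance {suc n} {c = c} g (pass c′ y t ch) zero =
  subst (λ c″ → T (advance (g zero) c c″ y)) (sym (sequence-zero (g ∘ suc) ch)) t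
sequence-advance {suc n} g (pass c′ y t ch) (suc l) = sequence-advance (g ∘ suc) ch l

sequence-glued : ∀ {n i c} (g : Fin n → Rotations) (ch : Chain (tabulate g) i c) → T (glued i (sequence g ch (fromℕ n)))
sequence-glued {zero}  g (finish t)         = t
sequence-glued {suc n} g (pass _ _ _ ch) = sequence-glued (g ∘ suc) ch

module _ {i : Colours} where

  sequence-chain : ∀ {n} (g : Fin n → Rotations) c y
    (adv : ∀ l → T (advance (g l) (c (inject₁ l)) (c (suc l)) (y l))) (gl : T (glued i (c (fromℕ n)))) →
    sequence g (chain {i = i} g c y adv gl) ≗ c
  sequence-chain {zero}  g c y adv gl zero    = refl
  sequence-chain {suc n} g c y adv gl zero    = refl
  sequence-chain {suc n} g c y adv gl (suc l) = sequence-chain (g ∘ suc) (c ∘ suc) (y ∘ suc) (adv ∘ suc) gl l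

  chords-chain : ∀ {n} (g : Fin n → Rotations) c y
    (adv : ∀ l → T (advance (g l) (c (inject₁ l)) (c (suc l)) (y l))) (gl : T (glued i (c (fromℕ n)))) →
    chords g (chain {i = i} g c y adv gl) ≗ y
  chords-chain {suc n} g c y adv gl zero    = refl
  chords-chain {suc n} g c y adv gl (suc l) = chords-chain (g ∘ suc) (c ∘ suc) (y ∘ suc) (adv ∘ suc) gl l

chain-unique : ∀ {n i c} (g : Fin n → Rotations) (ch ch′ : Chain (tabulate g) i c) →
  sequence g ch ≗ sequence g ch′ → chords g ch ≗ chords g ch′ → ch ≡ ch′
chain-unique {zero} g (finish t) (finish t′) _ _ = cong finish (Bool.T-irrelevant t t′)
chain-unique {suc n} g (pass c y t ch) (pass c′ y′ t′ ch′) cs ys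
  with refl ← trans (sym (sequence-zero (g ∘ suc) ch)) (trans (cs (suc zero)) (sequence-zero (g ∘ suc) ch′))
     | refl ← ys zero =
  cong₂ (pass c y) (Bool.T-irrelevant t t′) (chain-unique (g ∘ suc) ch ch′ (cs ∘ suc) (ys ∘ suc))

closing⁻ : ∀ ω′ {t b s d t′ b′ s′ d′ f₁ t₁ f₂ t₂} → t′ ≡ s → b′ ≡ d → T (around ω′ d′ s′ f₁ t₁ f₂ t₂) →
  T (spareSide ω′ (f₁ ∷ t₁ ∷ f₂ ∷ t₂ ∷ [])) ×
  T (glued (outer ω′ (t ∷ b ∷ s ∷ d ∷ []) (f₁ ∷ t₁ ∷ f₂ ∷ t₂ ∷ [])) (t′ ∷ b′ ∷ s′ ∷ d′ ∷ []))
closing⁻ false {s = s} {d} {s′ = s′} {d′} {f₁} {t₁} {f₂} {t₂} refl refl a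
  with refl , refl , refl ← T-around false {d′} {s′} {f₁} {t₁} {f₂} {t₂} a =
  ==-refl t₁ , T-∧⁺ (==-refl s) (T-∧⁺ (==-refl d) (T-∧⁺ (==-refl s′) (==-refl d′)))
closing⁻ true  {s = s} {d} {s′ = s′} {d′} {f₁} {t₁} {f₂} {t₂} refl refl a
  with refl , refl , refl ← T-around true {d′} {s′} {f₁} {t₁} {f₂} {t₂} a =
  ==-refl t₂ , T-∧⁺ (==-refl s) (T-∧⁺ (==-refl d) (T-∧⁺ (==-refl s′) (==-refl d′)))

glued⁻ : ∀ {i₁ i₂ i₃ i₄ t b s d} → T (glued (i₁ ∷ i₂ ∷ i₃ ∷ i₄ ∷ []) (t ∷ b ∷ s ∷ d ∷ [])) →
  t ≡ i₃ × b ≡ i₄ × s ≡ i₁ × d ≡ i₂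
glued⁻ {i₁} {i₂} {i₃} {i₄} {t} {b} {s} g
  with a , g ← T-∧⁻ {t == i₃} g with a′ , g ← T-∧⁻ {b == i₄} g with a″ , g ← T-∧⁻ {s == i₁} g =
  ==⇒≡ a , ==⇒≡ a′ , ==⇒≡ a″ , ==⇒≡ g

closing⁺ : ∀ ω′ {t b s d t′ b′ s′ d′ f₁ t₁ f₂ t₂} → T (spareSide ω′ (f₁ ∷ t₁ ∷ f₂ ∷ t₂ ∷ [])) →
  T (glued (outer ω′ (t ∷ b ∷ s ∷ d ∷ []) (f₁ ∷ t₁ ∷ f₂ ∷ t₂ ∷ [])) (t′ ∷ b′ ∷ s′ ∷ d′ ∷ [])) →
  t′ ≡ s × b′ ≡ d × T (around ω′ d′ s′ f₁ t₁ f₂ t₂)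
closing⁺ false {s = s} {d} {t′} {b′} {s′} {d′} {f₁} {t₁} {f₂} {t₂} side g
  with refl , refl , refl , refl ← glued⁻ {f₁} {t₂} {s} {d} {t′} {b′} {s′} {d′} g =
  refl , refl , around-T false {d′} {s′} {f₁} {t₁} {f₂} {t₂} (refl , ==⇒≡ side , refl)
closing⁺ true {s = s} {d} {t′} {b′} {s′} {d′} {f₁} {t₁} {f₂} {t₂} side g
  with refl , refl , refl , refl ← glued⁻ {f₂} {t₁} {s} {d} {t′} {b′} {s′} {d′} g =
  refl , refl , around-T true {d′} {s′} {f₁} {t₁} {f₂} {t₂} (refl , ==⇒≡ side , refl)

module CrossEmbeddings (n : ℕ) where

  open Cross n using (Vertex; w; w′; u)
  open Multigraph (cross n)
  open Embeddings (cross n) hiding (embeddingCount; IsMinimumGenus; IsMaximumGenus)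
  open CubicGraph (cross n)

  N : ℕ
  N = n + suc n

  x : Fin n → Vertex
  x l = suc (n ↑ʳ inject₁ l)

  path : Fin N → Fin size
  path k = k ↑ˡ (n + 2)

  chord : Fin n → Fin size
  chord l = N ↑ʳ (l ↑ˡ 2)

  spare : Fin 2 → Fin size
  spare j = N ↑ʳ (n ↑ʳ j)

  before after : Fin (suc n) → Fin size
  before i = path (low n i)
  after  i = path (n ↑ʳ i)

  ends-path : ∀ k → ends (path k) ≡ (inject₁ k , suc k)
  ends-path k rewrite Fin.splitAt-↑ˡ N k (n + 2) = refl

  ends-chord : ∀ l → ends (chord l) ≡ (u l , x l)
  ends-chord l rewrite Fin.splitAt-↑ʳ N (n + 2) (l ↑ˡ 2) | Fin.splitAt-↑ˡ n l 2 | Fin.opposite-involutive l = refl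

  ends-spare : ∀ j → ends (spare j) ≡ (w′ , w)
  ends-spare j rewrite Fin.splitAt-↑ʳ N (n + 2) (n ↑ʳ j) | Fin.splitAt-↑ʳ n 2 j = refl

  data Edge : Fin size → Set where
    path′  : ∀ k → Edge (path k)
    chord′ : ∀ l → Edge (chord l)
    spare′ : ∀ j → Edge (spare j)

  edge : ∀ e → Edge e
  edge e with summand N e
  ... | left k = path′ k
  ... | right j with summand n j
  ...   | left l  = chord′ l
  ...   | right i = spare′ i

  data Position : Vertex → Set where
    at-w  : Position w
    at-u  : ∀ l → Position (u l)
    at-x  : ∀ l → Position (x l)
    at-w′ : Position w′

  position : ∀ v → Position v
  position zero = at-w
  position (suc k) with summand n k
  ... | left l = at-u l
  ... | right i with Top.view i
  ...   | Top.‵fromℕ     = at-w′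
  ...   | Top.‵inject₁ l = at-x l

  three : Vertex → List Dart
  three zero    = (before zero , false) ∷ (spare 0F , true) ∷ (spare 1F , true) ∷ []
  three (suc k) =
    [ (λ l → (before (inject₁ l) , true) ∷ (before (suc l) , false) ∷ (chord l , false) ∷ [])
    , byTop n ((after (fromℕ n) , true) ∷ (spare 0F , false) ∷ (spare 1F , false) ∷ [])
        (λ l → (after (inject₁ l) , true) ∷ (after (suc l) , false) ∷ (chord l , true) ∷ [])
    ]′ (splitAt n k)

  three-u : ∀ l → three (u l) ≡ (before (inject₁ l) , true) ∷ (before (suc l) , false) ∷ (chord l , false) ∷ []
  three-u l rewrite Fin.splitAt-↑ˡ n l (suc n) = refl

  three-x : ∀ l → three (x l) ≡ (after (inject₁ l) , true) ∷ (after (suc l) , false) ∷ (chord l , true) ∷ []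
  three-x l rewrite Fin.splitAt-↑ʳ n (suc n) (inject₁ l) = byTop-inject₁ n l

  three-w′ : three w′ ≡ (after (fromℕ n) , true) ∷ (spare 0F , false) ∷ (spare 1F , false) ∷ []
  three-w′ rewrite Fin.splitAt-↑ʳ n (suc n) (fromℕ n) = byTop-fromℕ n

  ∈-along : ∀ {d : Dart} {ds es : List Dart} → ds ≡ es → d ∈ es → d ∈ ds
  ∈-along {d} eq = subst (d ∈_) (sym eq)

  ∈three : ∀ d → d ∈ three (vertexOf d)
  ∈three (e , b) with edge e
  ∈three (_ , false) | path′ k rewrite ends-path k with lowOrHigh n k
  ... | low′ zero    = ∈-along (cong three (inject₁-low-zero n)) (here refl)
  ... | low′ (suc l) = ∈-along (trans (cong three (inject₁-low-suc n l)) (three-u l)) (there (here refl))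
  ... | high′ l      = ∈-along (trans (cong three (inject₁-↑ʳ n l)) (three-x l)) (there (here refl))
  ∈three (_ , true)  | path′ k rewrite ends-path k with summand n k
  ... | left l = ∈-along (three-u l) (here (cong (λ k → path k , true) (sym (low-inject₁ n l))))
  ... | right i with Top.view i
  ...   | Top.‵fromℕ     = ∈-along three-w′ (here refl)
  ...   | Top.‵inject₁ l = ∈-along (three-x l) (here refl)
  ∈three (_ , false) | chord′ l rewrite ends-chord l = ∈-along (three-u l) (there (there (here refl)))
  ∈three (_ , true)  | chord′ l rewrite ends-chord l = ∈-along (three-x l) (there (there (here refl)))
  ∈three (_ , false) | spare′ 0F rewrite ends-spare 0F = ∈-along three-w′ (there (here refl))
  ∈three (_ , false) | spare′ 1F rewrite ends-spare 1F = ∈-along three-w′ (there (there (here refl)))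
  ∈three (_ , true)  | spare′ 0F rewrite ends-spare 0F = there (here refl)
  ∈three (_ , true)  | spare′ 1F rewrite ends-spare 1F = there (there (here refl))

  corner : ∀ {v p q r} → three v ≡ p ∷ q ∷ r ∷ [] → p ≺ q → q ≺ r → p ≺ r →
    vertexOf p ≡ v → vertexOf q ≡ v → vertexOf r ≡ v → Corner v p q r
  corner {v} eq p≺q q≺r p≺r vp vq vr = dartsAt-≡
    ((p≺q ∷ p≺r ∷ []) ∷ (q≺r ∷ []) ∷ [] ∷ []) (vp ∷ vq ∷ vr ∷ [])
    λ d eq′ → subst (d ∈_) (trans (cong three eq′) eq) (∈three d)

  path<extra : ∀ k (j : Fin (n + 2)) → toℕ (path k) < toℕ (N ↑ʳ j)
  path<extra k j rewrite Fin.toℕ-↑ˡ k (n + 2) | Fin.toℕ-↑ʳ N j = ℕ.≤-trans (Fin.toℕ<n k) (ℕ.m≤m+n N (toℕ j))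

  toℕ-before : ∀ i → toℕ (before i) ≡ toℕ i
  toℕ-before i = trans (Fin.toℕ-↑ˡ (low n i) (n + 2)) (toℕ-low n i)

  toℕ-after : ∀ i → toℕ (after i) ≡ n + toℕ i
  toℕ-after i = trans (Fin.toℕ-↑ˡ (n ↑ʳ i) (n + 2)) (Fin.toℕ-↑ʳ n i)

  before<before : ∀ l → toℕ (before (inject₁ l)) < toℕ (before (suc l))
  before<before l = subst₂ _<_ (sym (trans (toℕ-before (inject₁ l)) (Fin.toℕ-inject₁ l))) (sym (toℕ-before (suc l))) ℕ.≤-refl

  after<after : ∀ l → toℕ (after (inject₁ l)) < toℕ (after (suc l))
  after<after l = subst₂ _<_ (sym (trans (toℕ-after (inject₁ l)) (cong (n +_) (Fin.toℕ-inject₁ l)))) (sym (toℕ-after (suc l)))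
    (ℕ.+-monoʳ-< n ℕ.≤-refl)

  spare<spare : toℕ (spare 0F) < toℕ (spare 1F)
  spare<spare rewrite Fin.toℕ-↑ʳ N (n ↑ʳ zero {1}) | Fin.toℕ-↑ʳ N (n ↑ʳ suc {1} zero)
    | Fin.toℕ-↑ʳ n (zero {1}) | Fin.toℕ-↑ʳ n (suc {1} zero) = ℕ.+-monoʳ-< N (ℕ.+-monoʳ-< n ℕ.≤-refl)

  corner-w : Corner w (before zero , false) (spare 0F , true) (spare 1F , true)
  corner-w = corner refl (inj₁ (path<extra _ _)) (inj₁ spare<spare) (inj₁ (path<extra _ _))
    (trans (cong proj₁ (ends-path _)) (inject₁-low-zero n)) (cong proj₂ (ends-spare 0F)) (cong proj₂ (ends-spare 1F))

  corner-u : ∀ l → Corner (u l) (before (inject₁ l) , true) (before (suc l) , false) (chord l , false)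
  corner-u l = corner (three-u l) (inj₁ (before<before l)) (inj₁ (path<extra _ _)) (inj₁ (path<extra _ _))
    (trans (cong proj₂ (ends-path _)) (cong suc (low-inject₁ n l)))
    (trans (cong proj₁ (ends-path _)) (inject₁-low-suc n l)) (cong proj₁ (ends-chord l))

  corner-x : ∀ l → Corner (x l) (after (inject₁ l) , true) (after (suc l) , false) (chord l , true)
  corner-x l = corner (three-x l) (inj₁ (after<after l)) (inj₁ (path<extra _ _)) (inj₁ (path<extra _ _))
    (cong proj₂ (ends-path _)) (trans (cong proj₁ (ends-path _)) (inject₁-↑ʳ n l)) (cong proj₂ (ends-chord l))

  corner-w′ : Corner w′ (after (fromℕ n) , true) (spare 0F , false) (spare 1F , false)
  corner-w′ = corner three-w′ (inj₁ (path<extra _ _)) (inj₁ spare<spare) (inj₁ (path<extra _ _))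
    (cong proj₂ (ends-path _)) (cong proj₁ (ends-spare 0F)) (cong proj₁ (ends-spare 1F))

  cubic : ∀ v → ∃[ p ] ∃[ q ] ∃[ r ] Corner v p q r
  cubic v with position v
  ... | at-w   = _ , _ , _ , corner-w
  ... | at-u l = _ , _ , _ , corner-u l
  ... | at-x l = _ , _ , _ , corner-x l
  ... | at-w′  = _ , _ , _ , corner-w′

  open Cubic cubic public

  coloursAt : (Dart → Bool) → Fin (suc n) → Colours
  coloursAt φ i = φ (before i , false) ∷ φ (before i , true) ∷ φ (after i , false) ∷ φ (after i , true) ∷ []

  chordAt : (Dart → Bool) → Fin n → Vec Bool 2
  chordAt φ l = φ (chord l , false) ∷ φ (chord l , true) ∷ []

  spares : (Dart → Bool) → Colours
  spares φ = φ (spare 0F , false) ∷ φ (spare 0F , true) ∷ φ (spare 1F , false) ∷ φ (spare 1F , true) ∷ []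

  lowPart highPart : Colours → Bool → Bool
  lowPart  (t ∷ b ∷ s ∷ d ∷ []) κ = if κ then b else t
  highPart (t ∷ b ∷ s ∷ d ∷ []) κ = if κ then d else s

  chordPart : Vec Bool 2 → Bool → Bool
  chordPart (y ∷ y′ ∷ []) κ = if κ then y′ else y

  sparePart : Colours → Fin 2 → Bool → Bool
  sparePart (f₁ ∷ t₁ ∷ f₂ ∷ t₂ ∷ []) 0F κ = if κ then t₁ else f₁
  sparePart (f₁ ∷ t₁ ∷ f₂ ∷ t₂ ∷ []) 1F κ = if κ then t₂ else f₂

  -- The middle edge is painted from `highPart (C zero)`; that `lowPart (C (fromℕ n))` prescribes
  -- the same colours is the hypothesis `close` below and follows from `glued`.
  paintCross : (Fin (suc n) → Colours) → (Fin n → Vec Bool 2) → Colours → Dart → Bool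
  paintCross C Y E (e , κ) =
    [ (λ k → [ (λ i → lowPart (C (inject₁ i)) κ) , (λ i → highPart (C i) κ) ]′ (splitAt n k))
    , (λ j → [ (λ l → chordPart (Y l) κ) , (λ i → sparePart E i κ) ]′ (splitAt n j))
    ]′ (splitAt N e)

  module _ (C : Fin (suc n) → Colours) (Y : Fin n → Vec Bool 2) (E : Colours) where

    private φ = paintCross C Y E

    paint-after : ∀ i κ → φ (after i , κ) ≡ highPart (C i) κ
    paint-after i κ rewrite Fin.splitAt-↑ˡ N (n ↑ʳ i) (n + 2) | Fin.splitAt-↑ʳ n (suc n) i = refl

    paint-left : ∀ i κ → φ (path (i ↑ˡ suc n) , κ) ≡ lowPart (C (inject₁ i)) κ
    paint-left i κ rewrite Fin.splitAt-↑ˡ N (i ↑ˡ suc n) (n + 2) | Fin.splitAt-↑ˡ n i (suc n) = refl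

    paint-chord : ∀ l κ → φ (chord l , κ) ≡ chordPart (Y l) κ
    paint-chord l κ rewrite Fin.splitAt-↑ʳ N (n + 2) (l ↑ˡ 2) | Fin.splitAt-↑ˡ n l 2 = refl

    paint-spare : ∀ i κ → φ (spare i , κ) ≡ sparePart E i κ
    paint-spare i κ rewrite Fin.splitAt-↑ʳ N (n + 2) (n ↑ʳ i) | Fin.splitAt-↑ʳ n 2 i = refl

    paint-before : (∀ κ → lowPart (C (fromℕ n)) κ ≡ highPart (C zero) κ) → ∀ i κ → φ (before i , κ) ≡ lowPart (C i) κ
    paint-before close i κ with Top.view i
    ... | Top.‵fromℕ     = trans (cong (λ k → φ (path k , κ)) (low-fromℕ n)) (trans (paint-after zero κ) (sym (close κ)))
    ... | Top.‵inject₁ l = trans (cong (λ k → φ (path k , κ)) (low-inject₁ n l)) (paint-left l κ)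

    coloursAt-paint : (∀ κ → lowPart (C (fromℕ n)) κ ≡ highPart (C zero) κ) → coloursAt φ ≗ C
    coloursAt-paint close i
      rewrite paint-before close i false | paint-before close i true | paint-after i false | paint-after i true
      with _ ∷ _ ∷ _ ∷ _ ∷ [] ← C i = refl

    chordAt-paint : chordAt φ ≗ Y
    chordAt-paint l rewrite paint-chord l false | paint-chord l true with _ ∷ _ ∷ [] ← Y l = refl

    spares-paint : spares φ ≡ E
    spares-paint rewrite paint-spare 0F false | paint-spare 0F true | paint-spare 1F false | paint-spare 1F true = η E
      where
      η : ∀ E → sparePart E 0F false ∷ sparePart E 0F true ∷ sparePart E 1F false ∷ sparePart E 1F true ∷ [] ≡ E
      η (_ ∷ _ ∷ _ ∷ _ ∷ []) = refl

  module _ (bs : Vec Bool order) where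

    ω ω′ : Bool
    ω  = Vec.lookup bs w
    ω′ = Vec.lookup bs w′

    turns : Fin n → Rotations
    turns l = Vec.lookup bs (u l) , Vec.lookup bs (x l)

    record Consistent (φ : Dart → Bool) : Set where
      field
        opening : T (around ω (φ (before zero , false)) (φ (before zero , true)) (φ (spare 0F , true)) (φ (spare 0F , false))
                              (φ (spare 1F , true)) (φ (spare 1F , false)))
        passing : ∀ l → T (advance (turns l) (coloursAt φ (inject₁ l)) (coloursAt φ (suc l)) (chordAt φ l))
        ending  : T (around ω′ (φ (after (fromℕ n) , true)) (φ (after (fromℕ n) , false)) (φ (spare 0F , false)) (φ (spare 0F , true))
                               (φ (spare 1F , false)) (φ (spare 1F , true)))

    consistent : ∀ {φ} → Invariant bs φ → Consistent φ
    consistent inv = record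
      { opening = invariant⇒around bs inv corner-w
      ; passing = λ l → T-∧⁺ (invariant⇒around bs inv (corner-u l)) (invariant⇒around bs inv (corner-x l))
      ; ending  = invariant⇒around bs inv corner-w′
      }

    invariant : ∀ {φ} → Consistent φ → Invariant bs φ
    invariant {φ} con = around⇒invariant bs all
      where
      open Consistent con
      all : AroundAll bs φ
      all {v} c with position v
      ... | at-w   with refl ← trans (sym c) corner-w = opening
      ... | at-u l with refl ← trans (sym c) (corner-u l) = proj₁ (T-∧⁻ (passing l))
      ... | at-x l with refl ← trans (sym c) (corner-x l) =
        proj₂ (T-∧⁻ {around (proj₁ (turns l)) (φ (before (inject₁ l) , true)) _ _ _ _ _} (passing l))
      ... | at-w′  with refl ← trans (sym c) corner-w′ = ending

    -- A second enumeration of the colourings already enumerated by the faces; equating the sizes of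
    -- the two index types gives `faces-≡`.
    closedEnumeration : Closed ω ω′ (tabulate turns) Enumerates Invariant bs
    closedEnumeration = record
      { colour    = paintClosed
      ; satisfies = λ cl → invariant (paint-consistent cl)
      ; injective = λ {cl} {cl′} → paint-injective cl cl′
      ; complete  = λ φ inv → closed φ (consistent inv) , closed-paint φ (consistent inv)
      }
      where
      paintClosed : Closed ω ω′ (tabulate turns) → Dart → Bool
      paintClosed (c , e , _ , ch) = paintCross (sequence turns ch) (chords turns ch) e

      glue : ∀ {c e} (C : Fin (suc n) → Colours) → C zero ≡ c → T (spareSide ω′ e) → T (glued (outer ω′ c e) (C (fromℕ n))) →
        (∀ κ → lowPart (C (fromℕ n)) κ ≡ highPart (C zero) κ) ×
        T (around ω′ (highPart (C (fromℕ n)) true) (highPart (C (fromℕ n)) false)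
          (sparePart e 0F false) (sparePart e 0F true) (sparePart e 1F false) (sparePart e 1F true))
      glue {t ∷ b ∷ s ∷ d ∷ []} {f₁ ∷ t₁ ∷ f₂ ∷ t₂ ∷ []} C C₀ side gl with C zero | C₀ | C (fromℕ n)
      ... | _ | refl | t′ ∷ b′ ∷ s′ ∷ d′ ∷ []
        with t′≡s , b′≡d , a ← closing⁺ ω′ {t} {b} {s} {d} {t′} {b′} {s′} {d′} {f₁} {t₁} {f₂} {t₂} side gl =
        (λ { false → t′≡s ; true → b′≡d }) , a

      start-parts : ∀ c e → T (start ω ω′ c e) →
        T (around ω (lowPart c false) (lowPart c true) (sparePart e 0F true) (sparePart e 0F false)
          (sparePart e 1F true) (sparePart e 1F false)) × T (spareSide ω′ e)
      start-parts (t ∷ b ∷ s ∷ d ∷ []) (f₁ ∷ t₁ ∷ f₂ ∷ t₂ ∷ []) st = T-∧⁻ {around ω t b t₁ f₁ t₂ f₂} st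

      paint-closes : ∀ ((c , e , st , ch) : Closed ω ω′ (tabulate turns)) → _
      paint-closes (c , e , st , ch) =
        glue {c} {e} (sequence turns ch) (sequence-zero turns ch) (proj₂ (start-parts c e st)) (sequence-glued turns ch)

      paint-consistent : ∀ cl → Consistent (paintClosed cl)
      paint-consistent cl@(c , e , st , ch) with close , a ← paint-closes cl = record
        { opening = opening′
        ; passing = passing′
        ; ending  = ending′
        }
        where
        C = sequence turns ch
        Y = chords turns ch
        φ = paintCross C Y e
        opening′ : T (around ω (φ (before zero , false)) (φ (before zero , true)) (φ (spare 0F , true)) (φ (spare 0F , false))
                              (φ (spare 1F , true)) (φ (spare 1F , false)))
        opening′ rewrite paint-before C Y e close zero false | paint-before C Y e close zero true
          | paint-spare C Y e 0F true | paint-spare C Y e 0F false | paint-spare C Y e 1F true | paint-spare C Y e 1F false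
          | sequence-zero turns ch = proj₁ (start-parts c e st)
        passing′ : ∀ l → T (advance (turns l) (coloursAt φ (inject₁ l)) (coloursAt φ (suc l)) (chordAt φ l))
        passing′ l = subst T (sym (begin
          advance (turns l) (coloursAt φ (inject₁ l)) (coloursAt φ (suc l)) (chordAt φ l)
            ≡⟨ cong (λ c → advance (turns l) c (coloursAt φ (suc l)) (chordAt φ l)) (coloursAt-paint C Y e close (inject₁ l)) ⟩
          advance (turns l) (C (inject₁ l)) (coloursAt φ (suc l)) (chordAt φ l)
            ≡⟨ cong₂ (advance (turns l) (C (inject₁ l))) (coloursAt-paint C Y e close (suc l)) (chordAt-paint C Y e l) ⟩
          advance (turns l) (C (inject₁ l)) (C (suc l)) (Y l) ∎)) (sequence-advance turns ch l)
          where open ≡-Reasoning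
        ending′ : T (around ω′ (φ (after (fromℕ n) , true)) (φ (after (fromℕ n) , false)) (φ (spare 0F , false)) (φ (spare 0F , true))
                               (φ (spare 1F , false)) (φ (spare 1F , true)))
        ending′ rewrite paint-after C Y e (fromℕ n) true | paint-after C Y e (fromℕ n) false
          | paint-spare C Y e 0F true | paint-spare C Y e 0F false | paint-spare C Y e 1F true | paint-spare C Y e 1F false = a

      coloursAt-cong : ∀ {φ ψ} → φ ≗ ψ → coloursAt φ ≗ coloursAt ψ
      coloursAt-cong eq i = cong₂ _∷_ (eq _) (cong₂ _∷_ (eq _) (cong₂ _∷_ (eq _) (cong (_∷ []) (eq _))))

      chordAt-cong : ∀ {φ ψ} → φ ≗ ψ → chordAt φ ≗ chordAt ψ
      chordAt-cong eq l = cong₂ _∷_ (eq _) (cong (_∷ []) (eq _))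

      spares-cong : ∀ {φ ψ} → φ ≗ ψ → spares φ ≡ spares ψ
      spares-cong eq = cong₂ _∷_ (eq _) (cong₂ _∷_ (eq _) (cong₂ _∷_ (eq _) (cong (_∷ []) (eq _))))

      paint-injective : ∀ cl cl′ → paintClosed cl ≗ paintClosed cl′ → cl ≡ cl′
      paint-injective cl@(c , e , st , ch) cl′@(c′ , e′ , st′ , ch′) eq
        = same (trans (sym (sequence-zero turns ch)) (trans (C≗C′ zero) (sequence-zero turns ch′)))
               (trans (sym (spares-paint (sequence turns ch) (chords turns ch) e))
                 (trans (spares-cong eq) (spares-paint (sequence turns ch′) (chords turns ch′) e′))) st st′ ch ch′ C≗C′ Y≗Y′
        where
        C≗C′ : sequence turns ch ≗ sequence turns ch′
        C≗C′ i = trans (sym (coloursAt-paint (sequence turns ch) (chords turns ch) e (proj₁ (paint-closes cl)) i))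
          (trans (coloursAt-cong eq i) (coloursAt-paint (sequence turns ch′) (chords turns ch′) e′ (proj₁ (paint-closes cl′)) i))
        Y≗Y′ : chords turns ch ≗ chords turns ch′
        Y≗Y′ l = trans (sym (chordAt-paint (sequence turns ch) (chords turns ch) e l))
          (trans (chordAt-cong eq l) (chordAt-paint (sequence turns ch′) (chords turns ch′) e′ l))
        same : ∀ {c c′ e e′} → c ≡ c′ → e ≡ e′ → (st : T (start ω ω′ c e)) (st′ : T (start ω ω′ c′ e′)) →
          (ch : Chain (tabulate turns) (outer ω′ c e) c) (ch′ : Chain (tabulate turns) (outer ω′ c′ e′) c′) →
          sequence turns ch ≗ sequence turns ch′ → chords turns ch ≗ chords turns ch′ →
          _≡_ {A = Closed ω ω′ (tabulate turns)} (c , e , st , ch) (c′ , e′ , st′ , ch′)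
        same {c} {e = e} refl refl st st′ ch ch′ cs ys =
          cong₂ (λ st ch → c , e , st , ch) (Bool.T-irrelevant st st′) (chain-unique turns ch ch′ cs ys)

      module _ (φ : Dart → Bool) (con : Consistent φ) where
        open Consistent con

        close : ∀ κ → φ (before (fromℕ n) , κ) ≡ φ (after zero , κ)
        close κ = cong (λ k → φ (path k , κ)) (low-fromℕ n)

        sides : T (spareSide ω′ (spares φ)) × T (glued (outer ω′ (coloursAt φ zero) (spares φ)) (coloursAt φ (fromℕ n)))
        sides = closing⁻ ω′ (close false) (close true) ending

        closed : Closed ω ω′ (tabulate turns)
        closed = coloursAt φ zero , spares φ , T-∧⁺ opening (proj₁ sides) ,
          chain turns (coloursAt φ) (chordAt φ) passing (proj₂ sides)

        sequence-closed : sequence turns (proj₂ (proj₂ (proj₂ closed))) ≗ coloursAt φ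
        sequence-closed = sequence-chain turns (coloursAt φ) (chordAt φ) passing (proj₂ sides)

        closed-paint : paintClosed closed ≗ φ
        closed-paint (e , κ) with edge e
        ... | chord′ l = trans (paint-chord (sequence turns _) (chords turns _) (spares φ) l κ)
          (trans (cong (λ y → chordPart y κ) (chords-chain turns (coloursAt φ) (chordAt φ) passing (proj₂ sides) l)) (part κ))
          where
          part : ∀ κ → chordPart (chordAt φ l) κ ≡ φ (chord l , κ)
          part false = refl
          part true  = refl
        ... | spare′ i = trans (paint-spare (sequence turns _) (chords turns _) (spares φ) i κ) (part i κ)
          where
          part : ∀ i κ → sparePart (spares φ) i κ ≡ φ (spare i , κ)
          part 0F false = refl
          part 0F true  = refl
          part 1F false = refl
          part 1F true  = refl
        ... | path′ k with summand n k
        ...   | left i = trans (paint-left (sequence turns _) (chords turns _) (spares φ) i κ)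
          (trans (cong (λ c → lowPart c κ) (sequence-closed (inject₁ i)))
            (trans (part κ) (cong (λ k → φ (path k , κ)) (low-inject₁ n i))))
          where
          part : ∀ κ → lowPart (coloursAt φ (inject₁ i)) κ ≡ φ (before (inject₁ i) , κ)
          part false = refl
          part true  = refl
        ...   | right i = trans (paint-after (sequence turns _) (chords turns _) (spares φ) i κ)
          (trans (cong (λ c → highPart c κ) (sequence-closed i)) (part κ))
          where
          part : ∀ κ → highPart (coloursAt φ i) κ ≡ φ (after i , κ)
          part false = refl
          part true  = refl

-- Counting strand diagrams by genus

2^-injective : ∀ {a b} → 2 ^ a ≡ 2 ^ b → a ≡ b
2^-injective {a} {b} eq with ℕ.<-cmp a b
... | tri< a<b _ _ = contradiction eq (ℕ.<⇒≢ (ℕ.^-monoʳ-< 2 (s≤s (s≤s z≤n)) a<b))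
... | tri≈ _ a≡b _ = a≡b
... | tri> _ _ b<a = contradiction (sym eq) (ℕ.<⇒≢ (ℕ.^-monoʳ-< 2 (s≤s (s≤s z≤n)) b<a))

closingGenus : State → Bool
closingGenus (hooked i j k l) = i == k ∧ j == l
closingGenus _                = false

-- Unlike  true == y,  agree true y  reduces to y.
agree : Bool → Bool → Bool
agree false y = not y
agree true  y = y

-- The values are forced by `capacity`: twice the cost is `suc (capacity s)` minus the loop
-- completed in the step minus the capacity of the next state.
cost : Rotations → State → Bool
cost (false , false) (through σ τ)           = τ
cost (true  , true)  (through σ τ)           = σ
cost _               (through σ τ)           = σ ∨ τ
cost (true  , false) (hooked false true k l) = false
cost (true  , false) (hooked true false k l) = true
cost (false , true)  (hooked true false k l) = false
cost (false , true)  (hooked false true k l) = true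
cost _               (hooked i j k l)        = agree (i xor j) (k xor l)
cost (true  , false) (split true k)          = false
cost (false , true)  (split true k)          = false
cost _               (split m k)             = agree m k

genusOf : State → List Rotations → ℕ
genusOf s []       = bit (closingGenus s)
genusOf s (g ∷ gs) = bit (cost g s) + genusOf (next g s) gs

-- The potential for which  loops + 2 · genus − (number of steps)  depends on the
-- initial state only.
capacity : State → ℕ
capacity (through σ τ)    = 2 + bit σ + bit τ
capacity (hooked i j k l) = 2 + bit (agree (i xor j) (k xor l))
capacity (split m k)      = 2 ∸ bit (m xor k)

balanced-closing : ∀ s → closingLoops s + 2 * bit (closingGenus s) ≡ capacity s
balanced-closing (through σ τ)                 = ℕ.+-identityʳ _
balanced-closing (hooked false false false false) = refl
balanced-closing (hooked false false false true)  = refl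
balanced-closing (hooked false false true  false) = refl
balanced-closing (hooked false false true  true)  = refl
balanced-closing (hooked false true  false false) = refl
balanced-closing (hooked false true  false true)  = refl
balanced-closing (hooked false true  true  false) = refl
balanced-closing (hooked false true  true  true)  = refl
balanced-closing (hooked true  false false false) = refl
balanced-closing (hooked true  false false true)  = refl
balanced-closing (hooked true  false true  false) = refl
balanced-closing (hooked true  false true  true)  = refl
balanced-closing (hooked true  true  false false) = refl
balanced-closing (hooked true  true  false true)  = refl
balanced-closing (hooked true  true  true  false) = refl
balanced-closing (hooked true  true  true  true)  = refl
balanced-closing (split m k)                   = ℕ.+-identityʳ _

BalancedStep : Rotations → State → Bool
BalancedStep g s = (bit (loop g s) + 2 * bit (cost g s) + capacity (next g s)) ≡ᵇ suc (capacity s)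

through-balanced split-balanced : Vec Bool 4 → Bool
through-balanced (α ∷ β ∷ σ ∷ τ ∷ []) = BalancedStep (α , β) (through σ τ)
split-balanced   (α ∷ β ∷ m ∷ k ∷ []) = BalancedStep (α , β) (split m k)

hooked-balanced : Vec Bool 6 → Bool
hooked-balanced (α ∷ β ∷ i ∷ j ∷ k ∷ l ∷ []) = BalancedStep (α , β) (hooked i j k l)

balanced-step : ∀ g s → bit (loop g s) + 2 * bit (cost g s) + capacity (next g s) ≡ suc (capacity s)
balanced-step (α , β) (through σ τ)    = ℕ.≡ᵇ⇒≡ _ _ (∀ᵛ-sound 4 through-balanced tt (α ∷ β ∷ σ ∷ τ ∷ []))
balanced-step (α , β) (hooked i j k l) = ℕ.≡ᵇ⇒≡ _ _ (∀ᵛ-sound 6 hooked-balanced tt (α ∷ β ∷ i ∷ j ∷ k ∷ l ∷ []))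
balanced-step (α , β) (split m k)      = ℕ.≡ᵇ⇒≡ _ _ (∀ᵛ-sound 4 split-balanced tt (α ∷ β ∷ m ∷ k ∷ []))

balanced : ∀ s gs → loops s gs + 2 * genusOf s gs ≡ length gs + capacity s
balanced s []       = balanced-closing s
balanced s (g ∷ gs) = begin
  (l + L) + 2 * (c + Γ)             ≡⟨ rearrange l L c Γ ⟩
  l + 2 * c + (L + 2 * Γ)           ≡⟨ cong (l + 2 * c +_) (balanced (next g s) gs) ⟩
  l + 2 * c + (n + P)               ≡⟨ rearrange′ l c n P ⟩
  n + (l + 2 * c + P)               ≡⟨ cong (n +_) (balanced-step g s) ⟩
  n + suc (capacity s)              ≡⟨ ℕ.+-suc n (capacity s) ⟩
  suc n + capacity s                ∎
  where
  open ≡-Reasoning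
  l = bit (loop g s)
  L = loops (next g s) gs
  c = bit (cost g s)
  Γ = genusOf (next g s) gs
  n = length gs
  P = capacity (next g s)
  open +-*-Solver
  rearrange : ∀ l L c Γ → (l + L) + 2 * (c + Γ) ≡ l + 2 * c + (L + 2 * Γ)
  rearrange = solve 4 (λ l L c Γ → (l :+ L) :+ con 2 :* (c :+ Γ) := l :+ con 2 :* c :+ (L :+ con 2 :* Γ)) refl
  rearrange′ : ∀ l c n P → l + 2 * c + (n + P) ≡ n + (l + 2 * c + P)
  rearrange′ = solve 4 (λ l c n P → l :+ con 2 :* c :+ (n :+ P) := n :+ (l :+ con 2 :* c :+ P)) refl

initial : Bool → Bool → State
initial ω ω′ = if ω xor ω′ then through false false else hooked false false false false

-- Both closings lead to the same constant: `through false false` has capacity 2 and the digon adds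
-- 1, while the hooked initial state has capacity 3.
facesOf-balanced : ∀ ω ω′ gs → facesOf ω ω′ gs + 2 * genusOf (initial ω ω′) gs ≡ length gs + 3
facesOf-balanced ω ω′ gs with ω xor ω′
... | true  = trans (cong suc (balanced (through false false) gs)) (sym (ℕ.+-suc (length gs) 2))
... | false = balanced (hooked false false false false) gs

-- Sums over all rotation systems

ΣR : (n : ℕ) → (List Rotations → ℕ) → ℕ
ΣR zero    h = h []
ΣR (suc n) h = ΣR n (h ∘ ((false , false) ∷_)) + ΣR n (h ∘ ((false , true) ∷_))
             + (ΣR n (h ∘ ((true , false) ∷_)) + ΣR n (h ∘ ((true , true) ∷_)))

ΣV-+ : ∀ m f h → ΣV m (λ v → f v + h v) ≡ ΣV m f + ΣV m h
ΣV-+ zero    f h = refl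
ΣV-+ (suc m) f h = trans
  (cong₂ _+_ (ΣV-+ m (f ∘ (false ∷_)) (h ∘ (false ∷_))) (ΣV-+ m (f ∘ (true ∷_)) (h ∘ (true ∷_))))
  (interchange (ΣV m (f ∘ (false ∷_))) _ (ΣV m (f ∘ (true ∷_))) _)
  where
  open +-*-Solver
  interchange : ∀ a b c d → (a + b) + (c + d) ≡ (a + c) + (b + d)
  interchange = solve 4 (λ a b c d → (a :+ b) :+ (c :+ d) := (a :+ c) :+ (b :+ d)) refl

ΣV-++ : ∀ m n h → ΣV (m + n) h ≡ ΣV m λ v → ΣV n λ v′ → h (v Vec.++ v′)
ΣV-++ zero    n h = refl
ΣV-++ (suc m) n h = cong₂ _+_ (ΣV-++ m n (h ∘ (false ∷_))) (ΣV-++ m n (h ∘ (true ∷_)))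

ΣV-∷ʳ : ∀ m h → ΣV (suc m) h ≡ ΣV m λ v → h (v Vec.∷ʳ false) + h (v Vec.∷ʳ true)
ΣV-∷ʳ zero    h = refl
ΣV-∷ʳ (suc m) h = cong₂ _+_ (ΣV-∷ʳ m (h ∘ (false ∷_))) (ΣV-∷ʳ m (h ∘ (true ∷_)))

pairs : ∀ {n} → Vec Bool n → Vec Bool n → List Rotations
pairs []       []       = []
pairs (a ∷ as) (d ∷ ds) = (a , d) ∷ pairs as ds

length-pairs : ∀ {n} (as ds : Vec Bool n) → length (pairs as ds) ≡ n
length-pairs []       []       = refl
length-pairs (a ∷ as) (d ∷ ds) = cong suc (length-pairs as ds)

tabulate-pairs : ∀ {n} (as ds : Vec Bool n) {f : Fin n → Rotations} →
  (∀ l → f l ≡ (Vec.lookup as l , Vec.lookup ds l)) → tabulate f ≡ pairs as ds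
tabulate-pairs []       []       eq = refl
tabulate-pairs (a ∷ as) (d ∷ ds) eq = cong₂ _∷_ (eq zero) (tabulate-pairs as ds (eq ∘ suc))

ΣV-pairs : ∀ n h → (ΣV n λ as → ΣV n λ ds → h (pairs as ds)) ≡ ΣR n h
ΣV-pairs zero    h = refl
ΣV-pairs (suc n) h = cong₂ _+_ (headed false) (headed true)
  where
  headed : ∀ a → (ΣV n λ as → ΣV (suc n) λ ds → h (pairs (a ∷ as) ds)) ≡
    ΣR n (h ∘ ((a , false) ∷_)) + ΣR n (h ∘ ((a , true) ∷_))
  headed a = trans
    (ΣV-+ n (λ as → ΣV n λ ds → h ((a , false) ∷ pairs as ds)) (λ as → ΣV n λ ds → h ((a , true) ∷ pairs as ds)))
    (cong₂ _+_ (ΣV-pairs n (h ∘ ((a , false) ∷_))) (ΣV-pairs n (h ∘ ((a , true) ∷_))))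

lookup-∷ʳ-inject₁ : ∀ {A : Set} {n} (xs : Vec A n) x l → Vec.lookup (xs Vec.∷ʳ x) (inject₁ l) ≡ Vec.lookup xs l
lookup-∷ʳ-inject₁ (y ∷ xs) x zero    = refl
lookup-∷ʳ-inject₁ (y ∷ xs) x (suc l) = lookup-∷ʳ-inject₁ xs x l

lookup-∷ʳ-fromℕ : ∀ {A : Set} {n} (xs : Vec A n) x → Vec.lookup (xs Vec.∷ʳ x) (fromℕ n) ≡ x
lookup-∷ʳ-fromℕ []       x = refl
lookup-∷ʳ-fromℕ (y ∷ xs) x = lookup-∷ʳ-fromℕ xs x

delayed : Bool → (ℕ → ℕ) → ℕ → ℕ
delayed false p g       = p g
delayed true  p zero    = 0
delayed true  p (suc g) = p g

count : State → ℕ → ℕ → ℕ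
count s zero    g = bit (does (bit (closingGenus s) ℕ.≟ g))
count s (suc n) g = after (false , false) + after (false , true) + (after (true , false) + after (true , true))
  where
  after : Rotations → ℕ
  after r = delayed (cost r s) (count (next r s) n) g

ΣR-zero : ∀ n → ΣR n (λ _ → 0) ≡ 0
ΣR-zero zero    = refl
ΣR-zero (suc n) rewrite ΣR-zero n = refl

count-≡ : ∀ s n g → ΣR n (λ gs → bit (does (genusOf s gs ℕ.≟ g))) ≡ count s n g
count-≡ s zero    g = refl
count-≡ s (suc n) g = cong₂ _+_ (cong₂ _+_ (after (false , false)) (after (false , true)))
                                (cong₂ _+_ (after (true , false)) (after (true , true)))
  where
  after : ∀ r → ΣR n (λ gs → bit (does (genusOf s (r ∷ gs) ℕ.≟ g))) ≡ delayed (cost r s) (count (next r s) n) g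
  after r = by-cost (cost r s) g
    where
    by-cost : ∀ c g → ΣR n (λ gs → bit (does (bit c + genusOf (next r s) gs ℕ.≟ g))) ≡ delayed c (count (next r s) n) g
    by-cost false g       = count-≡ (next r s) n g
    by-cost true  zero    = ΣR-zero n
    by-cost true  (suc g) = count-≡ (next r s) n g

module _ (n : ℕ) where

  open CrossEmbeddings n
  open Cross n using (w; w′; u)
  open Multigraph (cross n) using (order; size)
  open Embeddings (cross n) using (faces; HasGenus; hasGenus?)

  faces-≡ : ∀ bs → faces (system bs) ≡ facesOf (ω bs) (ω′ bs) (tabulate (turns bs))
  faces-≡ bs = 2^-injective (enumerations-agree (enumeration bs) (closedEnumeration bs)
    (bits↔ (faces (system bs))) (closed↔ (ω bs) (ω′ bs) (tabulate (turns bs))))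

  module _ (α β : Bool) (as ds : Vec Bool n) where

    code : Vec Bool order
    code = α ∷ (as Vec.++ (ds Vec.∷ʳ β))

    ω′-code : ω′ code ≡ β
    ω′-code = trans (Vec.lookup-++ʳ as (ds Vec.∷ʳ β) (fromℕ n)) (lookup-∷ʳ-fromℕ ds β)

    turns-code : tabulate (turns code) ≡ pairs as ds
    turns-code = tabulate-pairs as ds λ l → cong₂ _,_ (Vec.lookup-++ˡ as (ds Vec.∷ʳ β) l)
      (trans (Vec.lookup-++ʳ as (ds Vec.∷ʳ β) (inject₁ l)) (lookup-∷ʳ-inject₁ ds β l))

    faces-code : faces (system code) ≡ facesOf α β (pairs as ds)
    faces-code = trans (faces-≡ code) (cong₂ (facesOf α) ω′-code turns-code)

    genus-code : ∀ g → HasGenus (system code) g ⇔ genusOf (initial α β) (pairs as ds) ≡ g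
    genus-code g = mk⇔
      (λ eq → ℕ.*-cancelˡ-≡ _ _ 2 (ℕ.+-cancelˡ-≡ F _ _
        (trans euler (sym (ℕ.+-cancelˡ-≡ order _ _ (trans (sym (ℕ.+-assoc order F (2 * g)))
          (trans (trans (cong (λ f → order + f + 2 * g) (sym faces-code)) eq) (sizes n))))))))
      (λ { refl → trans (cong (λ f → order + f + 2 * Γ) faces-code) (trans (ℕ.+-assoc order F (2 * Γ))
        (trans (cong (order +_) euler) (sym (sizes n)))) })
      where
      F = facesOf α β (pairs as ds)
      Γ = genusOf (initial α β) (pairs as ds)
      euler : F + 2 * Γ ≡ n + 3
      euler = trans (facesOf-balanced α β (pairs as ds)) (cong (_+ 3) (length-pairs as ds))
      open +-*-Solver
      sizes : ∀ n → (n + suc n) + (n + 2) + 2 ≡ suc (n + suc n) + (n + 3)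
      sizes = solve 1 (λ n → (n :+ (con 1 :+ n)) :+ (n :+ con 2) :+ con 2 := (con 1 :+ (n :+ (con 1 :+ n))) :+ (n :+ con 3)) refl

    indicator-code : ∀ g → bit (does (hasGenus? (system code) g)) ≡ bit (does (genusOf (initial α β) (pairs as ds) ℕ.≟ g))
    indicator-code g = cong bit (does-⇔ (genus-code g) (hasGenus? (system code) g) (genusOf (initial α β) (pairs as ds) ℕ.≟ g))

  -- `initial α β` depends only on `α xor β`, so each of the two initial states arises from two of
  -- the four rotations at w and w′.
  embeddingCount-count : ∀ g → embeddingCount (cross n) g ≡
    2 * (count (hooked false false false false) n g + count (through false false) n g)
  embeddingCount-count g = begin
    embeddingCount (cross n) g                ≡⟨ embeddingCount-≡ g ⟩
    ΣV order h                                ≡⟨ cong₂ _+_ (fixed false) (fixed true) ⟩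
    (counts false false + counts false true) + (counts true false + counts true true)
                                              ≡⟨ double (counts false false) (counts false true) ⟩
    2 * (count (hooked false false false false) n g + count (through false false) n g) ∎
    where
    open ≡-Reasoning
    h : Vec Bool order → ℕ
    h bs = bit (does (hasGenus? (system bs) g))
    counts : Bool → Bool → ℕ
    counts α β = count (initial α β) n g
    fixed : ∀ α → ΣV (n + suc n) (h ∘ (α ∷_)) ≡ counts α false + counts α true
    fixed α = begin
      ΣV (n + suc n) (h ∘ (α ∷_))
        ≡⟨ ΣV-++ n (suc n) (h ∘ (α ∷_)) ⟩
      (ΣV n λ as → ΣV (suc n) λ ds → h (α ∷ (as Vec.++ ds)))
        ≡⟨ ΣV-cong n (λ as → trans (ΣV-∷ʳ n (λ ds → h (α ∷ (as Vec.++ ds))))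
          (ΣV-+ n (λ ds → h (code α false as ds)) (λ ds → h (code α true as ds)))) ⟩
      (ΣV n λ as → ΣV n (λ ds → h (code α false as ds)) + ΣV n (λ ds → h (code α true as ds)))
        ≡⟨ ΣV-+ n (λ as → ΣV n λ ds → h (code α false as ds)) (λ as → ΣV n λ ds → h (code α true as ds)) ⟩
      (ΣV n λ as → ΣV n λ ds → h (code α false as ds)) + (ΣV n λ as → ΣV n λ ds → h (code α true as ds))
        ≡⟨ cong₂ _+_ (counted false) (counted true) ⟩
      counts α false + counts α true ∎
      where
      counted : ∀ β → (ΣV n λ as → ΣV n λ ds → h (code α β as ds)) ≡ counts α β
      counted β = trans (ΣV-cong n λ as → ΣV-cong n λ ds → indicator-code α β as ds g)
        (trans (ΣV-pairs n (λ gs → bit (does (genusOf (initial α β) gs ℕ.≟ g)))) (count-≡ (initial α β) n g))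
    open +-*-Solver
    double : ∀ a b → (a + b) + (b + a) ≡ 2 * (a + b)
    double = solve 2 (λ a b → (a :+ b) :+ (b :+ a) := con 2 :* (a :+ b)) refl

-- Recurrences for the genus polynomials

-- Coefficient sequences stand for polynomials in z; shift multiplies by z.
shift : (ℕ → ℕ) → ℕ → ℕ
shift = delayed true

shift-cong : ∀ {p q : ℕ → ℕ} → p ≗ q → shift p ≗ shift q
shift-cong eq zero    = refl
shift-cong eq (suc i) = eq i

delayed-cong : ∀ b {p q : ℕ → ℕ} → p ≗ q → delayed b p ≗ delayed b q
delayed-cong false eq = eq
delayed-cong true  eq = shift-cong eq

delayed-+ : ∀ b (p q : ℕ → ℕ) i → delayed b p i + delayed b q i ≡ delayed b (λ i → p i + q i) i
delayed-+ false p q i       = refl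
delayed-+ true  p q zero    = refl
delayed-+ true  p q (suc i) = refl

delayed-* : ∀ b k (p : ℕ → ℕ) i → k * delayed b p i ≡ delayed b (λ i → k * p i) i
delayed-* false k p i       = refl
delayed-* true  k p zero    = ℕ.*-zeroʳ k
delayed-* true  k p (suc i) = refl

-- Of two consecutive steps that change the parity exactly one costs a handle.
delayed-twice : ∀ b (p : ℕ → ℕ) i → delayed b (delayed (not b) p) i ≡ shift p i
delayed-twice false p i       = refl
delayed-twice true  p zero    = refl
delayed-twice true  p (suc i) = refl

one : ℕ → ℕ
one zero    = 1
one (suc i) = 0

splitCount : Bool → ℕ → ℕ → ℕ
splitCount k = count (split true k)

split-0 : ∀ m k i → count (split m k) 0 i ≡ one i
split-0 m k zero    = refl
split-0 m k (suc i) = refl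

split-1 : ∀ k i → splitCount k 1 i ≡ 2 * one i + 2 * delayed k one i
split-1 false zero          = refl
split-1 false (suc i)       = refl
split-1 true  zero          = refl
split-1 true  (suc zero)    = refl
split-1 true  (suc (suc i)) = refl

split-suc-true : ∀ k n i → splitCount k (suc n) i ≡ 2 * splitCount k n i + 2 * delayed k (count (split false k) n) i
split-suc-true false n i = lemma (count (split false false) n i) (splitCount false n i)
  where
  lemma : ∀ a b → (a + b) + (b + a) ≡ 2 * b + 2 * a
  lemma = solve-∀
split-suc-true true n i = lemma (shift (count (split false true) n) i) (splitCount true n i)
  where
  lemma : ∀ a b → (a + b) + (b + a) ≡ 2 * b + 2 * a
  lemma = solve-∀

split-suc-false : ∀ k n i → count (split false k) (suc n) i ≡ 4 * delayed (not k) (splitCount k n) i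
split-suc-false false n i = lemma (shift (splitCount false n) i)
  where
  lemma : ∀ a → (a + a) + (a + a) ≡ 4 * a
  lemma = solve-∀
split-suc-false true n i = lemma (splitCount true n i)
  where
  lemma : ∀ a → (a + a) + (a + a) ≡ 4 * a
  lemma = solve-∀

delayed-4 : ∀ b {q} (p : ℕ → ℕ) → (∀ i → q i ≡ 4 * delayed (not b) p i) → ∀ i → delayed b q i ≡ 4 * shift p i
delayed-4 b p eq i = trans (delayed-cong b eq i)
  (trans (sym (delayed-* b 4 (delayed (not b) p) i)) (cong (4 *_) (delayed-twice b p i)))

split-rec : ∀ k n i → splitCount k (suc (suc n)) i ≡ 2 * splitCount k (suc n) i + 8 * shift (splitCount k n) i
split-rec k n i = trans (split-suc-true k (suc n) i)
  (trans (cong (λ x → 2 * splitCount k (suc n) i + 2 * x) (delayed-4 k (splitCount k n) (split-suc-false k n) i))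
         (lemma (splitCount k (suc n) i) (shift (splitCount k n) i)))
  where
  lemma : ∀ a b → 2 * a + 2 * (4 * b) ≡ 2 * a + 8 * b
  lemma = solve-∀

-- hookedOdd p and hookedEven p are the counts for two hooked states whose
-- initial hook (k, l) satisfies p = k xor l.
hookedOdd hookedEven : Bool → ℕ → ℕ → ℕ
hookedOdd  p zero    i = delayed false one i + delayed p one i
hookedOdd  p (suc n) i = 2 * delayed p (hookedEven p n) i + hookedOdd p n i + 2 * shift (splitCount p n) i
hookedEven p zero    i = delayed false one i + delayed (not p) one i
hookedEven p (suc n) i = 4 * delayed (not p) (hookedOdd p n) i

-- Single hooked states distinguish all initial hooks; summed over the two current hooks with the
-- same parity `i xor j`, the counts depend on the initial hook only through `k xor l`.
Odd Even : Bool → Bool → ℕ → ℕ → ℕ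
Odd  k l n i = count (hooked false true k l) n i + count (hooked true false k l) n i
Even k l n i = count (hooked false false k l) n i + count (hooked true true k l) n i

odd-suc : ∀ k l n i → Odd k l (suc n) i ≡
  2 * delayed (k xor l) (Even k l n) i + Odd k l n i + 2 * shift (splitCount (k xor l) n) i
odd-suc k l n i = trans (lemma (δ (count (hooked false false k l) n) i) (δ (count (hooked true true k l) n) i)
    (shift (splitCount (k xor l) n) i) (count (hooked false true k l) n i) (count (hooked true false k l) n i))
  (cong (λ x → 2 * x + Odd k l n i + 2 * shift (splitCount (k xor l) n) i) (delayed-+ (k xor l) _ _ i))
  where
  δ = delayed (k xor l)
  lemma : ∀ a b z x y → ((a + z) + (x + b)) + ((b + y) + (z + a)) ≡ 2 * (a + b) + (x + y) + 2 * z
  lemma = solve-∀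

even-suc : ∀ k l n i → Even k l (suc n) i ≡ 4 * delayed (not (k xor l)) (Odd k l n) i
even-suc k l n i = trans (lemma (δ (count (hooked false true k l) n) i) (δ (count (hooked true false k l) n) i))
  (cong (4 *_) (delayed-+ (not (k xor l)) _ _ i))
  where
  δ = delayed (not (k xor l))
  lemma : ∀ a b → ((a + b) + (a + b)) + ((b + b) + (a + a)) ≡ 4 * (a + b)
  lemma = solve-∀

odd-≡  : ∀ k l n → Odd k l n ≗ hookedOdd (k xor l) n
even-≡ : ∀ k l n → Even k l n ≗ hookedEven (k xor l) n
odd-≡ false false zero zero          = refl
odd-≡ false false zero (suc i)       = refl
odd-≡ false true  zero zero          = refl
odd-≡ false true  zero (suc zero)    = refl
odd-≡ false true  zero (suc (suc i)) = refl
odd-≡ true  false zero zero          = refl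
odd-≡ true  false zero (suc zero)    = refl
odd-≡ true  false zero (suc (suc i)) = refl
odd-≡ true  true  zero zero          = refl
odd-≡ true  true  zero (suc i)       = refl
odd-≡ k l (suc n) i = trans (odd-suc k l n i)
  (cong₂ (λ x y → 2 * x + y + 2 * shift (splitCount (k xor l) n) i)
    (delayed-cong (k xor l) (even-≡ k l n) i) (odd-≡ k l n i))
even-≡ false false zero zero          = refl
even-≡ false false zero (suc zero)    = refl
even-≡ false false zero (suc (suc i)) = refl
even-≡ false true  zero zero          = refl
even-≡ false true  zero (suc i)       = refl
even-≡ true  false zero zero          = refl
even-≡ true  false zero (suc i)       = refl
even-≡ true  true  zero zero          = refl
even-≡ true  true  zero (suc zero)    = refl
even-≡ true  true  zero (suc (suc i)) = refl
even-≡ k l (suc n) i = trans (even-suc k l n i)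
  (cong (4 *_) (delayed-cong (not (k xor l)) (odd-≡ k l n) i))

hookedOdd-rec : ∀ p n i → hookedOdd p (suc (suc n)) i ≡
  hookedOdd p (suc n) i + 8 * shift (hookedOdd p n) i + 2 * shift (splitCount p (suc n)) i
hookedOdd-rec p n i = trans
  (cong (λ x → 2 * x + hookedOdd p (suc n) i + 2 * shift (splitCount p (suc n)) i)
    (delayed-4 p (hookedOdd p n) (λ _ → refl) i))
  (lemma (shift (hookedOdd p n) i) (hookedOdd p (suc n) i) (shift (splitCount p (suc n)) i))
  where
  lemma : ∀ a b c → 2 * (4 * a) + b + 2 * c ≡ b + 8 * a + 2 * c
  lemma = solve-∀

-- Both hooks join the same two strands.
Straight : ℕ → ℕ → ℕ
Straight n i = count (hooked false true false true) n i + count (hooked true false true false) n i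

crossed : ℕ → ℕ → ℕ
crossed n i = count (through false true) n i + count (through true false) n i

-- From a state counted by `crossed`, undoing the exchange costs a handle while exchanging the other
-- pair as well is free. The shift weights the two outcomes accordingly.
swapped : ℕ → ℕ → ℕ
swapped n i = count (through true true) n i + shift (count (through false false) n) i

straight-even : ∀ n i → count (hooked false false false true) n i + count (hooked true true true false) n i
                      + (count (hooked true true false true) n i + count (hooked false false true false) n i)
                      ≡ 2 * hookedEven true n i
straight-even n i = trans (lemma (count (hooked false false false true) n i) (count (hooked true true true false) n i) _ _)
  (trans (cong₂ _+_ (even-≡ false true n i) (even-≡ true false n i)) (double (hookedEven true n i)))
  where
  lemma : ∀ a b c d → a + b + (c + d) ≡ (a + c) + (d + b)
  lemma = solve-∀
  double : ∀ a → a + a ≡ 2 * a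
  double = solve-∀

-- `Straight` and `hookedOdd true` satisfy the same recurrence with coefficient 1 in front of the
-- previous value, so their initial difference z - 1 persists. It reappears as the correction -1 + z
-- of the genus polynomial.
straight-≡ : ∀ n i → Straight n i + one i ≡ hookedOdd true n i + shift one i
straight-≡ zero    zero          = refl
straight-≡ zero    (suc zero)    = refl
straight-≡ zero    (suc (suc i)) = refl
straight-≡ (suc n) zero          = trans (lemma (count (hooked false true false true) n 0) (count (hooked true false true false) n 0))
  (trans (straight-≡ n 0) (lemma′ (hookedOdd true n 0)))
  where
  lemma : ∀ a b → ((0 + 0) + (a + 0)) + ((0 + b) + (0 + 0)) + 1 ≡ a + b + 1
  lemma = solve-∀
  lemma′ : ∀ a → a + 0 ≡ 2 * 0 + a + 2 * 0 + 0
  lemma′ = solve-∀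
straight-≡ (suc n) (suc i) = begin
  ((a + z) + (o + b)) + ((b′ + o′) + (z + a′)) + one (suc i) ≡⟨ lemma a b a′ b′ z o o′ (one (suc i)) ⟩
  (a + b′ + (b + a′)) + (o + o′ + one (suc i)) + 2 * z       ≡⟨ cong₂ (λ x y → x + y + 2 * z) (straight-even n i) (straight-≡ n (suc i)) ⟩
  2 * hookedEven true n i + (hookedOdd true n (suc i) + shift one (suc i)) + 2 * z
    ≡⟨ lemma′ (hookedEven true n i) (hookedOdd true n (suc i)) (shift one (suc i)) z ⟩
  hookedOdd true (suc n) (suc i) + shift one (suc i) ∎
  where
  open ≡-Reasoning
  a  = count (hooked false false false true) n i
  b  = count (hooked true true false true) n i
  a′ = count (hooked false false true false) n i
  b′ = count (hooked true true true false) n i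
  z  = splitCount true n i
  o  = count (hooked false true false true) n (suc i)
  o′ = count (hooked true false true false) n (suc i)
  lemma : ∀ a b a′ b′ z o o′ e → ((a + z) + (o + b)) + ((b′ + o′) + (z + a′)) + e ≡ (a + b′ + (b + a′)) + (o + o′ + e) + 2 * z
  lemma = solve-∀
  lemma′ : ∀ x y e z → 2 * x + (y + e) + 2 * z ≡ 2 * x + y + 2 * z + e
  lemma′ = solve-∀

through-suc : ∀ n i → count (through false false) (suc n) i ≡ crossed n i + Straight n i
through-suc n i = lemma (count (through false true) n i) (count (through true false) n i)
  (count (hooked false true false true) n i) (count (hooked true false true false) n i)
  where
  lemma : ∀ a b c d → (a + d) + (c + b) ≡ a + b + (c + d)
  lemma = solve-∀

crossed-suc : ∀ n i → crossed (suc n) i ≡ 2 * swapped n i + 2 * shift (hookedOdd false n) i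
crossed-suc n zero = lemma (count (through true true) n 0)
  where
  lemma : ∀ a → ((0 + 0) + (0 + a)) + ((a + 0) + (0 + 0)) ≡ 2 * (a + 0) + 2 * 0
  lemma = solve-∀
crossed-suc n (suc i) = trans (lemma x y c d e f)
  (cong (2 * (x + y) +_) (trans (cong₂ _+_ (odd-≡ false false n i) (odd-≡ true true n i)) (double (hookedOdd false n i))))
  where
  x = count (through true true) n (suc i)
  y = count (through false false) n i
  c = count (hooked false true false false) n i
  d = count (hooked true false false false) n i
  e = count (hooked false true true true) n i
  f = count (hooked true false true true) n i
  lemma : ∀ x y c d e f → ((y + f) + (c + x)) + ((x + d) + (e + y)) ≡ 2 * (x + y) + ((c + d) + (e + f))
  lemma = solve-∀
  double : ∀ a → a + a ≡ 2 * a
  double = solve-∀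

swapped-suc : ∀ n i → swapped (suc n) i ≡ 2 * shift (crossed n) i + 2 * shift (hookedOdd true n) i
swapped-suc n zero    = refl
swapped-suc n (suc i) = trans (lemma x y c d e f)
  (cong (2 * (x + y) +_) (trans (cong₂ _+_ (odd-≡ false true n i) (odd-≡ true false n i)) (double (hookedOdd true n i))))
  where
  x = count (through false true) n i
  y = count (through true false) n i
  c = count (hooked false true false true) n i
  d = count (hooked true false false true) n i
  e = count (hooked false true true false) n i
  f = count (hooked true false true false) n i
  lemma : ∀ x y c d e f → ((y + d) + (e + x)) + ((x + f) + (c + y)) ≡ 2 * (x + y) + ((c + d) + (e + f))
  lemma = solve-∀
  double : ∀ a → a + a ≡ 2 * a
  double = solve-∀

crossed-rec : ∀ n i → crossed (suc (suc n)) i ≡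
  4 * shift (crossed n) i + 4 * shift (hookedOdd true n) i + 2 * shift (hookedOdd false (suc n)) i
crossed-rec n i = trans (crossed-suc (suc n) i) (trans
  (cong (λ x → 2 * x + 2 * shift (hookedOdd false (suc n)) i) (swapped-suc n i))
  (lemma (shift (crossed n) i) (shift (hookedOdd true n) i) (shift (hookedOdd false (suc n)) i)))
  where
  lemma : ∀ a b c → 2 * (2 * a + 2 * b) + 2 * c ≡ 4 * a + 4 * b + 2 * c
  lemma = solve-∀

open-suc : ∀ n i → count (hooked false false false false) (suc n) i ≡ 2 * shift (hookedOdd false n) i
open-suc n zero    = refl
open-suc n (suc i) = trans (lemma (count (hooked false true false false) n i) (count (hooked true false false false) n i))
  (cong (2 *_) (odd-≡ false false n i))
  where
  lemma : ∀ a b → (a + b) + (a + b) ≡ 2 * (a + b)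
  lemma = solve-∀

embeddingCount-suc : ∀ n i → embeddingCount (cross (suc n)) i + 2 * one i ≡
  2 * (2 * shift (hookedOdd false n) i + crossed n i + hookedOdd true n i + shift one i)
embeddingCount-suc n i = begin
  embeddingCount (cross (suc n)) i + 2 * one i
    ≡⟨ cong (_+ 2 * one i) (trans (embeddingCount-count (suc n) i)
         (cong (2 *_) (cong₂ _+_ (open-suc n i) (through-suc n i)))) ⟩
  2 * (2 * shift (hookedOdd false n) i + (crossed n i + Straight n i)) + 2 * one i
    ≡⟨ lemma (shift (hookedOdd false n) i) (crossed n i) (Straight n i) (one i) ⟩
  2 * (2 * shift (hookedOdd false n) i + crossed n i + (Straight n i + one i))
    ≡⟨ cong (λ x → 2 * (2 * shift (hookedOdd false n) i + crossed n i + x)) (straight-≡ n i) ⟩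
  2 * (2 * shift (hookedOdd false n) i + crossed n i + (hookedOdd true n i + shift one i))
    ≡⟨ cong (2 *_) (ℕ.+-assoc (2 * shift (hookedOdd false n) i + crossed n i) (hookedOdd true n i) (shift one i)) ⟨
  2 * (2 * shift (hookedOdd false n) i + crossed n i + hookedOdd true n i + shift one i) ∎
  where
  open ≡-Reasoning
  lemma : ∀ a b c d → 2 * (2 * a + (b + c)) + 2 * d ≡ 2 * (2 * a + b + (c + d))
  lemma = solve-∀

-- Closed form

-- The coefficients of the polynomials with F₀ = 0, F₁ = c and Fₙ₊₂ = a Fₙ₊₁ + b z Fₙ.
fib : (a b c : ℕ) → ℕ → ℕ → ℕ
fib a b c zero          i = 0
fib a b c (suc zero)    i = c * one i
fib a b c (suc (suc n)) i = a * fib a b c (suc n) i + b * shift (fib a b c n) i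

-- `h` solves the recurrence `split-rec` and `g` the homogeneous part of `hookedOdd-rec`. Both are
-- rescalings of `f`: 2ⁿ times it, respectively with z replaced by 4 z.
f g h : ℕ → ℕ → ℕ
f = fib 1 2 1
g = fib 1 8 1
h = fib 2 8 2

shift-fib : ∀ a b c n i → shift (fib a b c (suc (suc n))) i ≡
  a * shift (fib a b c (suc n)) i + b * shift (shift (fib a b c n)) i
shift-fib a b c n zero    = sym (cong₂ _+_ (ℕ.*-zeroʳ a) (ℕ.*-zeroʳ b))
shift-fib a b c n (suc i) = refl

split-closed : ∀ k n i → 2 * splitCount k n i ≡ h (suc n) i + 2 * delayed k (h n) i
split-closed k zero i = trans (cong (2 *_) (split-0 true k i))
  (trans (sym (ℕ.+-identityʳ _)) (cong (λ x → 2 * one i + 2 * x) (sym (zeros k i))))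
  where
  zeros : ∀ k i → delayed k (h 0) i ≡ 0
  zeros false i       = refl
  zeros true  zero    = refl
  zeros true  (suc i) = refl
split-closed k (suc zero) i = trans (cong (2 *_) (split-1 k i)) (trans (lemma (one i) (delayed k one i))
  (cong₂ (λ x y → 2 * (2 * one i) + 8 * x + 2 * y) (sym (zeros i)) (delayed-* k 2 one i)))
  where
  zeros : ∀ i → shift (h 0) i ≡ 0
  zeros zero    = refl
  zeros (suc i) = refl
  lemma : ∀ a b → 2 * (2 * a + 2 * b) ≡ 2 * (2 * a) + 8 * 0 + 2 * (2 * b)
  lemma = solve-∀
split-closed k (suc (suc n)) i = begin
  2 * splitCount k (suc (suc n)) i                  ≡⟨ cong (2 *_) (split-rec k n i) ⟩
  2 * (2 * splitCount k (suc n) i + 8 * shift (splitCount k n) i)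
    ≡⟨ lemma (splitCount k (suc n) i) (shift (splitCount k n) i) ⟩
  2 * (2 * splitCount k (suc n) i) + 8 * (2 * shift (splitCount k n) i)
    ≡⟨ cong₂ (λ x y → 2 * x + 8 * y) (split-closed k (suc n) i) (shifted i) ⟩
  2 * (h (suc (suc n)) i + 2 * delayed k (h (suc n)) i) + 8 * (shift (h (suc n)) i + 2 * shift (delayed k (h n)) i)
    ≡⟨ lemma′ (h (suc (suc n)) i) (delayed k (h (suc n)) i) (shift (h (suc n)) i) (shift (delayed k (h n)) i) ⟩
  h (suc (suc (suc n))) i + 2 * (2 * delayed k (h (suc n)) i + 8 * shift (delayed k (h n)) i)
    ≡⟨ cong (λ x → h (suc (suc (suc n))) i + 2 * x) (sym (delayed-h k i)) ⟩
  h (suc (suc (suc n))) i + 2 * delayed k (h (suc (suc n))) i ∎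
  where
  open ≡-Reasoning
  shifted : ∀ i → 2 * shift (splitCount k n) i ≡ shift (h (suc n)) i + 2 * shift (delayed k (h n)) i
  shifted zero    = refl
  shifted (suc i) = split-closed k n i
  delayed-h : ∀ k i → delayed k (h (suc (suc n))) i ≡ 2 * delayed k (h (suc n)) i + 8 * shift (delayed k (h n)) i
  delayed-h false i = refl
  delayed-h true  i = shift-fib 2 8 2 n i
  lemma : ∀ a b → 2 * (2 * a + 8 * b) ≡ 2 * (2 * a) + 8 * (2 * b)
  lemma = solve-∀
  lemma′ : ∀ a b c d → 2 * (a + 2 * b) + 8 * (c + 2 * d) ≡ (2 * a + 8 * c) + 2 * (2 * b + 8 * d)
  lemma′ = solve-∀

-- As h_{n+2} - h_{n+1} - 8 z h_n = h_{n+1}, the inhomogeneous term of `hookedOdd-rec`, expressed by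
-- `split-closed`, has the particular solution z h_{n+1} + 2 z h_n. The initial values leave the
-- homogeneous part 2 (1 - z) (g_{n+1} + g_n). For `hookedOdd-true` the delay gives z h_{n+1} + 2 z²
-- h_n and (1 - z) (g_{n+1} + 4 z g_n).
hookedOdd-false : ∀ n i → hookedOdd false n i + 2 * (shift (g (suc n)) i + shift (g n) i) ≡
  shift (h (suc n)) i + 2 * shift (h n) i + 2 * (g (suc n) i + g n i)
hookedOdd-false zero          zero          = refl
hookedOdd-false zero          (suc zero)    = refl
hookedOdd-false zero          (suc (suc i)) = refl
hookedOdd-false (suc zero)    zero          = refl
hookedOdd-false (suc zero)    (suc zero)    = refl
hookedOdd-false (suc zero)    (suc (suc zero)) = refl
hookedOdd-false (suc zero)    (suc (suc (suc i))) = refl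
hookedOdd-false (suc (suc n)) zero = trans (cong (_+ 2 * (0 + 0)) (hookedOdd-rec false n 0))
  (trans (lemma (hookedOdd false (suc n) 0)) (trans (hookedOdd-false (suc n) 0) (lemma′ (g (suc (suc n)) 0) (g (suc n) 0))))
  where
  lemma : ∀ a → a + 8 * 0 + 2 * 0 + 2 * (0 + 0) ≡ a + 2 * (0 + 0)
  lemma = solve-∀
  lemma′ : ∀ b a → 0 + 2 * 0 + 2 * (b + a) ≡ 0 + 2 * 0 + 2 * ((1 * b + 8 * 0) + (1 * a + 8 * 0))
  lemma′ = solve-∀
hookedOdd-false (suc (suc n)) (suc i) = begin
  hookedOdd false (suc (suc n)) (suc i) + 2 * (g (suc (suc (suc n))) i + g (suc (suc n)) i)
    ≡⟨ cong (_+ 2 * (g (suc (suc (suc n))) i + g (suc (suc n)) i)) (hookedOdd-rec false n (suc i)) ⟩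
  O₁ + 8 * O₀ + 2 * Z + 2 * ((1 * G₂ + 8 * G₁′) + (1 * G₁ + 8 * G₀′))
    ≡⟨ lemma O₁ O₀ Z G₂ G₁ G₁′ G₀′ ⟩
  (O₁ + 2 * (G₂ + G₁)) + 8 * (O₀ + 2 * (G₁′ + G₀′)) + 2 * Z
    ≡⟨ cong₂ _+_ (cong₂ (λ x y → x + 8 * y) (hookedOdd-false (suc n) (suc i)) (hookedOdd-false n i)) (split-closed false (suc n) i) ⟩
  (H₂ + 2 * H₁ + 2 * (g (suc (suc n)) (suc i) + g (suc n) (suc i))) + 8 * (H₁′ + 2 * H₀′ + 2 * (G₁ + g n i)) + (H₂ + 2 * H₁)
    ≡⟨ lemma′ H₂ H₁ H₁′ H₀′ (g (suc (suc n)) (suc i)) (g (suc n) (suc i)) G₁ (g n i) ⟩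
  (2 * H₂ + 8 * H₁′) + 2 * (2 * H₁ + 8 * H₀′) + 2 * ((1 * g (suc (suc n)) (suc i) + 8 * G₁) + (1 * g (suc n) (suc i) + 8 * g n i)) ∎
  where
  open ≡-Reasoning
  O₁  = hookedOdd false (suc n) (suc i)
  O₀  = hookedOdd false n i
  Z   = splitCount false (suc n) i
  G₂  = g (suc (suc n)) i
  G₁  = g (suc n) i
  G₁′ = shift (g (suc n)) i
  G₀′ = shift (g n) i
  H₂  = h (suc (suc n)) i
  H₁  = h (suc n) i
  H₁′ = shift (h (suc n)) i
  H₀′ = shift (h n) i
  lemma : ∀ O₁ O₀ Z G₂ G₁ G₁′ G₀′ → O₁ + 8 * O₀ + 2 * Z + 2 * ((1 * G₂ + 8 * G₁′) + (1 * G₁ + 8 * G₀′)) ≡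
    (O₁ + 2 * (G₂ + G₁)) + 8 * (O₀ + 2 * (G₁′ + G₀′)) + 2 * Z
  lemma = solve-∀
  lemma′ : ∀ H₂ H₁ H₁′ H₀′ K₂ K₁ G₁ G₀ →
    (H₂ + 2 * H₁ + 2 * (K₂ + K₁)) + 8 * (H₁′ + 2 * H₀′ + 2 * (G₁ + G₀)) + (H₂ + 2 * H₁) ≡
    (2 * H₂ + 8 * H₁′) + 2 * (2 * H₁ + 8 * H₀′) + 2 * ((1 * K₂ + 8 * G₁) + (1 * K₁ + 8 * G₀))
  lemma′ = solve-∀

hookedOdd-true : ∀ n i → hookedOdd true n i + (shift (g (suc n)) i + 4 * shift (shift (g n)) i) ≡
  shift (h (suc n)) i + 2 * shift (shift (h n)) i + (g (suc n) i + 4 * shift (g n) i)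
hookedOdd-true zero          zero                   = refl
hookedOdd-true zero          (suc zero)             = refl
hookedOdd-true zero          (suc (suc zero))       = refl
hookedOdd-true zero          (suc (suc (suc i)))    = refl
hookedOdd-true (suc zero)    zero                   = refl
hookedOdd-true (suc zero)    (suc zero)             = refl
hookedOdd-true (suc zero)    (suc (suc zero))       = refl
hookedOdd-true (suc zero)    (suc (suc (suc zero))) = refl
hookedOdd-true (suc zero)    (suc (suc (suc (suc i)))) = refl
hookedOdd-true (suc (suc n)) zero = trans (cong (_+ (0 + 4 * 0)) (hookedOdd-rec true n 0))
  (trans (lemma (hookedOdd true (suc n) 0)) (trans (hookedOdd-true (suc n) 0) (lemma′ (g (suc (suc n)) 0))))
  where
  lemma : ∀ a → a + 8 * 0 + 2 * 0 + (0 + 4 * 0) ≡ a + (0 + 4 * 0)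
  lemma = solve-∀
  lemma′ : ∀ b → 0 + 2 * 0 + (b + 4 * 0) ≡ 0 + 2 * 0 + ((1 * b + 8 * 0) + 4 * 0)
  lemma′ = solve-∀
hookedOdd-true (suc (suc n)) (suc i) = begin
  hookedOdd true (suc (suc n)) (suc i) + (g (suc (suc (suc n))) i + 4 * shift (g (suc (suc n))) i)
    ≡⟨ cong₂ (λ x y → x + (g (suc (suc (suc n))) i + 4 * y)) (hookedOdd-rec true n (suc i)) (shift-fib 1 8 1 n i) ⟩
  O₁ + 8 * O₀ + 2 * Z + ((1 * G₂ + 8 * G₁′) + 4 * (1 * G₁′ + 8 * G₀″))
    ≡⟨ lemma O₁ O₀ Z G₂ G₁′ G₀″ ⟩
  (O₁ + (G₂ + 4 * G₁′)) + 8 * (O₀ + (G₁′ + 4 * G₀″)) + 2 * Z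
    ≡⟨ cong₂ _+_ (cong₂ (λ x y → x + 8 * y) (hookedOdd-true (suc n) (suc i)) (hookedOdd-true n i)) (split-closed true (suc n) i) ⟩
  (H₂ + 2 * H₁′ + (g (suc (suc n)) (suc i) + 4 * G₁)) + 8 * (H₁′ + 2 * H₀″ + (G₁ + 4 * shift (g n) i)) + (H₂ + 2 * H₁′)
    ≡⟨ lemma′ H₂ H₁′ H₀″ (g (suc (suc n)) (suc i)) G₁ (shift (g n) i) ⟩
  (2 * H₂ + 8 * H₁′) + 2 * (2 * H₁′ + 8 * H₀″) + ((1 * g (suc (suc n)) (suc i) + 8 * G₁) + 4 * (1 * G₁ + 8 * shift (g n) i))
    ≡⟨ cong (λ x → (2 * H₂ + 8 * H₁′) + 2 * x + ((1 * g (suc (suc n)) (suc i) + 8 * G₁) + 4 * G₂)) (shift-fib 2 8 2 n i) ⟨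
  (2 * H₂ + 8 * H₁′) + 2 * shift (h (suc (suc n))) i + ((1 * g (suc (suc n)) (suc i) + 8 * G₁) + 4 * G₂) ∎
  where
  open ≡-Reasoning
  O₁  = hookedOdd true (suc n) (suc i)
  O₀  = hookedOdd true n i
  Z   = splitCount true (suc n) i
  G₂  = g (suc (suc n)) i
  G₁  = g (suc n) i
  G₁′ = shift (g (suc n)) i
  G₀″ = shift (shift (g n)) i
  H₂  = h (suc (suc n)) i
  H₁′ = shift (h (suc n)) i
  H₀″ = shift (shift (h n)) i
  lemma : ∀ O₁ O₀ Z G₂ G₁′ G₀″ → O₁ + 8 * O₀ + 2 * Z + ((1 * G₂ + 8 * G₁′) + 4 * (1 * G₁′ + 8 * G₀″)) ≡
    (O₁ + (G₂ + 4 * G₁′)) + 8 * (O₀ + (G₁′ + 4 * G₀″)) + 2 * Z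
  lemma = solve-∀
  lemma′ : ∀ H₂ H₁′ H₀″ K₂ G₁ G₀′ →
    (H₂ + 2 * H₁′ + (K₂ + 4 * G₁)) + 8 * (H₁′ + 2 * H₀″ + (G₁ + 4 * G₀′)) + (H₂ + 2 * H₁′) ≡
    (2 * H₂ + 8 * H₁′) + 2 * (2 * H₁′ + 8 * H₀″) + ((1 * K₂ + 8 * G₁) + 4 * (1 * G₁ + 8 * G₀′))
  lemma′ = solve-∀

-- top⁺ − top⁻ solves crossed-rec without its inhomogeneous terms; it is
-- concentrated near the maximum genus.
top⁺ top⁻ : ℕ → ℕ → ℕ
top⁺ zero          i = 2 * one i
top⁺ (suc zero)    i = 2 * one i
top⁺ (suc (suc n)) i = 4 * shift (top⁺ n) i
top⁻ zero          i = 0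
top⁻ (suc zero)    i = 6 * shift one i
top⁻ (suc (suc n)) i = 4 * shift (top⁻ n) i

-- `crossed-rec` advances by two steps and multiplies by 4 z, so its homogeneous solutions have one
-- free polynomial for each parity of n. The values 2 and 2 - 6 z of `top⁺` minus `top⁻` at n = 0
-- and n = 1 fit them to `crossed`.
crossed-closed : ∀ n i → crossed n i + (12 * shift (shift (g n)) i + top⁻ n i) ≡
  6 * shift (shift (h n)) i + 12 * shift (g n) i + top⁺ n i
crossed-closed zero          zero                = refl
crossed-closed zero          (suc zero)          = refl
crossed-closed zero          (suc (suc i))       = refl
crossed-closed (suc zero)    zero                = refl
crossed-closed (suc zero)    (suc zero)          = refl
crossed-closed (suc zero)    (suc (suc zero))    = refl
crossed-closed (suc zero)    (suc (suc (suc i))) = refl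
crossed-closed (suc (suc n)) zero    = cong (_+ 0) (crossed-rec n 0)
crossed-closed (suc (suc n)) (suc i) = begin
  crossed (suc (suc n)) (suc i) + (12 * shift (g (suc (suc n))) i + 4 * top⁻ n i)
    ≡⟨ cong₂ (λ x y → x + (12 * y + 4 * top⁻ n i)) (crossed-rec n (suc i)) (shift-fib 1 8 1 n i) ⟩
  4 * C + 4 * O + 2 * E + (12 * (1 * G₁′ + 8 * G₀″) + 4 * top⁻ n i)
    ≡⟨ lemma C O E G₁′ G₀″ (top⁻ n i) ⟩
  4 * (C + (12 * G₀″ + top⁻ n i)) + 4 * (O + (G₁′ + 4 * G₀″)) + 2 * (E + 2 * ((1 * G₁′ + 8 * G₀″) + G₁′))
    ≡⟨ cong (λ x → 4 * (C + (12 * G₀″ + top⁻ n i)) + 4 * (O + (G₁′ + 4 * G₀″)) + 2 * (E + 2 * (x + G₁′))) (shift-fib 1 8 1 n i) ⟨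
  4 * (C + (12 * G₀″ + top⁻ n i)) + 4 * (O + (G₁′ + 4 * G₀″)) + 2 * (E + 2 * (shift (g (suc (suc n))) i + G₁′))
    ≡⟨ cong₂ _+_ (cong₂ (λ x y → 4 * x + 4 * y) (crossed-closed n i) (hookedOdd-true n i)) (cong (2 *_) (hookedOdd-false (suc n) i)) ⟩
  4 * (6 * H₀″ + 12 * G₀′ + top⁺ n i) + 4 * (H₁′ + 2 * H₀″ + (G₁ + 4 * G₀′))
    + 2 * (shift (h (suc (suc n))) i + 2 * H₁′ + 2 * ((1 * G₁ + 8 * G₀′) + G₁))
    ≡⟨ cong (λ x → 4 * (6 * H₀″ + 12 * G₀′ + top⁺ n i) + 4 * (H₁′ + 2 * H₀″ + (G₁ + 4 * G₀′))
        + 2 * (x + 2 * H₁′ + 2 * ((1 * G₁ + 8 * G₀′) + G₁))) (shift-fib 2 8 2 n i) ⟩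
  4 * (6 * H₀″ + 12 * G₀′ + top⁺ n i) + 4 * (H₁′ + 2 * H₀″ + (G₁ + 4 * G₀′))
    + 2 * ((2 * H₁′ + 8 * H₀″) + 2 * H₁′ + 2 * ((1 * G₁ + 8 * G₀′) + G₁))
    ≡⟨ lemma′ H₀″ H₁′ G₁ G₀′ (top⁺ n i) ⟩
  6 * (2 * H₁′ + 8 * H₀″) + 12 * (1 * G₁ + 8 * G₀′) + 4 * top⁺ n i
    ≡⟨ cong (λ x → 6 * x + 12 * (1 * G₁ + 8 * G₀′) + 4 * top⁺ n i) (shift-fib 2 8 2 n i) ⟨
  6 * shift (h (suc (suc n))) i + 12 * g (suc (suc n)) i + 4 * top⁺ n i ∎
  where
  open ≡-Reasoning
  C   = crossed n i
  O   = hookedOdd true n i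
  E   = hookedOdd false (suc n) i
  G₁  = g (suc n) i
  G₀′ = shift (g n) i
  G₁′ = shift (g (suc n)) i
  G₀″ = shift (shift (g n)) i
  H₁′ = shift (h (suc n)) i
  H₀″ = shift (shift (h n)) i
  lemma : ∀ C O E G₁′ G₀″ t → 4 * C + 4 * O + 2 * E + (12 * (1 * G₁′ + 8 * G₀″) + 4 * t) ≡
    4 * (C + (12 * G₀″ + t)) + 4 * (O + (G₁′ + 4 * G₀″)) + 2 * (E + 2 * ((1 * G₁′ + 8 * G₀″) + G₁′))
  lemma = solve-∀
  lemma′ : ∀ H₀″ H₁′ G₁ G₀′ t → 4 * (6 * H₀″ + 12 * G₀′ + t) + 4 * (H₁′ + 2 * H₀″ + (G₁ + 4 * G₀′))
    + 2 * ((2 * H₁′ + 8 * H₀″) + 2 * H₁′ + 2 * ((1 * G₁ + 8 * G₀′) + G₁)) ≡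
    6 * (2 * H₁′ + 8 * H₀″) + 12 * (1 * G₁ + 8 * G₀′) + 4 * t
  lemma′ = solve-∀

-- The contributions of `2 z hookedOdd false`, `crossed` and `hookedOdd true` add up: 12 = 4 + 6 + 2
-- in front of `h n`, and 20 = 4 + 12 + 4 in front of `g n`.
main minor : ℕ → ℕ → ℕ
main  n i = h (suc n) i + 2 * shift (h (suc n)) i + 12 * shift (h n) i
minor n i = g (suc n) i + 4 * shift (g (suc n)) i + 20 * shift (g n) i

-- The genus polynomial is  2 (z main + (1 − z) minor + top⁺ − top⁻ − 1 + z),  with
-- both sides moved so that no subtraction occurs.
closed-form : ∀ n i → embeddingCount (cross (suc n)) i + 2 * (shift (minor n) i + top⁻ n i + one i) ≡
  2 * (shift (main n) i + minor n i + top⁺ n i + shift one i)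
closed-form n i = begin
  R + 2 * (shift (minor n) i + t⁻ + e)
    ≡⟨ cong (λ x → R + 2 * (x + t⁻ + e)) (shift-minor i) ⟩
  R + 2 * ((G₁′ + 4 * G₁″ + 20 * G₀″) + t⁻ + e)
    ≡⟨ lemma R G₁′ G₁″ G₀″ t⁻ e ⟩
  (R + 2 * e) + 2 * (G₁′ + 4 * G₁″ + 20 * G₀″ + t⁻)
    ≡⟨ cong (_+ 2 * (G₁′ + 4 * G₁″ + 20 * G₀″ + t⁻)) (embeddingCount-suc n i) ⟩
  2 * (2 * O₀ + C + O₁ + e′) + 2 * (G₁′ + 4 * G₁″ + 20 * G₀″ + t⁻)
    ≡⟨ lemma′ O₀ C O₁ e′ G₁′ G₁″ G₀″ t⁻ ⟩
  2 * (2 * (O₀ + 2 * (G₁″ + G₀″)) + (C + (12 * G₀″ + t⁻)) + (O₁ + (G₁′ + 4 * G₀″)) + e′)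
    ≡⟨ cong (λ x → 2 * (x + e′)) (cong₂ _+_ (cong₂ (λ x y → 2 * x + y) (shift-odd i) (crossed-closed n i)) (hookedOdd-true n i)) ⟩
  2 * (2 * (H₁″ + 2 * H₀″ + 2 * (G₁′ + G₀′)) + (6 * H₀″ + 12 * G₀′ + t⁺) + (H₁′ + 2 * H₀″ + (G₁ + 4 * G₀′)) + e′)
    ≡⟨ lemma″ H₁″ H₀″ G₁′ G₀′ t⁺ H₁′ G₁ e′ ⟩
  2 * ((H₁′ + 2 * H₁″ + 12 * H₀″) + (G₁ + 4 * G₁′ + 20 * G₀′) + t⁺ + e′)
    ≡⟨ cong (λ x → 2 * (x + (G₁ + 4 * G₁′ + 20 * G₀′) + t⁺ + e′)) (shift-main i) ⟨
  2 * (shift (main n) i + minor n i + t⁺ + e′) ∎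
  where
  open ≡-Reasoning
  R   = embeddingCount (cross (suc n)) i
  t⁺  = top⁺ n i
  t⁻  = top⁻ n i
  e   = one i
  e′  = shift one i
  C   = crossed n i
  O₀  = shift (hookedOdd false n) i
  O₁  = hookedOdd true n i
  G₁  = g (suc n) i
  G₁′ = shift (g (suc n)) i
  G₁″ = shift (shift (g (suc n))) i
  G₀′ = shift (g n) i
  G₀″ = shift (shift (g n)) i
  H₁′ = shift (h (suc n)) i
  H₁″ = shift (shift (h (suc n))) i
  H₀″ = shift (shift (h n)) i
  shift-minor : ∀ i → shift (minor n) i ≡ shift (g (suc n)) i + 4 * shift (shift (g (suc n))) i + 20 * shift (shift (g n)) i
  shift-minor zero    = refl
  shift-minor (suc i) = refl
  shift-main : ∀ i → shift (main n) i ≡ shift (h (suc n)) i + 2 * shift (shift (h (suc n))) i + 12 * shift (shift (h n)) i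
  shift-main zero    = refl
  shift-main (suc i) = refl
  shift-odd : ∀ i → shift (hookedOdd false n) i + 2 * (shift (shift (g (suc n))) i + shift (shift (g n)) i) ≡
    shift (shift (h (suc n))) i + 2 * shift (shift (h n)) i + 2 * (shift (g (suc n)) i + shift (g n) i)
  shift-odd zero    = refl
  shift-odd (suc i) = hookedOdd-false n i
  lemma : ∀ R a b c t e → R + 2 * ((a + 4 * b + 20 * c) + t + e) ≡ (R + 2 * e) + 2 * (a + 4 * b + 20 * c + t)
  lemma = solve-∀
  lemma′ : ∀ O C P e a b c t → 2 * (2 * O + C + P + e) + 2 * (a + 4 * b + 20 * c + t) ≡
    2 * (2 * (O + 2 * (b + c)) + (C + (12 * c + t)) + (P + (a + 4 * c)) + e)
  lemma′ = solve-∀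
  lemma″ : ∀ a b c d t p q e → 2 * (2 * (a + 2 * b + 2 * (c + d)) + (6 * b + 12 * d + t) + (p + 2 * b + (q + 4 * d)) + e) ≡
    2 * ((p + 2 * a + 12 * b) + (q + 4 * c + 20 * d) + t + e)
  lemma″ = solve-∀

-- Unimodality of the main term

-- G a b = 2ᵃ · binomial (a + b) a
G : ℕ → ℕ → ℕ
G zero    b       = 1
G (suc a) zero    = 2 * G a zero
G (suc a) (suc b) = 2 * G a (suc b) + G (suc a) b

f-vanishes : ∀ m i → m < 2 * i → f (suc m) i ≡ 0
f-vanishes zero          (suc i) _ = refl
f-vanishes (suc zero)    (suc i) _ with i
... | zero  = refl
... | suc _ = refl
f-vanishes (suc (suc m)) (suc i) m<
  rewrite f-vanishes (suc m) (suc i) (ℕ.<-trans (ℕ.n<1+n (suc m)) m<)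
        | f-vanishes m i (ℕ.≤-pred (ℕ.≤-pred (subst (suc (suc (suc m)) ≤_) (ℕ.*-suc 2 i) m<))) = refl

-- The parameter b = m - 2 a makes the coefficient 2ᵃ binom(m - a, a) symmetric up to the power and
-- avoids truncated subtraction.
f-G : ∀ a b {m} → m ≡ 2 * a + b → f (suc m) a ≡ G a b
f-G zero    zero          refl = refl
f-G zero    (suc zero)    refl = refl
f-G zero    (suc (suc b)) refl = trans (cong (λ x → 1 * x + 0) (f-G zero (suc b) refl)) refl
f-G (suc a) zero    eq = trans (cong (λ m → f (suc m) (suc a)) (trans eq (double a))) (cong₂ (λ x y → 1 * x + 2 * y)
  (f-vanishes (suc (2 * a)) (suc a) (ℕ.≤-reflexive (sym (ℕ.*-suc 2 a)))) (f-G a zero (sym (ℕ.+-identityʳ (2 * a)))))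
  where
  double : ∀ a → 2 * suc a + 0 ≡ suc (suc (2 * a))
  double = solve-∀
f-G (suc a) (suc b) eq = trans (cong (λ m → f (suc m) (suc a)) (trans eq (double a b))) (trans
  (cong₂ (λ x y → 1 * x + 2 * y) (f-G (suc a) b (lemma a b)) (f-G a (suc b) (sym (ℕ.+-suc (2 * a) b))))
  (swap (G (suc a) b) (G a (suc b))))
  where
  double : ∀ a b → 2 * suc a + suc b ≡ suc (suc (suc (2 * a + b)))
  double = solve-∀
  lemma : ∀ a b → suc (suc (2 * a + b)) ≡ 2 * suc a + b
  lemma = solve-∀
  swap : ∀ x y → 1 * x + 2 * y ≡ 2 * y + x
  swap = solve-∀

-- The absorption identities of binomial coefficients; Pascal's rule makes each of them lean on the
-- other.
G-b : ∀ a b → suc b * G a (suc b) ≡ (a + suc b) * G a b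
G-a : ∀ a b → suc a * G (suc a) b ≡ 2 * ((a + suc b) * G a b)
G-b zero    b = refl
G-b (suc a) b = begin
  suc b * (2 * G a (suc b) + G (suc a) b)          ≡⟨ lemma b (G a (suc b)) (G (suc a) b) ⟩
  2 * (suc b * G a (suc b)) + suc b * G (suc a) b  ≡⟨ cong (λ x → 2 * x + suc b * G (suc a) b) (G-b a b) ⟩
  2 * ((a + suc b) * G a b) + suc b * G (suc a) b  ≡⟨ cong (_+ suc b * G (suc a) b) (G-a a b) ⟨
  suc a * G (suc a) b + suc b * G (suc a) b        ≡⟨ ℕ.*-distribʳ-+ (G (suc a) b) (suc a) (suc b) ⟨
  (suc a + suc b) * G (suc a) b                    ∎
  where
  open ≡-Reasoning
  lemma : ∀ b x y → suc b * (2 * x + y) ≡ 2 * (suc b * x) + suc b * y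
  lemma = solve-∀
G-a a zero    = lemma a (G a zero)
  where
  lemma : ∀ a x → suc a * (2 * x) ≡ 2 * ((a + 1) * x)
  lemma = solve-∀
G-a a (suc b) = begin
  suc a * (2 * G a (suc b) + G (suc a) b)                   ≡⟨ lemma a (G a (suc b)) (G (suc a) b) ⟩
  2 * (suc a * G a (suc b)) + suc a * G (suc a) b           ≡⟨ cong (2 * (suc a * G a (suc b)) +_) (G-a a b) ⟩
  2 * (suc a * G a (suc b)) + 2 * ((a + suc b) * G a b)     ≡⟨ cong (λ x → 2 * (suc a * G a (suc b)) + 2 * x) (G-b a b) ⟨
  2 * (suc a * G a (suc b)) + 2 * (suc b * G a (suc b))     ≡⟨ lemma′ a b (G a (suc b)) ⟩
  2 * ((a + suc (suc b)) * G a (suc b))                     ∎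
  where
  open ≡-Reasoning
  lemma : ∀ a x y → suc a * (2 * x + y) ≡ 2 * (suc a * x) + suc a * y
  lemma = solve-∀
  lemma′ : ∀ a b x → 2 * (suc a * x) + 2 * (suc b * x) ≡ 2 * ((a + suc (suc b)) * x)
  lemma′ = solve-∀

-- Raising a by one at fixed m = 2 a + b lowers b by two, so this is the ratio 2 (b + 1) (b + 2) /
-- ((a + 1) (a + b + 2)) of consecutive coefficients of one `f`. It exceeds 1 exactly for a ≤ b.
G-ratio : ∀ a b → suc a * ((a + b + 2) * G (suc a) b) ≡ suc b * (2 * ((b + 2) * G a (suc (suc b))))
G-ratio a b = begin
  suc a * ((a + b + 2) * G (suc a) b)                   ≡⟨ lemma a b (G (suc a) b) ⟩
  (a + b + 2) * (suc a * G (suc a) b)                   ≡⟨ cong ((a + b + 2) *_) (G-a a b) ⟩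
  (a + b + 2) * (2 * ((a + suc b) * G a b))             ≡⟨ cong (λ x → (a + b + 2) * (2 * x)) (G-b a b) ⟨
  (a + b + 2) * (2 * (suc b * G a (suc b)))             ≡⟨ lemma′ a b (G a (suc b)) ⟩
  2 * suc b * ((a + suc (suc b)) * G a (suc b))         ≡⟨ cong (2 * suc b *_) (G-b a (suc b)) ⟨
  2 * suc b * (suc (suc b) * G a (suc (suc b)))         ≡⟨ lemma″ b (G a (suc (suc b))) ⟩
  suc b * (2 * ((b + 2) * G a (suc (suc b))))           ∎
  where
  open ≡-Reasoning
  lemma : ∀ a b x → suc a * ((a + b + 2) * x) ≡ (a + b + 2) * (suc a * x)
  lemma = solve-∀
  lemma′ : ∀ a b x → (a + b + 2) * (2 * (suc b * x)) ≡ 2 * suc b * ((a + suc (suc b)) * x)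
  lemma′ = solve-∀
  lemma″ : ∀ b x → 2 * suc b * (suc (suc b) * x) ≡ suc b * (2 * ((b + 2) * x))
  lemma″ = solve-∀

G-positive : ∀ a b → 2 ^ a ≤ G a b
G-positive zero    b       = ℕ.≤-refl
G-positive (suc a) zero    = ℕ.*-monoʳ-≤ 2 (G-positive a zero)
G-positive (suc a) (suc b) = ℕ.≤-trans (ℕ.*-monoʳ-≤ 2 (G-positive a (suc b))) (ℕ.m≤m+n _ _)

-- The factor (b + 2)/(a + 1) of the ratio is at most 1 and is dropped; the other one, 2 (b + 1)/(a
-- + b + 2), still records the distance from the peak.
G-falls : ∀ a b → b < a → (a + b + 2) * G (suc a) b ≤ 2 * suc b * G a (suc (suc b))
G-falls a b b<a = ℕ.*-cancelˡ-≤ (suc a) (begin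
  suc a * ((a + b + 2) * G (suc a) b)          ≡⟨ G-ratio a b ⟩
  suc b * (2 * ((b + 2) * G a (suc (suc b))))  ≡⟨ lemma b (G a (suc (suc b))) ⟩
  suc (suc b) * (2 * suc b * G a (suc (suc b))) ≤⟨ ℕ.*-monoˡ-≤ (2 * suc b * G a (suc (suc b))) (s≤s b<a) ⟩
  suc a * (2 * suc b * G a (suc (suc b)))      ∎)
  where
  open ℕ.≤-Reasoning
  lemma : ∀ b x → suc b * (2 * ((b + 2) * x)) ≡ suc (suc b) * (2 * suc b * x)
  lemma = solve-∀

-- For fixed b the ratio is smallest at a = b, where it equals (b + 2)/(b + 1).
G-rises : ∀ a b → a ≤ b → (b + 2) * G a (suc (suc b)) ≤ suc b * G (suc a) b
G-rises a b a≤b = ℕ.*-cancelˡ-≤ (2 * suc b) (begin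
  2 * suc b * ((b + 2) * G a (suc (suc b)))    ≡⟨ lemma b (G a (suc (suc b))) ⟩
  suc b * (2 * ((b + 2) * G a (suc (suc b))))  ≡⟨ G-ratio a b ⟨
  suc a * ((a + b + 2) * G (suc a) b)          ≤⟨ ℕ.*-mono-≤ (s≤s a≤b) (ℕ.*-monoˡ-≤ (G (suc a) b) (ℕ.+-monoˡ-≤ 2 (ℕ.+-monoˡ-≤ b a≤b))) ⟩
  suc b * ((b + b + 2) * G (suc a) b)          ≡⟨ lemma′ b (G (suc a) b) ⟩
  2 * suc b * (suc b * G (suc a) b)            ∎)
  where
  open ℕ.≤-Reasoning
  lemma : ∀ b x → 2 * suc b * ((b + 2) * x) ≡ suc b * (2 * ((b + 2) * x))
  lemma = solve-∀
  lemma′ : ∀ b x → suc b * ((b + b + 2) * x) ≡ 2 * suc b * (suc b * x)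
  lemma′ = solve-∀

f-falls : ∀ a b {m} → m ≡ 2 * a + suc (suc b) → b < a → (a + b + 2) * f (suc m) (suc a) ≤ 2 * suc b * f (suc m) a
f-falls a b eq b<a = subst₂ (λ x y → (a + b + 2) * x ≤ 2 * suc b * y)
  (sym (f-G (suc a) b (trans eq (lemma a b)))) (sym (f-G a (suc (suc b)) eq)) (G-falls a b b<a)
  where
  lemma : ∀ a b → 2 * a + suc (suc b) ≡ 2 * suc a + b
  lemma = solve-∀

f-rises : ∀ a b {m} → m ≡ 2 * a + suc (suc b) → a ≤ b → (b + 2) * f (suc m) a ≤ suc b * f (suc m) (suc a)
f-rises a b eq a≤b = subst₂ (λ x y → (b + 2) * x ≤ suc b * y)
  (sym (f-G a (suc (suc b)) eq)) (sym (f-G (suc a) b (trans eq (lemma a b)))) (G-rises a b a≤b)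
  where
  lemma : ∀ a b → 2 * a + suc (suc b) ≡ 2 * suc a + b
  lemma = solve-∀

f-decreasing : ∀ a {m} → m ≤ suc (3 * a) → f (suc m) (suc a) ≤ f (suc m) a
f-decreasing a {m} m≤ with ℕ.<-≤-connex m (2 * suc a)
... | inj₁ m<   = ℕ.≤-trans (ℕ.≤-reflexive (f-vanishes m (suc a) m<)) z≤n
... | inj₂ 2a≤m with b , refl ← ℕ.m≤n⇒∃[o]m+o≡n 2a≤m = ℕ.*-cancelˡ-≤ (2 * suc b)
  (ℕ.≤-trans (ℕ.*-monoˡ-≤ (f (suc (2 * suc a + b)) (suc a)) factor) (f-falls a b (lemma a b) b<a))
  where
  lemma : ∀ a b → 2 * suc a + b ≡ 2 * a + suc (suc b)
  lemma = solve-∀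
  b<a : b < a
  b<a = ℕ.+-cancelˡ-≤ (suc (2 * a)) (suc b) a (subst₂ _≤_ (left′ a b) (right′ a) m≤)
    where
    left′ : ∀ a b → 2 * suc a + b ≡ suc (2 * a) + suc b
    left′ = solve-∀
    right′ : ∀ a → suc (3 * a) ≡ suc (2 * a) + a
    right′ = solve-∀
  factor : 2 * suc b ≤ a + b + 2
  factor = subst (_≤ a + b + 2) (lemma′ b) (ℕ.+-monoˡ-≤ 2 (ℕ.+-monoˡ-≤ b (ℕ.<⇒≤ b<a)))
    where
    lemma′ : ∀ b → b + b + 2 ≡ 2 * suc b
    lemma′ = solve-∀

-- Main and minor term as multiples of the same coefficients

Q H : ℕ → ℕ → ℕ
Q n i = f (suc n) i + 2 * shift (f (suc n)) i + 6 * shift (f n) i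
H n i = f (suc n) i + shift (f (suc n)) i + 5 * shift (f n) i

H≤Q : ∀ n i → H n i ≤ Q n i
H≤Q n i = ℕ.+-mono-≤ (ℕ.+-monoʳ-≤ (f (suc n) i) (ℕ.m≤m+n _ _)) (ℕ.*-monoˡ-≤ (shift (f n) i) (ℕ.n≤1+n 5))

-- Passing from `f (n + 3)` at i to `f n` at i - 1 lowers both a = i and b = m - 2 a by one. Their
-- difference stays, so both summands rise or fall together.
Q-≡ : ∀ n i → Q n i ≡ f (suc (suc (suc n))) i + 4 * shift (f n) i
Q-≡ n i = lemma (f (suc n) i) (shift (f (suc n)) i) (shift (f n) i)
  where
  lemma : ∀ x y z → x + 2 * y + 6 * z ≡ 1 * (1 * x + 2 * z) + 2 * y + 4 * z
  lemma = solve-∀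

g-f : ∀ n i → g n i ≡ 4 ^ i * f n i
g-f zero          i = sym (ℕ.*-zeroʳ (4 ^ i))
g-f (suc zero)    zero    = refl
g-f (suc zero)    (suc i) = sym (ℕ.*-zeroʳ (4 ^ suc i))
g-f (suc (suc n)) i = trans (cong (λ x → 1 * x + 8 * shift (g n) i) (g-f (suc n) i)) (trans
  (cong (1 * (4 ^ i * f (suc n) i) +_) (shifted i)) (lemma (4 ^ i) (f (suc n) i) (shift (f n) i)))
  where
  shifted : ∀ i → 8 * shift (g n) i ≡ 4 ^ i * (2 * shift (f n) i)
  shifted zero    = refl
  shifted (suc i) = trans (cong (8 *_) (g-f n i)) (lemma′ (4 ^ i) (f n i))
    where
    lemma′ : ∀ p x → 8 * (p * x) ≡ 4 * p * (2 * x)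
    lemma′ = solve-∀
  lemma : ∀ p x y → 1 * (p * x) + p * (2 * y) ≡ p * (1 * x + 2 * y)
  lemma = solve-∀

h-f : ∀ n i → h n i ≡ 2 ^ n * f n i
shift-h-f : ∀ n i → shift (h n) i ≡ 2 ^ n * shift (f n) i
h-f zero          i = refl
h-f (suc zero)    i = lemma (one i)
  where
  lemma : ∀ x → 2 * x ≡ 2 * (1 * x)
  lemma = solve-∀
h-f (suc (suc n)) i = trans (cong₂ (λ x y → 2 * x + 8 * y) (h-f (suc n) i) (shift-h-f n i))
  (lemma (2 ^ n) (f (suc n) i) (shift (f n) i))
  where
  lemma : ∀ p x y → 2 * (2 * p * x) + 8 * (p * y) ≡ 2 * (2 * p) * (1 * x + 2 * y)
  lemma = solve-∀
shift-h-f n zero    = sym (ℕ.*-zeroʳ (2 ^ n))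
shift-h-f n (suc i) = h-f n i

main-Q : ∀ n i → main n i ≡ 2 ^ suc n * Q n i
main-Q n i = trans
  (cong₂ _+_ (cong₂ (λ x y → x + 2 * y) (h-f (suc n) i) (shift-h-f (suc n) i)) (cong (12 *_) (shift-h-f n i)))
  (lemma (2 ^ n) (f (suc n) i) (shift (f (suc n)) i) (shift (f n) i))
  where
  lemma : ∀ p x y z → 2 * p * x + 2 * (2 * p * y) + 12 * (p * z) ≡ 2 * p * (x + 2 * y + 6 * z)
  lemma = solve-∀

minor-H : ∀ n i → minor n i ≡ 4 ^ i * H n i
minor-H n zero    = trans (cong (λ x → x + 0 + 0) (g-f (suc n) 0)) (lemma (f (suc n) 0))
  where
  lemma : ∀ x → 1 * x + 0 + 0 ≡ 1 * (x + 0 + 5 * 0)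
  lemma = solve-∀
minor-H n (suc i) = trans
  (cong₂ _+_ (cong₂ (λ x y → x + 4 * y) (g-f (suc n) (suc i)) (g-f (suc n) i)) (cong (20 *_) (g-f n i)))
  (lemma (4 ^ i) (f (suc n) (suc i)) (f (suc n) i) (f n i))
  where
  lemma : ∀ p x y z → 4 * p * x + 4 * (p * y) + 20 * (p * z) ≡ 4 * p * (x + y + 5 * z)
  lemma = solve-∀

minor≤ : ∀ n i → minor n i ≤ 4 ^ i * Q n i
minor≤ n i = ℕ.≤-trans (ℕ.≤-reflexive (minor-H n i)) (ℕ.*-monoʳ-≤ (4 ^ i) (H≤Q n i))

top⁺≤ : ∀ n i → top⁺ n i ≤ 2 * 4 ^ i
top⁺≤ zero          zero    = ℕ.≤-refl
top⁺≤ zero          (suc i) = z≤n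
top⁺≤ (suc zero)    zero    = ℕ.≤-refl
top⁺≤ (suc zero)    (suc i) = z≤n
top⁺≤ (suc (suc n)) zero    = z≤n
top⁺≤ (suc (suc n)) (suc i) = ℕ.≤-trans (ℕ.*-monoʳ-≤ 4 (top⁺≤ n i)) (ℕ.≤-reflexive (lemma (4 ^ i)))
  where
  lemma : ∀ p → 4 * (2 * p) ≡ 2 * (4 * p)
  lemma = solve-∀

top⁻≤ : ∀ n i → top⁻ n i ≤ 2 * 4 ^ i
top⁻≤ zero          i             = z≤n
top⁻≤ (suc zero)    zero          = z≤n
top⁻≤ (suc zero)    (suc zero)    = ℕ.m≤n+m 6 2
top⁻≤ (suc zero)    (suc (suc i)) = z≤n
top⁻≤ (suc (suc n)) zero          = z≤n
top⁻≤ (suc (suc n)) (suc i) = ℕ.≤-trans (ℕ.*-monoʳ-≤ 4 (top⁻≤ n i)) (ℕ.≤-reflexive (lemma (4 ^ i)))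
  where
  lemma : ∀ p → 4 * (2 * p) ≡ 2 * (4 * p)
  lemma = solve-∀

2^-split : ∀ i k → 2 ^ (2 * i + k) ≡ 4 ^ i * 2 ^ k
2^-split i k = trans (ℕ.^-distribˡ-+-* 2 (2 * i) k) (cong (_* 2 ^ k) (sym (ℕ.^-*-assoc 2 2 i)))

-- Ascent up to the peak

module Rise (j k : ℕ) (j≤ : j ≤ suc k) (8≤k : 8 ≤ k) where

  -- The genus is i = j + 1 and k = n + 1 - 2 i, so 2ᵏ is the ratio of the factors of `main` and
  -- `minor`. The hypothesis `j≤` says 3 i ≤ n + 3.
  n : ℕ
  n = suc (2 * j + k)

  parts : ∀ j → j ≤ suc k → (k + 3) * shift (f (suc (2 * j + k))) j ≤ (k + 2) * f (suc (2 * j + k)) j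
  parts zero    _         = ℕ.≤-trans (ℕ.≤-reflexive (ℕ.*-zeroʳ (k + 3))) z≤n
  parts (suc j) (s≤s j≤k) = begin
    (k + 3) * x          ≡⟨ lemma k x ⟩
    -- Adding x ≤ y weakens the ratio (k + 2)/(k + 1) to (k + 3)/(k + 2), the ratio of the other
    -- summand of `Q`.
    (k + 2) * x + x      ≤⟨ ℕ.+-mono-≤ ratio (ℕ.*-cancelˡ-≤ (suc k) (ℕ.≤-trans (ℕ.*-monoˡ-≤ x (ℕ.≤-trans (ℕ.n≤1+n _) (ℕ.≤-reflexive (ℕ.+-comm 2 k)))) ratio)) ⟩
    suc k * y + y        ≡⟨ lemma′ k y ⟩
    (k + 2) * y          ∎
    where
    open ℕ.≤-Reasoning
    x = f (suc (2 * suc j + k)) j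
    y = f (suc (2 * suc j + k)) (suc j)
    ratio : (k + 2) * x ≤ suc k * y
    ratio = f-rises j k (lemma″ j k) j≤k
      where
      lemma″ : ∀ j k → 2 * suc j + k ≡ 2 * j + suc (suc k)
      lemma″ = solve-∀
    lemma : ∀ k x → (k + 3) * x ≡ (k + 2) * x + x
    lemma = solve-∀
    lemma′ : ∀ k y → suc k * y + y ≡ (k + 2) * y
    lemma′ = solve-∀

  Q-ratio : (k + 3) * Q n j ≤ (k + 2) * Q n (suc j)
  Q-ratio = begin
    (k + 3) * Q n j
      ≡⟨ cong ((k + 3) *_) (Q-≡ n j) ⟩
    (k + 3) * (x + 4 * y)
      ≡⟨ lemma (k + 3) x y ⟩
    (k + 3) * x + 4 * ((k + 3) * y)
      ≤⟨ ℕ.+-mono-≤ (subst₂ (λ p q → p * x ≤ q * x′) (lemma′ k) (ℕ.+-comm 2 k) (f-rises j (suc k) (lemma″ j k) j≤)) (ℕ.*-monoʳ-≤ 4 (parts j j≤)) ⟩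
    (k + 2) * x′ + 4 * ((k + 2) * y′)
      ≡⟨ lemma (k + 2) x′ y′ ⟨
    (k + 2) * (x′ + 4 * y′)
      ≡⟨ cong ((k + 2) *_) (Q-≡ n (suc j)) ⟨
    (k + 2) * Q n (suc j) ∎
    where
    open ℕ.≤-Reasoning
    x  = f (suc (suc (suc n))) j
    y  = shift (f n) j
    x′ = f (suc (suc (suc n))) (suc j)
    y′ = f n j
    lemma : ∀ p x y → p * (x + 4 * y) ≡ p * x + 4 * (p * y)
    lemma = solve-∀
    lemma′ : ∀ k → suc k + 2 ≡ k + 3
    lemma′ = solve-∀
    lemma″ : ∀ j k → suc (suc (suc (2 * j + k))) ≡ 2 * j + suc (suc (suc k))
    lemma″ = solve-∀

  Q-positive : 1 ≤ Q n (suc j)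
  Q-positive = ℕ.≤-trans (ℕ.≤-trans (ℕ.m^n>0 2 (suc j)) (G-positive (suc j) (suc k)))
    (ℕ.≤-trans (ℕ.≤-reflexive (sym (f-G (suc j) (suc k) (lemma j k))))
      (ℕ.≤-trans (ℕ.m≤m+n _ _) (ℕ.≤-reflexive (sym (Q-≡ n (suc j))))))
    where
    lemma : ∀ j k → suc (suc (suc (2 * j + k))) ≡ 2 * suc j + suc k
    lemma = solve-∀

  -- In units of 4^(j+1), 13 = 2 + 11 stands for twice the minor term and for the corrections 2 + 8
  -- + 1 from `top⁺`, `top⁻` and the constant; k + 3 is the denominator of the ratio. The inequality
  -- fails at k = 7, whence the bound 8.
  exponential : ∀ k → 8 ≤ k → 13 * (k + 3) < 2 ^ k
  exponential k 8≤k with o , refl ← ℕ.m≤n⇒∃[o]m+o≡n 8≤k = go o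
    where
    go : ∀ o → 13 * (8 + o + 3) < 2 ^ (8 + o)
    go zero    = ℕ.m≤n+m 144 112
    go (suc o) = begin-strict
      13 * (8 + suc o + 3)            ≡⟨ lemma o ⟩
      13 * (8 + o + 3) + 13           <⟨ ℕ.+-mono-<-≤ (go o) (ℕ.≤-trans (ℕ.m≤m+n 13 (13 * (10 + o))) (ℕ.≤-trans (ℕ.≤-reflexive (lemma′ o)) (ℕ.<⇒≤ (go o)))) ⟩
      2 ^ (8 + o) + 2 ^ (8 + o)       ≡⟨ cong (2 ^ (8 + o) +_) (ℕ.+-identityʳ _) ⟨
      2 ^ (8 + suc o)                 ∎
      where
      open ℕ.≤-Reasoning
      lemma : ∀ o → 13 * (8 + suc o + 3) ≡ 13 * (8 + o + 3) + 13
      lemma = solve-∀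
      lemma′ : ∀ o → 13 + 13 * (10 + o) ≡ 13 * (8 + o + 3)
      lemma′ = solve-∀

  dominates : 2 ^ k * Q n j + 2 * Q n (suc j) + 11 < 2 ^ k * Q n (suc j)
  dominates = ℕ.*-cancelˡ-< (k + 3) _ _ (begin-strict
    (k + 3) * (2 ^ k * Q n j + 2 * q + 11)        ≡⟨ lemma k (2 ^ k) (Q n j) q ⟩
    2 ^ k * ((k + 3) * Q n j) + (k + 3) * (2 * q + 11)
      ≤⟨ ℕ.+-mono-≤ (ℕ.*-monoʳ-≤ (2 ^ k) Q-ratio) (ℕ.*-monoʳ-≤ (k + 3) (ℕ.+-monoʳ-≤ (2 * q) (ℕ.*-monoʳ-≤ 11 Q-positive))) ⟩
    2 ^ k * ((k + 2) * q) + (k + 3) * (2 * q + 11 * q)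
      ≡⟨ cong (2 ^ k * ((k + 2) * q) +_) (lemma′ k q) ⟩
    2 ^ k * ((k + 2) * q) + 13 * (k + 3) * q
      <⟨ ℕ.+-monoʳ-< (2 ^ k * ((k + 2) * q)) (ℕ.*-monoˡ-< q {{>-nonZero Q-positive}} (exponential k 8≤k)) ⟩
    2 ^ k * ((k + 2) * q) + 2 ^ k * q             ≡⟨ lemma″ k (2 ^ k) q ⟩
    (k + 3) * (2 ^ k * q)                         ∎)
    where
    open ℕ.≤-Reasoning
    q = Q n (suc j)
    lemma : ∀ k p x q → (k + 3) * (p * x + 2 * q + 11) ≡ p * ((k + 3) * x) + (k + 3) * (2 * q + 11)
    lemma = solve-∀
    lemma′ : ∀ k q → (k + 3) * (2 * q + 11 * q) ≡ 13 * (k + 3) * q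
    lemma′ = solve-∀
    lemma″ : ∀ k p q → p * ((k + 2) * q) + p * q ≡ (k + 3) * (p * q)
    lemma″ = solve-∀

  rises : main n j + 2 * minor n (suc j) + top⁺ n (suc j) + top⁻ n (suc (suc j)) + 1 < main n (suc j)
  rises = begin-strict
    main n j + 2 * minor n (suc j) + top⁺ n (suc j) + top⁻ n (suc (suc j)) + 1
      ≤⟨ ℕ.+-mono-≤ (ℕ.+-mono-≤ (ℕ.+-mono-≤ (ℕ.+-mono-≤ (ℕ.≤-reflexive (scaled j)) (ℕ.*-monoʳ-≤ 2 (minor≤ n (suc j))))
           (top⁺≤ n (suc j))) (top⁻≤ n (suc (suc j)))) (ℕ.m^n>0 4 (suc j)) ⟩
    c * (2 ^ k * Q n j) + 2 * (c * Q n (suc j)) + 2 * c + 2 * (4 * c) + c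
      ≡⟨ lemma c (2 ^ k * Q n j) (Q n (suc j)) ⟩
    c * (2 ^ k * Q n j + 2 * Q n (suc j) + 11)
      <⟨ ℕ.*-monoʳ-< c {{>-nonZero (ℕ.m^n>0 4 (suc j))}} dominates ⟩
    c * (2 ^ k * Q n (suc j))
      ≡⟨ scaled (suc j) ⟨
    main n (suc j) ∎
    where
    open ℕ.≤-Reasoning
    c = 4 ^ suc j
    scaled : ∀ i → main n i ≡ c * (2 ^ k * Q n i)
    scaled i = trans (main-Q n i) (trans (cong (_* Q n i) (trans (cong (2 ^_) (index j k)) (2^-split (suc j) k)))
      (ℕ.*-assoc c (2 ^ k) (Q n i)))
      where
      index : ∀ j k → suc (suc (2 * j + k)) ≡ 2 * suc j + k
      index = solve-∀
    lemma : ∀ c x q → c * x + 2 * (c * q) + 2 * c + 2 * (4 * c) + c ≡ c * (x + 2 * q + 11)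
    lemma = solve-∀

-- Descent beyond the peak

far : ∀ K e c → 82 ≤ 2 * e + 3 * K → 2 * c + 3 * K ≤ 83 → c ≤ e
far K e c large c≤ with ℕ.≤-<-connex c e
... | inj₁ c≤e = c≤e
... | inj₂ e<c = contradiction (ℕ.≤-trans (ℕ.+-monoʳ-≤ 2 large)
  (ℕ.≤-trans (ℕ.≤-reflexive (lemma e K)) (ℕ.≤-trans (ℕ.+-monoˡ-≤ (3 * K) (ℕ.*-monoʳ-≤ 2 e<c)) c≤))) (ℕ.<⇒≱ ℕ.≤-refl)
  where
  lemma : ∀ e K → 2 + (2 * e + 3 * K) ≡ 2 * suc e + 3 * K
  lemma = solve-∀

-- The hypothesis is 79 ≤ n, since `Fall` has n + 3 = 2 (e + 1) + 3 (k + 2). The constant 36 is 2 ·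
-- 16 + 4: the factor 16 comes from the minor term two genera further on, and 4 together with
-- `2 * suc e` from another two copies of `Q`. The case k + 2 = 2 is the most demanding and needs e
-- + 1 ≥ 36.
exponential : ∀ k e → 82 ≤ 2 * suc e + 3 * (k + 2) → 36 * (k + 2) + 2 * suc e ≤ 2 ^ (k + 2) * suc e
exponential k e large = by-cases k (λ c → far (k + 2) (suc e) c large)
  where
  slack : ∀ K s c → 36 * K ≤ s * c → c ≤ suc e → 36 * K + 2 * suc e ≤ (s + 2) * suc e
  slack K s c K≤ c≤ = ℕ.≤-trans (ℕ.+-monoˡ-≤ (2 * suc e) (ℕ.≤-trans K≤ (ℕ.*-monoʳ-≤ s c≤)))
    (ℕ.≤-reflexive (sym (ℕ.*-distribʳ-+ (suc e) s 2)))
  grows : ∀ o → 36 * (9 + o) + 2 ≤ 2 ^ (9 + o)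
  grows zero    = ℕ.m≤n+m 326 186
  grows (suc o) = begin
    36 * (9 + suc o) + 2                          ≡⟨ lemma o ⟩
    36 * (9 + o) + 2 + 36                         ≤⟨ ℕ.+-mono-≤ (grows o) (ℕ.≤-trans (ℕ.m≤m+n 36 (36 * (8 + o) + 2)) (ℕ.≤-trans (ℕ.≤-reflexive (lemma′ o)) (grows o))) ⟩
    2 ^ (9 + o) + 2 ^ (9 + o)                     ≡⟨ cong (2 ^ (9 + o) +_) (ℕ.+-identityʳ _) ⟨
    2 ^ (9 + suc o)                               ∎
    where
    open ℕ.≤-Reasoning
    lemma : ∀ o → 36 * (9 + suc o) + 2 ≡ 36 * (9 + o) + 2 + 36
    lemma = solve-∀
    lemma′ : ∀ o → 36 + (36 * (8 + o) + 2) ≡ 36 * (9 + o) + 2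
    lemma′ = solve-∀
  by-cases : ∀ k → (∀ c → 2 * c + 3 * (k + 2) ≤ 83 → c ≤ suc e) → 36 * (k + 2) + 2 * suc e ≤ 2 ^ (k + 2) * suc e
  -- With K = k + 2, the second argument is 2^K - 2 and the third is the least c with 36 K ≤ (2^K -
  -- 2) c.
  by-cases 0 c≤ = slack 2 2   36 (ℕ.≤ᵇ⇒≤ _ _ tt) (c≤ 36 (ℕ.≤ᵇ⇒≤ _ _ tt))
  by-cases 1 c≤ = slack 3 6   18 (ℕ.≤ᵇ⇒≤ _ _ tt) (c≤ 18 (ℕ.≤ᵇ⇒≤ _ _ tt))
  by-cases 2 c≤ = slack 4 14  11 (ℕ.≤ᵇ⇒≤ _ _ tt) (c≤ 11 (ℕ.≤ᵇ⇒≤ _ _ tt))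
  by-cases 3 c≤ = slack 5 30  6  (ℕ.≤ᵇ⇒≤ _ _ tt) (c≤ 6 (ℕ.≤ᵇ⇒≤ _ _ tt))
  by-cases 4 c≤ = slack 6 62  4  (ℕ.≤ᵇ⇒≤ _ _ tt) (c≤ 4 (ℕ.≤ᵇ⇒≤ _ _ tt))
  by-cases 5 c≤ = slack 7 126 2  (ℕ.≤ᵇ⇒≤ _ _ tt) (c≤ 2 (ℕ.≤ᵇ⇒≤ _ _ tt))
  by-cases 6 c≤ = slack 8 254 2  (ℕ.≤ᵇ⇒≤ _ _ tt) (c≤ 2 (ℕ.≤ᵇ⇒≤ _ _ tt))
  by-cases (suc (suc (suc (suc (suc (suc (suc o))))))) _ = begin
    36 * K + 2 * suc e             ≤⟨ slack K (36 * K) 1 (ℕ.≤-reflexive (sym (ℕ.*-identityʳ (36 * K)))) (s≤s z≤n) ⟩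
    (36 * K + 2) * suc e           ≤⟨ ℕ.*-monoˡ-≤ (suc e) (subst (λ K → 36 * K + 2 ≤ 2 ^ K) (lemma o) (grows o)) ⟩
    2 ^ K * suc e                  ∎
    where
    open ℕ.≤-Reasoning
    K = 7 + o + 2
    lemma : ∀ o → 9 + o ≡ 7 + o + 2
    lemma = solve-∀

-- The genus is i = j + 3 with j = k + e; the number of vertices on each side is
-- n + 1 = 2 i + k, and e + 1 measures the distance from the peak.
module Fall (k e : ℕ) (large : 82 ≤ 2 * suc e + 3 * (k + 2)) where

  j n K : ℕ
  j = k + e
  n = 5 + (2 * j + k)
  K = k + 2

  Q-ratio : (suc e + 2 * K) * Q n (3 + j) ≤ 2 * K * Q n (2 + j)
  Q-ratio = begin
    (suc e + 2 * K) * Q n (3 + j)      ≡⟨ cong ((suc e + 2 * K) *_) (Q-≡ n (3 + j)) ⟩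
    (suc e + 2 * K) * (x + 4 * y)      ≡⟨ lemma (suc e + 2 * K) x y ⟩
    (suc e + 2 * K) * x + 4 * ((suc e + 2 * K) * y)
      ≤⟨ ℕ.+-mono-≤ first (ℕ.*-monoʳ-≤ 4 second) ⟩
    2 * K * x′ + 4 * (2 * K * y′)      ≡⟨ lemma (2 * K) x′ y′ ⟨
    2 * K * (x′ + 4 * y′)              ≡⟨ cong (2 * K *_) (Q-≡ n (2 + j)) ⟨
    2 * K * Q n (2 + j)                ∎
    where
    open ℕ.≤-Reasoning
    x  = f (suc (suc (suc n))) (3 + j)
    y  = f n (2 + j)
    x′ = f (suc (suc (suc n))) (2 + j)
    y′ = f n (1 + j)
    lemma : ∀ p x y → p * (x + 4 * y) ≡ p * x + 4 * (p * y)
    lemma = solve-∀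
    first : (suc e + 2 * K) * x ≤ 2 * K * x′
    first = subst₂ (λ p q → p * x ≤ 2 * q * x′) (factor k e) (ℕ.+-comm 2 k)
      (f-falls (2 + j) (suc k) (index j k) (s≤s (s≤s (ℕ.m≤m+n k e))))
      where
      factor : ∀ k e → (2 + (k + e)) + suc k + 2 ≡ suc e + 2 * (k + 2)
      factor = solve-∀
      index : ∀ j k → suc (suc (5 + (2 * j + k))) ≡ 2 * (2 + j) + suc (suc (suc k))
      index = solve-∀
    y≤y′ : y ≤ y′
    y≤y′ = f-decreasing (1 + j) (subst (4 + (2 * j + k) ≤_) (total j) (ℕ.+-monoʳ-≤ 4 (ℕ.+-monoʳ-≤ (2 * j) (ℕ.m≤m+n k e))))
      where
      total : ∀ j → 4 + (2 * j + j) ≡ suc (3 * (1 + j))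
      total = solve-∀
    -- This summand has the ratio 2 (k + 1)/(j + k + 3); adding 2 to numerator and denominator,
    -- which y ≤ y′ permits, gives the ratio of the first summand.
    second : (suc e + 2 * K) * y ≤ 2 * K * y′
    second = begin
      (suc e + 2 * K) * y                  ≡⟨ split′ k e y ⟩
      (1 + j + k + 2) * y + 2 * y          ≤⟨ ℕ.+-mono-≤ (f-falls (1 + j) k (index j k) (s≤s (ℕ.m≤m+n k e))) (ℕ.*-monoʳ-≤ 2 y≤y′) ⟩
      2 * suc k * y′ + 2 * y′              ≡⟨ join k y′ ⟩
      2 * K * y′                           ∎
      where
      split′ : ∀ k e y → (suc e + 2 * (k + 2)) * y ≡ (1 + (k + e) + k + 2) * y + 2 * y
      split′ = solve-∀
      index : ∀ j k → 4 + (2 * j + k) ≡ 2 * (1 + j) + suc (suc k)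
      index = solve-∀
      join : ∀ k y → 2 * suc k * y + 2 * y ≡ 2 * (k + 2) * y
      join = solve-∀

  Q-decreasing : Q n (4 + j) ≤ Q n (3 + j)
  Q-decreasing = subst₂ _≤_ (sym (Q-≡ n (4 + j))) (sym (Q-≡ n (3 + j)))
    (ℕ.+-mono-≤ (f-decreasing (3 + j) (bound 7 10 (s≤s (s≤s (s≤s (s≤s (s≤s (s≤s (s≤s z≤n))))))) (total j)))
      (ℕ.*-monoʳ-≤ 4 (f-decreasing (2 + j) (bound 4 7 (s≤s (s≤s (s≤s (s≤s z≤n)))) (total′ j)))))
    where
    bound : ∀ a b {c} → a ≤ b → b + (2 * j + j) ≡ c → a + (2 * j + k) ≤ c
    bound a b a≤b refl = ℕ.+-mono-≤ a≤b (ℕ.+-monoʳ-≤ (2 * j) (ℕ.m≤m+n k e))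
    total : ∀ j → 10 + (2 * j + j) ≡ suc (3 * (3 + j))
    total = solve-∀
    total′ : ∀ j → 7 + (2 * j + j) ≡ suc (3 * (2 + j))
    total′ = solve-∀

  -- In units of 4^(2+j) the corrections `top⁺ n (4 + j)` and `top⁻ n (3 + j)` are at most 32 and 8.
  -- One more copy of `Q` absorbs them.
  Q-large : 40 < Q n (2 + j)
  Q-large = begin-strict
    40                                      <⟨ ℕ.m≤n+m 41 23 ⟩
    2 ^ 6                                   ≤⟨ ℕ.^-monoʳ-≤ 2 (ℕ.+-monoʳ-≤ 2 4≤j) ⟩
    2 ^ (2 + j)                             ≤⟨ G-positive (2 + j) (3 + k) ⟩
    G (2 + j) (3 + k)                       ≡⟨ f-G (2 + j) (3 + k) (index j k) ⟨
    f (suc (suc (suc n))) (2 + j)           ≤⟨ ℕ.m≤m+n _ _ ⟩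
    f (suc (suc (suc n))) (2 + j) + 4 * f n (1 + j) ≡⟨ Q-≡ n (2 + j) ⟨
    Q n (2 + j)                             ∎
    where
    open ℕ.≤-Reasoning
    index : ∀ j k → suc (suc (5 + (2 * j + k))) ≡ 2 * (2 + j) + (3 + k)
    index = solve-∀
    bound : ∀ k e → 2 * suc e + 3 * (k + 2) + e ≡ 8 + 3 * (k + e)
    bound = solve-∀
    4≤j : 4 ≤ j
    4≤j with ℕ.≤-<-connex 4 j
    ... | inj₁ le = le
    ... | inj₂ (s≤s j≤3) = contradiction
      (ℕ.≤-trans large (ℕ.≤-trans (ℕ.m≤m+n _ e) (ℕ.≤-trans (ℕ.≤-reflexive (bound k e)) (ℕ.+-monoʳ-≤ 8 (ℕ.*-monoʳ-≤ 3 j≤3)))))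
      (ℕ.<⇒≱ (ℕ.m≤n+m 18 64))

  dominates : 2 ^ K * Q n (3 + j) + 16 * Q n (4 + j) + Q n (2 + j) + 40 < 2 ^ K * Q n (2 + j)
  dominates = ℕ.*-cancelˡ-< p _ _ (begin-strict
    p * (P * q₃ + 16 * q₄ + q₂ + 40)
      ≡⟨ expand p P q₃ q₄ q₂ ⟩
    P * (p * q₃) + 16 * (p * q₄) + p * (q₂ + 40)
      ≤⟨ ℕ.+-monoˡ-≤ (p * (q₂ + 40)) (ℕ.+-mono-≤ (ℕ.*-monoʳ-≤ P Q-ratio) (ℕ.*-monoʳ-≤ 16 (ℕ.≤-trans (ℕ.*-monoʳ-≤ p Q-decreasing) Q-ratio))) ⟩
    P * (2 * K * q₂) + 16 * (2 * K * q₂) + p * (q₂ + 40)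
      <⟨ ℕ.+-monoʳ-< (P * (2 * K * q₂) + 16 * (2 * K * q₂)) (ℕ.*-monoʳ-< p (ℕ.+-monoʳ-< q₂ Q-large)) ⟩
    P * (2 * K * q₂) + 16 * (2 * K * q₂) + p * (q₂ + q₂)
      ≡⟨ collect P K (suc e) q₂ ⟩
    (P * (2 * K) + (36 * K + 2 * suc e)) * q₂
      ≤⟨ ℕ.*-monoˡ-≤ q₂ (ℕ.+-monoʳ-≤ (P * (2 * K)) (exponential k e large)) ⟩
    (P * (2 * K) + P * suc e) * q₂
      ≡⟨ regroup P K (suc e) q₂ ⟩
    p * (P * q₂) ∎)
    where
    open ℕ.≤-Reasoning
    p  = suc e + 2 * K
    P  = 2 ^ K
    q₂ = Q n (2 + j)
    q₃ = Q n (3 + j)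
    q₄ = Q n (4 + j)
    expand : ∀ p P x y z → p * (P * x + 16 * y + z + 40) ≡ P * (p * x) + 16 * (p * y) + p * (z + 40)
    expand = solve-∀
    collect : ∀ P K e q → P * (2 * K * q) + 16 * (2 * K * q) + (e + 2 * K) * (q + q) ≡ (P * (2 * K) + (36 * K + 2 * e)) * q
    collect = solve-∀
    regroup : ∀ P K e q → (P * (2 * K) + P * e) * q ≡ (e + 2 * K) * (P * q)
    regroup = solve-∀

  falls : main n (3 + j) + minor n (4 + j) + minor n (2 + j) + top⁺ n (4 + j) + top⁻ n (3 + j) < main n (2 + j)
  falls = begin-strict
    main n (3 + j) + minor n (4 + j) + minor n (2 + j) + top⁺ n (4 + j) + top⁻ n (3 + j)
      ≤⟨ ℕ.+-mono-≤ (ℕ.+-mono-≤ (ℕ.+-mono-≤ (ℕ.+-mono-≤ (ℕ.≤-reflexive (scaled (3 + j))) (minor≤ n (4 + j)))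
           (minor≤ n (2 + j))) (top⁺≤ n (4 + j))) (top⁻≤ n (3 + j)) ⟩
    c * (2 ^ K * Q n (3 + j)) + 4 * (4 * c) * Q n (4 + j) + c * Q n (2 + j) + 2 * (4 * (4 * c)) + 2 * (4 * c)
      ≡⟨ lemma c (2 ^ K * Q n (3 + j)) (Q n (4 + j)) (Q n (2 + j)) ⟩
    c * (2 ^ K * Q n (3 + j) + 16 * Q n (4 + j) + Q n (2 + j) + 40)
      <⟨ ℕ.*-monoʳ-< c {{>-nonZero (ℕ.m^n>0 4 (2 + j))}} dominates ⟩
    c * (2 ^ K * Q n (2 + j))
      ≡⟨ scaled (2 + j) ⟨
    main n (2 + j) ∎
    where
    open ℕ.≤-Reasoning
    c = 4 ^ (2 + j)
    scaled : ∀ i → main n i ≡ c * (2 ^ K * Q n i)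
    scaled i = trans (main-Q n i) (trans (cong (_* Q n i) (trans (cong (2 ^_) (index j k)) (2^-split (2 + j) K)))
      (ℕ.*-assoc c (2 ^ K) (Q n i)))
      where
      index : ∀ j k → 6 + (2 * j + k) ≡ 2 * (2 + j) + (k + 2)
      index = solve-∀
    lemma : ∀ c x y z → c * x + 4 * (4 * c) * y + c * z + 2 * (4 * (4 * c)) + 2 * (4 * c) ≡ c * (x + 16 * y + z + 40)
    lemma = solve-∀

-- Peaks

maxGenus : ℕ → ℕ
maxGenus n = (n + 3) / 2

-- Every embedding has a face, so Euler's formula bounds the genus; `faces` reduces to a successor
-- because `darts` has a first element.
embeddingCount-vanishes : ∀ n i → maxGenus n < i → embeddingCount (cross (suc n)) i ≡ 0
embeddingCount-vanishes n i M<i = cong length (List.filter-none (λ ρ → hasGenus? ρ i)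
  (All.universal (λ ρ genus → ℕ.<⇒≱ M<i (bound ρ genus)) rotationSystems))
  where
  open Multigraph (cross (suc n)) using (order; size)
  open Embeddings (cross (suc n)) using (faces; HasGenus; hasGenus?; rotationSystems; RotationSystem)
  euler : ∀ n φ i → suc (suc n + suc (suc n)) + suc φ + 2 * i ≡ suc (suc n + suc (suc n)) + suc (i * 2 + φ)
  euler = solve-∀
  sizes : ∀ n → (suc n + suc (suc n)) + (suc n + 2) + 2 ≡ suc (suc n + suc (suc n)) + suc (n + 3)
  sizes = solve-∀
  bound : ∀ ρ → HasGenus ρ i → i ≤ maxGenus n
  bound ρ genus = subst (_≤ maxGenus n) (m*n/n≡m i 2) (/-monoˡ-≤ 2 (go (faces ρ) (s≤s z≤n) genus))
    where
    go : ∀ φ → 0 < φ → order + φ + 2 * i ≡ size + 2 → i * 2 ≤ n + 3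
    go (suc φ) _ eq = ℕ.≤-trans (ℕ.m≤m+n (i * 2) φ) (ℕ.≤-reflexive (ℕ.suc-injective
      (ℕ.+-cancelˡ-≡ order (suc (i * 2 + φ)) (suc (n + 3)) (trans (sym (euler n φ i)) (trans eq (sizes n))))))

module Comparison {R X Y : ℕ → ℕ} (closed : ∀ i → R i + 2 * X i ≡ 2 * Y i) where

  compare : ∀ {i j} → Y i + X j < Y j + X i → R i < R j
  compare {i} {j} lt = ℕ.+-cancelʳ-< (2 * X i + 2 * X j) (R i) (R j) (begin-strict
    R i + (2 * X i + 2 * X j)     ≡⟨ ℕ.+-assoc (R i) (2 * X i) (2 * X j) ⟨
    R i + 2 * X i + 2 * X j       ≡⟨ cong (_+ 2 * X j) (closed i) ⟩
    2 * Y i + 2 * X j             ≡⟨ ℕ.*-distribˡ-+ 2 (Y i) (X j) ⟨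
    2 * (Y i + X j)               <⟨ ℕ.*-monoʳ-< 2 lt ⟩
    2 * (Y j + X i)               ≡⟨ ℕ.*-distribˡ-+ 2 (Y j) (X i) ⟩
    2 * Y j + 2 * X i             ≡⟨ cong (_+ 2 * X i) (closed j) ⟨
    R j + 2 * X j + 2 * X i       ≡⟨ swap (R j) (2 * X j) (2 * X i) ⟩
    R j + (2 * X i + 2 * X j)     ∎)
    where
    open ℕ.≤-Reasoning
    swap : ∀ a b c → a + b + c ≡ a + (c + b)
    swap = solve-∀

  positive : ∀ {i} → X i < Y i → 0 < R i
  positive {i} lt = ℕ.+-cancelʳ-< (2 * X i) 0 (R i)
    (ℕ.<-≤-trans (ℕ.*-monoʳ-< 2 lt) (ℕ.≤-reflexive (sym (closed i))))

  null : ∀ {i} → X i ≡ Y i → R i ≡ 0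
  null {i} eq = ℕ.+-cancelʳ-≡ (2 * X i) (R i) 0 (trans (closed i) (cong (2 *_) (sym eq)))

-- X and Y are the two sides of a closed form R + 2 X = 2 Y. Each comparison of values of R is
-- stated with terms moved across, and all are strict, which makes the peak unique.
record Peaked (X Y : ℕ → ℕ) (γ M p : ℕ) : Set where
  field
    γ≤p     : γ ≤ p
    p≤M     : p ≤ M
    bottom  : X γ < Y γ
    top     : X M < Y M
    below   : ∀ i → i < γ → X i ≡ Y i
    ascent  : ∀ i → γ ≤ i → i < M → i < p → Y i + X (suc i) < Y (suc i) + X i
    descent : ∀ i → γ ≤ i → i < M → p ≤ i → Y (suc i) + X i < Y i + X (suc i)

Theorem : ℕ → Set
Theorem n = ∃₂ λ γ γM →
  IsMinimumGenus (cross n) γ × IsMaximumGenus (cross n) γM ×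
  Unimodal γ γM (embeddingCount (cross n)) × IsPeak γ γM (embeddingCount (cross n)) (crossPeak n)

conclude : ∀ n {X Y γ} → (∀ i → embeddingCount (cross (suc n)) i + 2 * X i ≡ 2 * Y i) →
  Peaked X Y γ (maxGenus n) (crossPeak (suc n)) → Theorem (suc n)
conclude n {X} {Y} {γ} closed peaked = γ , maxGenus n
  , (positive bottom , λ i i<γ → null (below i i<γ))
  , (positive top , embeddingCount-vanishes n)
  , (crossPeak (suc n) , crossPeak (suc n) , unimodal)
  , unimodal
  where
  open Peaked peaked
  open Comparison {embeddingCount (cross (suc n))} {X} {Y} closed
  unimodal : IsPeak γ (maxGenus n) (embeddingCount (cross (suc n))) (crossPeak (suc n))
  unimodal = record
    { q≤l     = γ≤p
    ; l≤m     = ℕ.≤-refl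
    ; m≤n     = p≤M
    ; rising  = λ i γ≤i 1+i<p → ℕ.<⇒≤ (compare (ascent i γ≤i (ℕ.<-≤-trans (ℕ.<⇒≤ 1+i<p) p≤M) (ℕ.<⇒≤ 1+i<p)))
    ; rise    = λ i γ≤i 1+i≡p → subst (λ p → embeddingCount (cross (suc n)) i < embeddingCount (cross (suc n)) p) 1+i≡p
        (compare (ascent i γ≤i (ℕ.≤-trans (ℕ.≤-reflexive 1+i≡p) p≤M) (ℕ.≤-reflexive 1+i≡p)))
    ; plateau = λ i p≤i i≤p → cong (embeddingCount (cross (suc n))) (ℕ.≤-antisym i≤p p≤i)
    ; fall    = λ p<M → compare (descent _ γ≤p p<M ℕ.≤-refl)
    ; falling = λ i p<i i<M → ℕ.<⇒≤ (compare (descent i (ℕ.≤-trans γ≤p (ℕ.<⇒≤ p<i)) i<M (ℕ.<⇒≤ p<i)))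
    }

-- Evaluation of the closed form

coefficient : List ℕ → ℕ → ℕ
coefficient []       i       = 0
coefficient (x ∷ xs) zero    = x
coefficient (x ∷ xs) (suc i) = coefficient xs i

addTwice : List ℕ → List ℕ → List ℕ
addTwice xs       []       = xs
addTwice []       (y ∷ ys) = 2 * y ∷ addTwice [] ys
addTwice (x ∷ xs) (y ∷ ys) = x + 2 * y ∷ addTwice xs ys

advanceFib : List ℕ × List ℕ → List ℕ × List ℕ
advanceFib (p , q) = q , addTwice q (0 ∷ p)

-- The recursion of `fib` branches at every step. Keeping two adjacent rows as lists makes the
-- evaluation linear in the number of rows.
fibs : ℕ → List ℕ × List ℕ
fibs zero    = [] , 1 ∷ []
fibs (suc n) = advanceFib (fibs n)

coefficient-addTwice : ∀ xs ys i → coefficient (addTwice xs ys) i ≡ coefficient xs i + 2 * coefficient ys i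
coefficient-addTwice xs       []       i       = sym (ℕ.+-identityʳ _)
coefficient-addTwice []       (y ∷ ys) zero    = refl
coefficient-addTwice []       (y ∷ ys) (suc i) = coefficient-addTwice [] ys i
coefficient-addTwice (x ∷ xs) (y ∷ ys) zero    = refl
coefficient-addTwice (x ∷ xs) (y ∷ ys) (suc i) = coefficient-addTwice xs ys i

fibs-f : ∀ n → coefficient (proj₁ (fibs n)) ≗ f n × coefficient (proj₂ (fibs n)) ≗ f (suc n)
fibs-f zero    = (λ _ → refl) , λ { zero → refl ; (suc i) → refl }
fibs-f (suc n) with fibs n | fibs-f n
... | p , q | p≗ , q≗ = q≗ , λ i → trans (coefficient-addTwice q (0 ∷ p) i)
  (cong₂ _+_ (trans (q≗ i) (sym (ℕ.+-identityʳ _))) (cong (2 *_) (shifted i)))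
  where
  shifted : ∀ i → coefficient (0 ∷ p) i ≡ shift (f n) i
  shifted zero    = refl
  shifted (suc i) = p≗ i

quickMain quickMinor : ℕ → List ℕ × List ℕ → ℕ → ℕ
quickMain  n (p , q) i = 2 ^ suc n * (coefficient q i + 2 * coefficient (0 ∷ q) i + 6 * coefficient (0 ∷ p) i)
quickMinor n (p , q) i = 4 ^ i * (coefficient q i + coefficient (0 ∷ q) i + 5 * coefficient (0 ∷ p) i)

module _ (n : ℕ) where

  private
    shifted : ∀ xs {a : ℕ → ℕ} → coefficient xs ≗ a → coefficient (0 ∷ xs) ≗ shift a
    shifted xs eq zero    = refl
    shifted xs eq (suc i) = eq i
    p = proj₁ (fibs n)
    q = proj₂ (fibs n)

  quickMain-≡ : ∀ i → quickMain n (fibs n) i ≡ main n i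
  quickMain-≡ i = trans (cong (2 ^ suc n *_) (cong₂ _+_
      (cong₂ (λ x y → x + 2 * y) (proj₂ (fibs-f n) i) (shifted q (proj₂ (fibs-f n)) i))
      (cong (6 *_) (shifted p (proj₁ (fibs-f n)) i))))
    (sym (main-Q n i))

  quickMinor-≡ : ∀ i → quickMinor n (fibs n) i ≡ minor n i
  quickMinor-≡ i = trans (cong (4 ^ i *_) (cong₂ _+_
      (cong₂ _+_ (proj₂ (fibs-f n) i) (shifted q (proj₂ (fibs-f n)) i))
      (cong (5 *_) (shifted p (proj₁ (fibs-f n)) i))))
    (sym (minor-H n i))

lowerQ upperQ : ℕ → List ℕ × List ℕ → ℕ → ℕ
lowerQ n pq i = shift (quickMinor n pq) i + top⁻ n i + one i
upperQ n pq i = shift (quickMain n pq) i + quickMinor n pq i + top⁺ n i + shift one i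

quick-closed : ∀ n i → embeddingCount (cross (suc n)) i + 2 * lowerQ n (fibs n) i ≡ 2 * upperQ n (fibs n) i
quick-closed n i = trans
  (cong (λ x → embeddingCount (cross (suc n)) i + 2 * (x + top⁻ n i + one i)) (shift-cong (quickMinor-≡ n) i))
  (trans (closed-form n i) (cong (λ x → 2 * (x + top⁺ n i + shift one i))
    (sym (cong₂ _+_ (shift-cong (quickMain-≡ n) i) (quickMinor-≡ n i)))))

allBelow : ℕ → (ℕ → Bool) → Bool
allBelow zero    c = true
allBelow (suc m) c = c m ∧ allBelow m c

allBelow-sound : ∀ m c → T (allBelow m c) → ∀ i → i < m → T (c i)
allBelow-sound (suc m) c t i i<1+m with ℕ.m≤n⇒m<n∨m≡n (ℕ.≤-pred i<1+m)
... | inj₁ i<m  = allBelow-sound m c (proj₂ (T-∧⁻ {c m} t)) i i<m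
... | inj₂ refl = proj₁ (T-∧⁻ {c m} t)

monotoneAt : (X Y : ℕ → ℕ) (γ p i : ℕ) → Bool
monotoneAt X Y γ p i = (i <ᵇ γ) ∨
  (if i <ᵇ p then (Y i + X (suc i)) <ᵇ (Y (suc i) + X i) else (Y (suc i) + X i) <ᵇ (Y i + X (suc i)))

isPeaked : (X Y : ℕ → ℕ) (γ M p : ℕ) → Bool
isPeaked X Y γ M p = (γ ≤ᵇ p) ∧ (p ≤ᵇ M) ∧ (X γ <ᵇ Y γ) ∧ (X M <ᵇ Y M) ∧
  allBelow γ (λ i → X i ≡ᵇ Y i) ∧ allBelow M (monotoneAt X Y γ p)

isPeaked-sound : ∀ X Y γ M p → T (isPeaked X Y γ M p) → Peaked X Y γ M p
isPeaked-sound X Y γ M p t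
  with t₁ , t ← T-∧⁻ {γ ≤ᵇ p} t with t₂ , t ← T-∧⁻ {p ≤ᵇ M} t with t₃ , t ← T-∧⁻ {X γ <ᵇ Y γ} t
  with t₄ , t ← T-∧⁻ {X M <ᵇ Y M} t with t₅ , t₆ ← T-∧⁻ {allBelow γ (λ i → X i ≡ᵇ Y i)} t = record
  { γ≤p     = ℕ.≤ᵇ⇒≤ γ p t₁
  ; p≤M     = ℕ.≤ᵇ⇒≤ p M t₂
  ; bottom  = ℕ.<ᵇ⇒< (X γ) (Y γ) t₃
  ; top     = ℕ.<ᵇ⇒< (X M) (Y M) t₄
  ; below   = λ i i<γ → ℕ.≡ᵇ⇒≡ (X i) (Y i) (allBelow-sound γ _ t₅ i i<γ)
  ; ascent  = λ i γ≤i i<M i<p → ℕ.<ᵇ⇒< _ _ (branch-true (i <ᵇ γ) (i <ᵇ p) (ℕ.≤⇒≯ γ≤i ∘ ℕ.<ᵇ⇒< i γ) (ℕ.<⇒<ᵇ i<p) (allBelow-sound M _ t₆ i i<M))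
  ; descent = λ i γ≤i i<M p≤i → ℕ.<ᵇ⇒< _ _ (branch-false (i <ᵇ γ) (i <ᵇ p) (ℕ.≤⇒≯ γ≤i ∘ ℕ.<ᵇ⇒< i γ) (ℕ.≤⇒≯ p≤i ∘ ℕ.<ᵇ⇒< i p) (allBelow-sound M _ t₆ i i<M))
  }
  where
  branch-true : ∀ a b {c d} → ¬ T a → T b → T (a ∨ (if b then c else d)) → T c
  branch-true false true  _  _ t = t
  branch-true true  _     ¬a _ _ = contradiction tt ¬a
  branch-false : ∀ a b {c d} → ¬ T a → ¬ T b → T (a ∨ (if b then c else d)) → T d
  branch-false false false _  _  t = t
  branch-false false true  _  ¬b _ = contradiction tt ¬b
  branch-false true  _     ¬a _  _ = contradiction tt ¬a

-- Of the crosses R_{n+1} only R₁ and R₂ are planar.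
minGenus : ℕ → ℕ
minGenus n = if n ≤ᵇ 1 then 0 else 1

smallPeaked : ℕ → Bool
smallPeaked n = isPeaked (lowerQ n (fibs n)) (upperQ n (fibs n)) (minGenus n) (maxGenus n) (crossPeak (suc n))

small : ∀ n → n < 79 → Theorem (suc n)
small n n<79 = conclude n (quick-closed n)
  (isPeaked-sound (lowerQ n (fibs n)) (upperQ n (fibs n)) (minGenus n) (maxGenus n) (crossPeak (suc n))
    (allBelow-sound 79 smallPeaked tt n n<79))

-- The peak for large n

g-constant : ∀ n → g (suc n) 0 ≡ 1
g-constant zero    = refl
g-constant (suc n) = cong (λ x → 1 * x + 0) (g-constant n)

top-vanishes : ∀ n → 4 ≤ n → top⁺ n 0 ≡ 0 × top⁻ n 0 ≡ 0 × top⁻ n 1 ≡ 0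
top-vanishes (suc (suc (suc (suc n)))) _ = refl , refl , refl
top-vanishes 1 (s≤s ())
top-vanishes 2 (s≤s (s≤s ()))
top-vanishes 3 (s≤s (s≤s (s≤s ())))

crossPeak-large : ∀ n → 7 < n → crossPeak n ≡ (n + 2) / 3 + 1
crossPeak-large n 7<n = branches (n ≤ᵇ 6) (n ≡ᵇ 7)
  (λ t → ℕ.<⇒≱ 7<n (ℕ.≤-trans (ℕ.≤ᵇ⇒≤ n 6 t) (ℕ.n≤1+n 6))) (λ t → ℕ.<⇒≢ 7<n (sym (ℕ.≡ᵇ⇒≡ n 7 t)))
  where
  branches : ∀ a b {x y z : ℕ} → ¬ T a → ¬ T b → (if a then x else if b then y else z) ≡ z
  branches false false _  _  = refl
  branches false true  _  ¬b = contradiction tt ¬b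
  branches true  _     ¬a _  = contradiction tt ¬a

module Large (n : ℕ) (79≤n : 79 ≤ n) where

  X Y : ℕ → ℕ
  X i = shift (minor n) i + top⁻ n i + one i
  Y i = shift (main n) i + minor n i + top⁺ n i + shift one i

  peak : ℕ
  peak = (suc n + 2) / 3 + 1

  third : suc n + 2 ≡ n + 3
  third = sym (ℕ.+-suc n 2)

  third≤ : (suc n + 2) / 3 * 3 ≤ n + 3
  third≤ = ℕ.≤-trans (m/n*n≤m (suc n + 2) 3) (ℕ.≤-reflexive third)

  -- `peak` is the least i with n + 3 < 3 i; this and `above-peak` translate between the quotient
  -- and the condition of the ratio estimates.
  below-peak : ∀ {i} → i < peak → i * 3 ≤ n + 3
  below-peak {i} i<p = ℕ.≤-trans (ℕ.*-monoˡ-≤ 3 (ℕ.≤-pred (subst (i <_) (ℕ.+-comm ((suc n + 2) / 3) 1) i<p))) third≤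

  above-peak : ∀ {i} → peak ≤ i → n + 3 < i * 3
  above-peak {i} p≤i = ℕ.≰⇒> λ i*3≤ → ℕ.<⇒≱ (subst (_≤ i) (ℕ.+-comm ((suc n + 2) / 3) 1) p≤i)
    (subst (_≤ (suc n + 2) / 3) (m*n/n≡m i 3) (/-monoˡ-≤ 3 (ℕ.≤-trans i*3≤ (ℕ.≤-reflexive (sym third)))))

  -- Ensures that k = n + 1 - 2 i exists as a natural number, the exponent by which the main term
  -- outweighs the minor one.
  below-max : ∀ {i} → i < maxGenus n → 2 * i ≤ suc n
  below-max {i} i<M = ℕ.+-cancelˡ-≤ 2 (2 * i) (suc n) (subst₂ _≤_ (double i) (shifted n)
    (ℕ.≤-trans (ℕ.*-monoˡ-≤ 2 i<M) (m/n*n≤m (n + 3) 2)))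
    where
    double : ∀ i → suc i * 2 ≡ 2 + 2 * i
    double = solve-∀
    shifted : ∀ n → n + 3 ≡ 2 + suc n
    shifted = solve-∀

  peak≤max : peak ≤ maxGenus n
  peak≤max = subst (_≤ maxGenus n) (m*n/n≡m peak 2) (/-monoˡ-≤ {peak * 2} {n + 3} 2 (ℕ.*-cancelˡ-≤ 3 (begin
    3 * (peak * 2)                          ≡⟨ lemma ((suc n + 2) / 3) ⟩
    2 * ((suc n + 2) / 3 * 3) + 6           ≤⟨ ℕ.+-mono-≤ (ℕ.*-monoʳ-≤ 2 third≤) (ℕ.≤-trans (ℕ.≤-trans (ℕ.m≤n+m 6 73) 79≤n) (ℕ.m≤m+n n 3)) ⟩
    2 * (n + 3) + (n + 3)                   ≡⟨ lemma′ (n + 3) ⟩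
    3 * (n + 3)                             ∎)))
    where
    open ℕ.≤-Reasoning
    lemma : ∀ q → 3 * ((q + 1) * 2) ≡ 2 * (q * 3) + 6
    lemma = solve-∀
    lemma′ : ∀ m → 2 * m + m ≡ 3 * m
    lemma′ = solve-∀

  minor-zero : minor n 0 ≡ 1
  minor-zero = cong (λ x → x + 0 + 0) (g-constant n)

  ascent : ∀ i → 1 ≤ i → i < maxGenus n → i < peak → Y i + X (suc i) < Y (suc i) + X i
  ascent (suc j) _ i<M i<p with k , eq ← ℕ.m≤n⇒∃[o]m+o≡n (below-max {suc j} i<M) = from-rise k (ℕ.suc-injective (trans (sym eq) (lemma j k)))
    where
    lemma : ∀ j k → 2 * suc j + k ≡ suc (suc (2 * j + k))
    lemma = solve-∀
    from-rise : ∀ k → n ≡ suc (2 * j + k) → Y (suc j) + X (suc (suc j)) < Y (suc (suc j)) + X (suc j)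
    from-rise k n≡ = ℕ.<-≤-trans (ℕ.≤-<-trans total (subst Rising (sym n≡) (Rise.rises j k j≤1+k 8≤k)))
      (ℕ.≤-trans (ℕ.m≤m+n _ _) (ℕ.≤-trans (ℕ.m≤m+n _ _) (ℕ.≤-trans (ℕ.m≤m+n _ _) (ℕ.m≤m+n _ _))))
      where
      Rising : ℕ → Set
      Rising n = main n j + 2 * minor n (suc j) + top⁺ n (suc j) + top⁻ n (suc (suc j)) + 1 < main n (suc j)
      one≤1 : ∀ j → one j ≤ 1
      one≤1 zero    = ℕ.≤-refl
      one≤1 (suc j) = z≤n
      total : Y (suc j) + X (suc (suc j)) ≤ main n j + 2 * minor n (suc j) + top⁺ n (suc j) + top⁻ n (suc (suc j)) + 1
      total = ℕ.≤-trans (ℕ.≤-reflexive (regroup (main n j) (minor n (suc j)) (top⁺ n (suc j)) (top⁻ n (suc (suc j))) (one j)))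
        (ℕ.+-monoʳ-≤ (main n j + 2 * minor n (suc j) + top⁺ n (suc j) + top⁻ n (suc (suc j))) (one≤1 j))
        where
        regroup : ∀ a b t t′ e → (a + b + t + e) + (b + t′ + 0) ≡ a + 2 * b + t + t′ + e
        regroup = solve-∀
      bound : suc j * 3 ≤ suc (2 * j + k) + 3
      bound = subst (λ n → suc j * 3 ≤ n + 3) n≡ (below-peak i<p)
      j≤1+k : j ≤ suc k
      j≤1+k = ℕ.+-cancelˡ-≤ (2 * j + 3) j (suc k) (subst₂ _≤_ (left′ j) (right′ j k) bound)
        where
        left′ : ∀ j → suc j * 3 ≡ 2 * j + 3 + j
        left′ = solve-∀
        right′ : ∀ j k → suc (2 * j + k) + 3 ≡ 2 * j + 3 + suc k
        right′ = solve-∀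
      8≤k : 8 ≤ k
      8≤k with ℕ.≤-<-connex 8 k
      ... | inj₁ le = le
      ... | inj₂ (s≤s k≤7) = contradiction
        (ℕ.≤-trans (ℕ.≤-trans 79≤n (ℕ.≤-reflexive n≡))
          (s≤s (ℕ.+-mono-≤ (ℕ.*-monoʳ-≤ 2 (ℕ.≤-trans j≤1+k (s≤s k≤7))) k≤7)))
        (ℕ.<⇒≱ (ℕ.m≤n+m 25 54))

  beyond : ∀ {i} k → peak ≤ i → 2 * i + k ≡ suc n → 3 + k ≤ i
  beyond {i} k p≤i eq = ℕ.+-cancelˡ-≤ (2 * i) (3 + k) i (subst₂ _≤_ left′ (right′ i) (above-peak p≤i))
    where
    left′ : suc (n + 3) ≡ 2 * i + (3 + k)
    left′ = trans (cong (_+ 3) (sym eq)) (lemma i k)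
      where
      lemma : ∀ i k → 2 * i + k + 3 ≡ 2 * i + (3 + k)
      lemma = solve-∀
    right′ : ∀ i → i * 3 ≡ 2 * i + i
    right′ = solve-∀

  from-fall : ∀ {i} k e → i ≡ 3 + (k + e) → 2 * i + k ≡ suc n → Y (suc i) + X i < Y i + X (suc i)
  from-fall k e refl eq = ℕ.<-≤-trans (ℕ.≤-<-trans (ℕ.≤-reflexive total) (subst Falling (sym n≡) (Fall.falls k e large)))
    (ℕ.≤-trans (ℕ.m≤m+n _ _) (ℕ.≤-trans (ℕ.m≤m+n _ _) (ℕ.≤-trans (ℕ.m≤m+n _ _) (ℕ.m≤m+n _ _))))
    where
    j = k + e
    Falling : ℕ → Set
    Falling n = main n (3 + j) + minor n (4 + j) + minor n (2 + j) + top⁺ n (4 + j) + top⁻ n (3 + j) < main n (2 + j)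
    n≡ : n ≡ 5 + (2 * j + k)
    n≡ = ℕ.suc-injective (trans (sym eq) (lemma j k))
      where
      lemma : ∀ j k → 2 * (3 + j) + k ≡ suc (5 + (2 * j + k))
      lemma = solve-∀
    large : 82 ≤ 2 * suc e + 3 * (k + 2)
    large = ℕ.≤-trans (ℕ.+-monoʳ-≤ 3 79≤n) (ℕ.≤-reflexive (trans (cong (3 +_) n≡) (lemma k e)))
      where
      lemma : ∀ k e → 3 + (5 + (2 * (k + e) + k)) ≡ 2 * suc e + 3 * (k + 2)
      lemma = solve-∀
    total : Y (4 + j) + X (3 + j) ≡
      main n (3 + j) + minor n (4 + j) + minor n (2 + j) + top⁺ n (4 + j) + top⁻ n (3 + j)
    total = regroup (main n (3 + j)) (minor n (4 + j)) (top⁺ n (4 + j)) (minor n (2 + j)) (top⁻ n (3 + j))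
      where
      regroup : ∀ a b t c t′ → (a + b + t + 0) + (c + t′ + 0) ≡ a + b + c + t + t′
      regroup = solve-∀

  descent : ∀ i → 1 ≤ i → i < maxGenus n → peak ≤ i → Y (suc i) + X i < Y i + X (suc i)
  descent i _ i<M p≤i with k , eq ← ℕ.m≤n⇒∃[o]m+o≡n (below-max {i} i<M)
    with e , eq′ ← ℕ.m≤n⇒∃[o]m+o≡n (beyond k p≤i eq) = from-fall k e (trans (sym eq′) (ℕ.+-assoc 3 k e)) eq

  vanishing : top⁺ n 0 ≡ 0 × top⁻ n 0 ≡ 0 × top⁻ n 1 ≡ 0
  vanishing = top-vanishes n (ℕ.≤-trans (ℕ.m≤n+m 4 75) 79≤n)

  bottom : X 1 < Y 1
  bottom = begin-strict
    minor n 0 + top⁻ n 1 + 0                        ≡⟨ cong (λ t → minor n 0 + t + 0) (proj₂ (proj₂ vanishing)) ⟩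
    minor n 0 + 0 + 0                               ≡⟨ trans (ℕ.+-identityʳ _) (ℕ.+-identityʳ _) ⟩
    minor n 0                                       ≤⟨ minor≤ n 0 ⟩
    1 * Q n 0                                       ≤⟨ ℕ.*-monoˡ-≤ (Q n 0) (ℕ.m^n>0 2 (suc n)) ⟩
    2 ^ suc n * Q n 0                               ≡⟨ main-Q n 0 ⟨
    main n 0                                        ≤⟨ ℕ.≤-trans (ℕ.m≤m+n (main n 0) (minor n 1)) (ℕ.m≤m+n _ (top⁺ n 1)) ⟩
    main n 0 + minor n 1 + top⁺ n 1                 <⟨ ℕ.m<m+n _ (s≤s z≤n) ⟩
    main n 0 + minor n 1 + top⁺ n 1 + 1             ∎
    where open ℕ.≤-Reasoning

  -- In genus 0 the constant term 1 of `minor` cancels against the correction -1, which rules out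
  -- planar embeddings.
  below : ∀ i → i < 1 → X i ≡ Y i
  below zero _ = trans (cong (_+ 1) (proj₁ (proj₂ vanishing)))
    (sym (cong₂ (λ x y → x + y + 0) minor-zero (proj₁ vanishing)))
  below (suc i) (s≤s ())

-- Positivity at the maximum genus

top⁻-even : ∀ m i → top⁻ (2 * m) i ≡ 0
top⁻-even zero    i       = refl
top⁻-even (suc m) i rewrite ℕ.*-suc 2 m with i
... | zero  = refl
... | suc j rewrite top⁻-even m j = refl

-- For odd n = 2 m + 1, `top⁻` is concentrated in degree m + 1, one below the maximum genus m + 2.
top⁻-odd : ∀ m → top⁻ (suc (2 * m)) (suc (suc m)) ≡ 0
top⁻-odd zero    = refl
top⁻-odd (suc m) = trans (cong (λ k → top⁻ (suc k) (suc (suc (suc m)))) (ℕ.*-suc 2 m)) (cong (4 *_) (top⁻-odd m))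

Q-positive : ∀ m b {n} → n ≡ 2 * m + b → 0 < f (suc n) m
Q-positive m b eq = ℕ.<-≤-trans (ℕ.m^n>0 2 m) (ℕ.≤-trans (G-positive m b) (ℕ.≤-reflexive (sym (f-G m b eq))))

module _ (n j : ℕ) where

  lower upper : ℕ
  lower = minor n j + top⁻ n (suc j) + 0
  upper = main n j + minor n (suc j) + top⁺ n (suc j) + one j

  top-from : minor n j < main n j → top⁻ n (suc j) ≡ 0 → lower < upper
  top-from lt eq = ℕ.≤-<-trans (ℕ.≤-reflexive (trans (ℕ.+-identityʳ _) (trans (cong (minor n j +_) eq) (ℕ.+-identityʳ _))))
    (ℕ.<-≤-trans lt (ℕ.≤-trans (ℕ.m≤m+n _ _) (ℕ.≤-trans (ℕ.m≤m+n _ _) (ℕ.m≤m+n _ _))))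

top-even : ∀ m → lower (2 * m) m < upper (2 * m) m
top-even m = top-from (2 * m) m (begin-strict
  minor n m                  ≤⟨ minor≤ n m ⟩
  4 ^ m * q                  <⟨ ℕ.m<m+n (4 ^ m * q) (ℕ.*-mono-≤ (ℕ.m^n>0 4 m) q>0) ⟩
  4 ^ m * q + 4 ^ m * q      ≡⟨ lemma (4 ^ m) q ⟩
  2 * 4 ^ m * q              ≡⟨ cong (λ p → 2 * p * q) (ℕ.^-*-assoc 2 2 m) ⟩
  2 ^ suc n * q              ≡⟨ main-Q n m ⟨
  main n m                   ∎) (top⁻-even m (suc m))
  where
  open ℕ.≤-Reasoning
  n = 2 * m
  q = Q n m
  q>0 : 0 < q
  q>0 = ℕ.<-≤-trans (Q-positive m 0 (sym (ℕ.+-identityʳ n))) (ℕ.≤-trans (ℕ.m≤m+n _ _) (ℕ.m≤m+n _ _))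
  lemma : ∀ p q → p * q + p * q ≡ 2 * p * q
  lemma = solve-∀

-- For even n a spare factor 2 separates the main from the minor term. Here 4^(m+1) = 2^(n+1), so
-- the gap has to come from `H` and `Q`, whose difference y + z is positive because z is the last
-- nonzero coefficient of `f n`.
top-odd : ∀ m → lower (suc (2 * m)) (suc m) < upper (suc (2 * m)) (suc m)
top-odd m = top-from n (suc m) (begin-strict
  minor n (suc m)            ≡⟨ minor-H n (suc m) ⟩
  4 ^ suc m * H n (suc m)    <⟨ ℕ.*-monoʳ-< (4 ^ suc m) {{>-nonZero (ℕ.m^n>0 4 (suc m))}} H<Q ⟩
  4 ^ suc m * Q n (suc m)    ≡⟨ cong (_* Q n (suc m)) (trans (ℕ.^-*-assoc 2 2 (suc m)) (cong (2 ^_) (ℕ.*-suc 2 m))) ⟩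
  2 ^ suc n * Q n (suc m)    ≡⟨ main-Q n (suc m) ⟨
  main n (suc m)             ∎) (top⁻-odd m)
  where
  open ℕ.≤-Reasoning
  n = suc (2 * m)
  x = f (suc n) (suc m)
  y = f (suc n) m
  z = f n m
  H<Q : H n (suc m) < Q n (suc m)
  H<Q = ℕ.<-≤-trans (ℕ.m<m+n (x + y + 5 * z) (ℕ.<-≤-trans (Q-positive m 0 (sym (ℕ.+-identityʳ (2 * m)))) (ℕ.m≤n+m z y)))
    (ℕ.≤-reflexive (lemma x y z))
    where
    lemma : ∀ x y z → x + y + 5 * z + (y + z) ≡ x + 2 * y + 6 * z
    lemma = solve-∀

maxGenus-even : ∀ m → maxGenus (2 * m) ≡ suc m
maxGenus-even m = trans (cong (_/ 2) (lemma m)) (trans (+-distrib-/-∣ʳ 1 {suc m * 2} {2} (divides (suc m) refl)) (m*n/n≡m (suc m) 2))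
  where
  lemma : ∀ m → 2 * m + 3 ≡ 1 + suc m * 2
  lemma = solve-∀

maxGenus-odd : ∀ m → maxGenus (suc (2 * m)) ≡ suc (suc m)
maxGenus-odd m = trans (cong (_/ 2) (lemma m)) (m*n/n≡m (suc (suc m)) 2)
  where
  lemma : ∀ m → suc (2 * m) + 3 ≡ suc (suc m) * 2
  lemma = solve-∀

parity : ∀ n → (∃ λ m → n ≡ 2 * m) ⊎ (∃ λ m → n ≡ suc (2 * m))
parity zero = inj₁ (0 , refl)
parity (suc n) with parity n
... | inj₁ (m , refl) = inj₂ (m , refl)
... | inj₂ (m , refl) = inj₁ (suc m , sym (ℕ.*-suc 2 m))

top : ∀ n → shift (minor n) (maxGenus n) + top⁻ n (maxGenus n) + one (maxGenus n) <
  shift (main n) (maxGenus n) + minor n (maxGenus n) + top⁺ n (maxGenus n) + shift one (maxGenus n)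
top n with parity n
... | inj₁ (m , refl) rewrite maxGenus-even m = top-even m
... | inj₂ (m , refl) rewrite maxGenus-odd m  = top-odd m

large : ∀ n → 79 ≤ n → Theorem (suc n)
large n 79≤n = conclude n {X} {Y} {1} (closed-form n) (subst (Peaked X Y 1 (maxGenus n))
  (sym (crossPeak-large (suc n) (s≤s (ℕ.≤-trans (ℕ.m≤n+m 7 72) 79≤n)))) record
  { γ≤p     = ℕ.m≤n+m 1 _
  ; p≤M     = peak≤max
  ; bottom  = bottom
  ; top     = top n
  ; below   = below
  ; ascent  = ascent
  ; descent = descent
  })
  where open Large n 79≤n


theorem4p8 : (n : ℕ) → 1 ≤ n →
    ∃₂ λ γ γM →
    IsMinimumGenus (cross n) γ
    × IsMaximumGenus (cross n) γM
    × Unimodal γ γM (embeddingCount (cross n))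
    × IsPeak γ γM (embeddingCount (cross n)) (crossPeak n)
theorem4p8 (suc n) _ = [ small n , large n ]′ (ℕ.<-≤-connex n 79)
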